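{- Let $s,n\in\mathbb N$ with $s\le n$ and let $p,q,R,\eta>0$ satisfy $$q\le\tfrac1{16},\qquad p\le\frac{q}{2^{10}s^2},\qquad R\ge2^{ -6}pn,\qquad \eta=2^{ -2s-2}.$$ For every $s$-uniform hypergraph $\mathcal H$ with $n$ vertices there is a family $\mathcal X\subset 2^{V(\mathcal H)}$ with $|\mathcal X|\le4(2/q)^{8qn}$ such that: (i) if $L\subset V(\mathcal H)$ and $\mathcal H[L]$ is not $(p/q,\eta R)$-Janson, then $L\subset X$ for some $X\in\mathcal X$; (ii) for each $X\in\mathcal X$, $\mathcal H[X]$ is not $(p,R)$-Janson.
   Context: A hypergraph is identified with its edge set; $\mathcal H[L]=\{E\in\mathcal H:E\subset L\}$ with vertex set $L$. For $\nu:\mathcal G\to\mathbb R_{\ge0}$: $e(\nu)=\sum_{E\in\mathcal G}\nu(E)$, $d_\nu(L)=\sum_{E\in\mathcal G,L\subset E}\nu(E)$, $\Lambda_p(\nu)=\sum_{L\subset V(\mathcal G),|L|\ge2}d_\nu(L)^2p^{ -|L|}$. For $p,R>0$, $\mathcal G$ is $(p,R)$-Janson if there exists $\nu:\mathcal G\to\mathbb R_{\ge0}$ with $\Lambda_p(\nu)<e(\nu)^2/R$. -}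

module Defs where

open import Algebra.Bundles using (CommutativeRing; Semiring)
import Algebra.Definitions.RawSemiring as RawSemiringDefs
open import Data.Bool.Base using (Bool; _∧_; T)
open import Data.Bool.Properties using (T-∧; T?)
open import Data.Fin.Subset using (Subset; inside; outside; _⊆_; ∣_∣)
open import Data.Fin.Subset.Properties using (_⊆?_)
open import Data.Integer.Base as ℤ using (ℤ; +_; -[1+_])
open import Data.List.Base using (List; []; _∷_; _++_; map; foldr; filter; length)
open import Data.Nat.Base as ℕ using (ℕ; zero; suc)
open import Data.Nat.Properties using (_≤?_)
open import Data.Product.Base using (∃; _×_; _,_; proj₂)
open import Data.Rational.Unnormalised.Base as ℚᵘ using (ℚᵘ)
import Data.Vec.Base as Vec
open import Function.Bundles using (Equivalence)
open import Level using (0ℓ) renaming (suc to lsuc)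
open import Relation.Binary.Core using (Rel)
import Relation.Binary.Construct.NonStrictToStrict as Strict
open import Relation.Binary.PropositionalEquality.Core using (_≡_)
open import Relation.Binary.Structures using (IsTotalOrder)
open import Relation.Nullary.Decidable using (⌊_⌋; toWitness; _×-dec_)
open import Relation.Nullary.Negation using (¬_)
open import Relation.Unary using (Pred)

-- Dedekind-complete ordered fields, i.e. (classically, up to a unique
-- isomorphism) the real numbers.  The inverse and the supremum are total
-- functions, constrained only where they are meaningful.
record Reals : Set (lsuc 0ℓ) where
  field
    commutativeRing : CommutativeRing 0ℓ 0ℓ

  open CommutativeRing commutativeRing public

  infix 4 _≤_
  infix 8 _⁻¹

  field
    _≤_          : Rel Carrier 0ℓ
    isTotalOrder : IsTotalOrder _≈_ _≤_
    0≉1          : ¬ (0# ≈ 1#)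
    +-monoʳ-≤    : ∀ x {y z} → y ≤ z → x + y ≤ x + z
    *-nonneg     : ∀ {x y} → 0# ≤ x → 0# ≤ y → 0# ≤ x * y
    _⁻¹          : Carrier → Carrier
    ⁻¹-cong      : ∀ {x y} → x ≈ y → x ⁻¹ ≈ y ⁻¹
    ⁻¹-inverseʳ  : ∀ x → ¬ (x ≈ 0#) → x * x ⁻¹ ≈ 1#

  UpperBound : Pred Carrier 0ℓ → Carrier → Set
  UpperBound P b = ∀ x → P x → x ≤ b

  field
    sup       : Pred Carrier 0ℓ → Carrier
    sup-upper : ∀ P → ∃ P → ∃ (UpperBound P) → UpperBound P (sup P)
    sup-least : ∀ P → ∃ P → ∃ (UpperBound P) → ∀ b → UpperBound P b → sup P ≤ b

  open Strict _≈_ _≤_ public using (_<_)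
  open RawSemiringDefs (Semiring.rawSemiring semiring) public using (_^_) renaming (_×_ to _·_)

  infixl 7 _/_
  infixr 8 _^ℤ_ _^ℝ_

  _/_ : Carrier → Carrier → Carrier
  x / y = x * y ⁻¹

  fromℕ : ℕ → Carrier
  fromℕ n = n · 1#

  fromℤ : ℤ → Carrier
  fromℤ (+ n)    = fromℕ n
  fromℤ -[1+ n ] = - fromℕ (suc n)

  fromℚᵘ : ℚᵘ → Carrier
  fromℚᵘ r = fromℤ (ℚᵘ.↥ r) / fromℕ (ℚᵘ.↧ₙ r)

  _^ℤ_ : Carrier → ℤ → Carrier
  a ^ℤ (+ n)    = a ^ n
  a ^ℤ -[1+ n ] = (a ^ suc n) ⁻¹

  IsRationalPower : Carrier → ℚᵘ → Carrier → Set
  IsRationalPower a r z = 0# ≤ z × z ^ ℚᵘ.↧ₙ r ≈ a ^ℤ ℚᵘ.↥ r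

  -- Real powers of a base a ≥ 1, as a^x = sup { a^r : r rational, r ≤ x }.
  -- Not meaningful for a < 1.
  _^ℝ_ : Carrier → Carrier → Carrier
  a ^ℝ x = sup (λ z → ∃ λ r → fromℚᵘ r ≤ x × IsRationalPower a r z)

  sumOver : {A : Set} → List A → (A → Carrier) → Carrier
  sumOver xs f = foldr _+_ 0# (map f xs)

subsets : ∀ N → List (Subset N)
subsets zero    = Vec.[] ∷ []
subsets (suc N) = map (outside Vec.∷_) (subsets N) ++ map (inside Vec.∷_) (subsets N)

-- Sets of subsets of Fin N, by characteristic function.
Family : ℕ → Set
Family N = Subset N → Bool

infix 4 _∈ᶠ_

_∈ᶠ_ : ∀ {N} → Subset N → Family N → Set
A ∈ᶠ F = T (F A)

members : ∀ {N} → Family N → List (Subset N)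
members {N} F = filter (λ A → T? (F A)) (subsets N)

card : ∀ {N} → Family N → ℕ
card F = length (members F)

-- Vertex sets range over subsets of an ambient Fin N, so that 𝓗 and 𝓗[ L ]
-- are objects of the same type with their own vertex sets.
record Hypergraph (N : ℕ) : Set where
  field
    V   : Subset N
    E   : Family N
    E⊆V : ∀ {A} → A ∈ᶠ E → A ⊆ V

open Hypergraph public

Uniform : ∀ {N} → ℕ → Hypergraph N → Set
Uniform s H = ∀ A → A ∈ᶠ E H → ∣ A ∣ ≡ s

infix 9 _[_]

_[_] : ∀ {N} → Hypergraph N → Subset N → Hypergraph N
H [ L ] = record
  { V   = L
  ; E   = λ A → E H A ∧ ⌊ A ⊆? L ⌋
  ; E⊆V = λ {A} A∈E → toWitness {a? = A ⊆? L} (proj₂ (Equivalence.to (T-∧ {E H A}) A∈E))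
  }

module Weights (ℝ : Reals) {N : ℕ} (G : Hypergraph N) where
  open Reals ℝ

  -- A weight function on the edges is given on all subsets of Fin N; values
  -- off the edge set are never used.
  e : (Subset N → Carrier) → Carrier
  e ν = sumOver (members (E G)) ν

  d : (Subset N → Carrier) → Subset N → Carrier
  d ν L = sumOver (filter (L ⊆?_) (members (E G))) ν

  Λ : Carrier → (Subset N → Carrier) → Carrier
  Λ p ν = sumOver (filter (λ L → (L ⊆? V G) ×-dec (2 ≤? ∣ L ∣)) (subsets N))
                  (λ L → d ν L ^ 2 * p ^ℤ (ℤ.- (+ ∣ L ∣)))

  Janson : Carrier → Carrier → Set
  Janson p R = ∃ λ ν → (∀ A → A ∈ᶠ E G → 0# ≤ ν A) × Λ p ν < e ν ^ 2 / R

Janson : (ℝ : Reals) {N : ℕ} → Hypergraph N → (p R : Reals.Carrier ℝ) → Set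
Janson ℝ G = Weights.Janson ℝ G

{-# OPTIONS --safe #-}

-- Fix a uniformly random 𝐋 from the sets that are still to be covered, and
-- let W be a largest set of vertices with P(𝐋 ∩ W = ∅) ≥ b^|W|.  Its
-- complement X contains a b^n-proportion of these sets, so choosing containers
-- greedily uses few of them.  It remains to see that H[X] is not (p,R)-Janson.
--
-- By maximality of W, every U ⊆ X is hit by 𝐋 outside an event of probability
-- at most b^|U|.  Suppose that ν witnesses that H[X] is (p,R)-Janson.  Reveal a
-- random A ⊆ 𝐋 by going through X in order of decreasing ν-degree: a vertex v
-- which, given the past, lies in 𝐋 with conditional probability at least q is
-- put into A with conditional probability exactly q₀ = q/(16s²), by thinning
-- the event v ∈ 𝐋; other vertices stay pending until they become likely.  The
-- hitting property keeps the number of pending vertices in every initial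
-- segment small, so A behaves like a q₀-random subset of X, and a second-moment
-- computation shows that it retains half of the expected ν-mass.  On the other
-- hand A contains any given S ⊆ 𝐋 with probability at most (16s²)^{-|S|}, so
-- averaging the measures ν restricted to A over the randomness of A given 𝐋
-- produces a measure on H[𝐋] which shows that some L is (p/q, ηR)-Janson.

module Submission where

open import Algebra.Bundles using (RawRing)
import Algebra.Properties.CommutativeSemiring.Exp as Exp
import Algebra.Properties.Ring as RingProperties
import Algebra.Solver.Ring as RingSolver
import Algebra.Solver.Ring.AlmostCommutativeRing as ACR
open import Axiom.ExcludedMiddle using (ExcludedMiddle)
open import Data.Bool.Base using (Bool; true; false; _∧_; _∨_; not; if_then_else_; T)
open import Data.Bool.Properties as BoolP using (T?)
open import Data.Empty using (⊥-elim)
open import Data.Fin.Base using (Fin; zero; suc)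
import Data.Fin.Properties as FinP
open import Data.Fin.Subset using (Subset; inside; outside; _⊆_; ∣_∣; _∩_)
open import Data.Fin.Subset.Properties using (_⊆?_; p⊆q⇒∣p∣≤∣q∣; drop-∷-⊆; out⊆; in⊆in)
open import Data.Integer.Base as ℤ using (ℤ; +_; -[1+_])
import Data.Integer.Properties as ℤP
open import Data.List.Base using (List; []; _∷_; _++_; map; filter; length; allFin)
import Data.List.Membership.DecPropositional as DecMembership
open import Data.List.Membership.Propositional using (_∈_)
open import Data.List.Membership.Propositional.Properties using (∈-map⁺; ∈-++⁺ˡ; ∈-++⁺ʳ; ∈-filter⁺; ∈-filter⁻; ∈-allFin; ∈-length)
import Data.List.Properties as ListP
open import Data.List.Relation.Binary.Permutation.Propositional as Perm using (_↭_)
open import Data.List.Relation.Binary.Permutation.Propositional.Properties using (All-resp-↭; ∈-resp-↭)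
open import Data.List.Relation.Unary.All as All using (All; []; _∷_)
import Data.List.Relation.Unary.All.Properties as AllP
open import Data.List.Relation.Unary.AllPairs as AllPairs using ([]; _∷_; AllPairs)
open import Data.List.Relation.Unary.Any as Any using (here; there; Any)
open import Data.List.Relation.Unary.Unique.Propositional using (Unique)
import Data.List.Relation.Unary.Unique.Propositional.Properties as UniqueP
open import Data.Maybe.Base using (Maybe; just; nothing)
open import Data.Nat.Base as ℕ using (ℕ; zero; suc)
import Data.Nat.DivMod as DivMod
import Data.Nat.Properties as ℕP
open import Data.Nat.Solver using (module +-*-Solver)
open import Data.Product.Base using (∃; _×_; _,_; proj₁; proj₂; ∃₂)
open import Data.Rational.Unnormalised.Base using (mkℚᵘ)
open import Data.Sum.Base using (_⊎_; inj₁; inj₂)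
open import Data.Unit.Base using (tt; ⊤)
open import Data.Vec.Base as Vec using ([]; _∷_; lookup; _[_]≔_; tabulate)
import Data.Vec.Properties as VecP
open import Function.Base using (_∘_)
open import Function.Bundles using (Equivalence)
open import Level using (0ℓ)
open import Relation.Binary.Bundles using (Poset)
import Relation.Binary.Construct.NonStrictToStrict as Strict
open import Relation.Binary.PropositionalEquality.Core as ≡ using (_≡_; _≢_)
import Relation.Binary.Reasoning.PartialOrder as PosetReasoning
import Relation.Binary.Reasoning.Setoid as SetoidReasoning
open import Relation.Binary.Structures using (IsTotalOrder)
open import Relation.Nullary.Decidable using (yes; no; Dec; does; dec-true; dec-false; _×-dec_; isYes≗does)
open import Relation.Nullary.Negation using (¬_)
open import Relation.Unary using (Pred; Decidable)
open import Defs

-- The obstacle is that conditioning on earlier answers can make a vertex unlikely to lie in `𝐋`,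
-- and the edges through such pending vertices are lost. The order by degree makes this harmless: a
-- bound on the expected number of pending vertices in every initial segment becomes, by Abel
-- summation, a bound on the degree lost, namely the same fraction of the total degree, which is at
-- most s. The factor 16s² in q₀ keeps that fraction of order 1/s². Keeping half of the mass costs a
-- factor 4 after squaring, and the sets S ⊆ E ∩ E′ cost at most 4^s; together they give η =
-- 2^(-2s-2). Logarithms are avoided. The given q is rounded down to a power 2^(-ℓ), b is a power of
-- y = 1 - q₀, and the entropy estimate behind the bound on pending vertices compares two powers of
-- y, that is, two natural exponents. The greedy cover costs a further factor n + 1, which the
-- exponent absorbs once qn ≥ 4. If H itself is (p,R)-Janson, then pn ≥ 1/512 and this holds;
-- otherwise V(H) is the only container. For s = 1, where Λ vanishes, one container is written down
-- directly.

-- Numerals, and a ring solver with integer coefficients.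

module Numerals (ℝ : Reals) where
  open Reals ℝ hiding (zero)
  open RingProperties ring using (-0#≈0#; -‿involutive; -‿distribˡ-*; -‿distribʳ-*; -‿+-comm)
  open SetoidReasoning setoid

  -- Unlike fromℕ, this makes ι 1 and 1# definitionally equal, which the ring
  -- solver relies on.
  ι : ℕ → Carrier
  ι zero          = 0#
  ι (suc zero)    = 1#
  ι (suc (suc n)) = 1# + ι (suc n)

  ι-suc : ∀ n → ι (suc n) ≈ 1# + ι n
  ι-suc zero    = sym (+-identityʳ 1#)
  ι-suc (suc n) = refl

  fromℕ≈ι : ∀ n → fromℕ n ≈ ι n
  fromℕ≈ι zero    = refl
  fromℕ≈ι (suc n) = trans (+-congˡ (fromℕ≈ι n)) (sym (ι-suc n))

  ι-+ : ∀ m n → ι (m ℕ.+ n) ≈ ι m + ι n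
  ι-+ zero    n = sym (+-identityˡ _)
  ι-+ (suc m) n = begin
    ι (suc (m ℕ.+ n))  ≈⟨ ι-suc (m ℕ.+ n) ⟩
    1# + ι (m ℕ.+ n)  ≈⟨ +-congˡ (ι-+ m n) ⟩
    1# + (ι m + ι n)  ≈⟨ +-assoc _ _ _ ⟨
    1# + ι m + ι n  ≈⟨ +-congʳ (ι-suc m) ⟨
    ι (suc m) + ι n  ∎

  ι-* : ∀ m n → ι (m ℕ.* n) ≈ ι m * ι n
  ι-* zero    n = sym (zeroˡ _)
  ι-* (suc m) n = begin
    ι (n ℕ.+ m ℕ.* n)  ≈⟨ ι-+ n (m ℕ.* n) ⟩
    ι n + ι (m ℕ.* n)  ≈⟨ +-cong (sym (*-identityˡ _)) (ι-* m n) ⟩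
    1# * ι n + ι m * ι n ≈⟨ distribʳ _ _ _ ⟨
    (1# + ι m) * ι n  ≈⟨ *-congʳ (ι-suc m) ⟨
    ι (suc m) * ι n  ∎

  ιℤ : ℤ → Carrier
  ιℤ (+ n)    = ι n
  ιℤ -[1+ n ] = - ι (suc n)

  private
    ιℤ-neg : ∀ i → ιℤ (ℤ.- i) ≈ - ιℤ i
    ιℤ-neg (+ zero)  = sym -0#≈0#
    ιℤ-neg (+ suc n) = refl
    ιℤ-neg -[1+ n ]  = sym (-‿involutive _)

    ιℤ-⊖ : ∀ m n → ιℤ (m ℤ.⊖ n) ≈ ι m + - ι n
    ιℤ-⊖ m zero = begin
      ιℤ (m ℤ.⊖ 0)  ≡⟨ ≡.cong ιℤ (ℤP.⊖-≥ {m} {0} ℕ.z≤n) ⟩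
      ι m  ≈⟨ +-identityʳ _ ⟨
      ι m + 0#  ≈⟨ +-congˡ -0#≈0# ⟨
      ι m + - 0#  ∎
    ιℤ-⊖ zero (suc n) = sym (+-identityˡ _)
    ιℤ-⊖ (suc m) (suc n) = begin
      ιℤ (suc m ℤ.⊖ suc n)  ≡⟨ ≡.cong ιℤ (ℤP.[1+m]⊖[1+n]≡m⊖n m n) ⟩
      ιℤ (m ℤ.⊖ n)  ≈⟨ ιℤ-⊖ m n ⟩
      ι m + - ι n  ≈⟨ +-identityˡ _ ⟨
      0# + (ι m + - ι n)  ≈⟨ +-congʳ (-‿inverseʳ 1#) ⟨
      (1# + - 1#) + (ι m + - ι n)  ≈⟨ +-assoc _ _ _ ⟩
      1# + (- 1# + (ι m + - ι n))  ≈⟨ +-congˡ (+-assoc _ _ _) ⟨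
      1# + (- 1# + ι m + - ι n)  ≈⟨ +-congˡ (+-congʳ (+-comm _ _)) ⟩
      1# + (ι m + - 1# + - ι n)  ≈⟨ +-congˡ (+-assoc _ _ _) ⟩
      1# + (ι m + (- 1# + - ι n))  ≈⟨ +-assoc _ _ _ ⟨
      1# + ι m + (- 1# + - ι n)  ≈⟨ +-cong (sym (ι-suc m)) (-‿+-comm _ _) ⟩
      ι (suc m) + - (1# + ι n)  ≈⟨ +-congˡ (-‿cong (ι-suc n)) ⟨
      ι (suc m) + - ι (suc n)  ∎

    ιℤ-+ : ∀ i j → ιℤ (i ℤ.+ j) ≈ ιℤ i + ιℤ j
    ιℤ-+ (+ m)    (+ n)    = ι-+ m n
    ιℤ-+ (+ m)    -[1+ n ] = ιℤ-⊖ m (suc n)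
    ιℤ-+ -[1+ m ] (+ n)    = trans (ιℤ-⊖ n (suc m)) (+-comm _ _)
    ιℤ-+ -[1+ m ] -[1+ n ] = begin
      - ι (suc (suc (m ℕ.+ n)))  ≡⟨ ≡.cong (λ k → - ι (suc k)) (≡.sym (ℕP.+-suc m n)) ⟩
      - ι (suc m ℕ.+ suc n)  ≈⟨ -‿cong (ι-+ (suc m) (suc n)) ⟩
      - (ι (suc m) + ι (suc n))  ≈⟨ -‿+-comm _ _ ⟨
      - ι (suc m) + - ι (suc n)  ∎

    ιℤ-* : ∀ i j → ιℤ (i ℤ.* j) ≈ ιℤ i * ιℤ j
    ιℤ-* (+ m) (+ n) = begin
      ιℤ (+ m ℤ.* + n)  ≡⟨ ≡.cong ιℤ (ℤP.pos-* m n) ⟨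
      ι (m ℕ.* n)  ≈⟨ ι-* m n ⟩
      ι m * ι n  ∎
    ιℤ-* (+ m) -[1+ n ] = begin
      ιℤ (+ m ℤ.* (ℤ.- + suc n))  ≡⟨ ≡.cong ιℤ (ℤP.neg-distribʳ-* (+ m) (+ suc n)) ⟨
      ιℤ (ℤ.- (+ m ℤ.* + suc n))  ≡⟨ ≡.cong (λ i → ιℤ (ℤ.- i)) (ℤP.pos-* m (suc n)) ⟨
      ιℤ (ℤ.- + (m ℕ.* suc n))  ≈⟨ ιℤ-neg (+ (m ℕ.* suc n)) ⟩
      - ι (m ℕ.* suc n)  ≈⟨ -‿cong (ι-* m (suc n)) ⟩
      - (ι m * ι (suc n))  ≈⟨ -‿distribʳ-* _ _ ⟩
      ι m * - ι (suc n)  ∎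
    ιℤ-* -[1+ m ] (+ n) = begin
      ιℤ ((ℤ.- + suc m) ℤ.* + n)  ≡⟨ ≡.cong ιℤ (ℤP.neg-distribˡ-* (+ suc m) (+ n)) ⟨
      ιℤ (ℤ.- (+ suc m ℤ.* + n))  ≡⟨ ≡.cong (λ i → ιℤ (ℤ.- i)) (ℤP.pos-* (suc m) n) ⟨
      ιℤ (ℤ.- + (suc m ℕ.* n))  ≈⟨ ιℤ-neg (+ (suc m ℕ.* n)) ⟩
      - ι (suc m ℕ.* n)  ≈⟨ -‿cong (ι-* (suc m) n) ⟩
      - (ι (suc m) * ι n)  ≈⟨ -‿distribˡ-* _ _ ⟩
      - ι (suc m) * ι n  ∎
    ιℤ-* -[1+ m ] -[1+ n ] = begin
      ι (suc m ℕ.* suc n)  ≈⟨ ι-* (suc m) (suc n) ⟩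
      ι (suc m) * ι (suc n)  ≈⟨ -‿involutive _ ⟨
      - - (ι (suc m) * ι (suc n))  ≈⟨ -‿cong (-‿distribˡ-* _ _) ⟩
      - (- ι (suc m) * ι (suc n))  ≈⟨ -‿distribʳ-* _ _ ⟩
      - ι (suc m) * - ι (suc n)  ∎

    ℤ-rawRing : RawRing _ _
    ℤ-rawRing = record
      { Carrier = ℤ ; _≈_ = _≡_ ; _+_ = ℤ._+_ ; _*_ = ℤ._*_ ; -_ = ℤ.-_ ; 0# = + 0 ; 1# = + 1 }

    morphism : ℤ-rawRing ACR.-Raw-AlmostCommutative⟶ ACR.fromCommutativeRing commutativeRing
    morphism = record
      { ⟦_⟧ = ιℤ ; +-homo = ιℤ-+ ; *-homo = ιℤ-* ; -‿homo = ιℤ-neg ; 0-homo = refl ; 1-homo = refl }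

    ιℤ≟ : ∀ i j → Maybe (ιℤ i ≈ ιℤ j)
    ιℤ≟ i j with i ℤP.≟ j
    ... | yes ≡.refl = just refl
    ... | no _       = nothing

  open RingSolver ℤ-rawRing (ACR.fromCommutativeRing commutativeRing) morphism ιℤ≟ public
    using (solve; _:=_; _:+_; _:*_; _:-_; :-_; _:^_; con)

-- Inequalities, inverses and powers in an ordered field.

module OrderedField (ℝ : Reals) where
  open Reals ℝ hiding (zero)
  open Numerals ℝ public
  open Exp commutativeSemiring public using (^-congˡ; ^-homo-*; ^-assocʳ; ^-distrib-*)
  open RingProperties ring public using (-0#≈0#; -‿involutive; -‿distribˡ-*; -‿distribʳ-*)
  open IsTotalOrder isTotalOrder public
    using (antisym; total; isPartialOrder; ≤-respˡ-≈; ≤-respʳ-≈)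
    renaming (refl to ≤-refl; trans to ≤-trans; reflexive to ≤-reflexive)

  poset : Poset 0ℓ 0ℓ 0ℓ
  poset = record { isPartialOrder = isPartialOrder }

  module ≤R = PosetReasoning poset
  open ≤R

  private
    variable
      x y z w : Carrier

  <⇒≤ : x < y → x ≤ y
  <⇒≤ = proj₁

  ≤-<-trans : x ≤ y → y < z → x < z
  ≤-<-trans = Strict.≤-<-trans _≈_ _≤_ ≤-trans antisym ≤-respˡ-≈

  <-≤-trans : x < y → y ≤ z → x < z
  <-≤-trans = Strict.<-≤-trans _≈_ _≤_ sym ≤-trans antisym ≤-respʳ-≈

  <⇒≱ : x < y → ¬ (y ≤ x)
  <⇒≱ = Strict.<⇒≱ _≈_ _≤_ antisym

  <-irrefl : ¬ (x < x)
  <-irrefl (_ , x≉x) = x≉x refl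

  +-mono-≤ : x ≤ y → z ≤ w → x + z ≤ y + w
  +-mono-≤ {x} {y} {z} {w} x≤y z≤w = begin
    x + z  ≤⟨ +-monoʳ-≤ x z≤w ⟩
    x + w  ≈⟨ +-comm x w ⟩
    w + x  ≤⟨ +-monoʳ-≤ w x≤y ⟩
    w + y  ≈⟨ +-comm w y ⟩
    y + w  ∎

  +-monoˡ-≤ : ∀ z → x ≤ y → x + z ≤ y + z
  +-monoˡ-≤ z x≤y = +-mono-≤ x≤y ≤-refl

  0≤-+ : 0# ≤ x → 0# ≤ y → 0# ≤ x + y
  0≤-+ {x} {y} 0≤x 0≤y = begin
    0#  ≈⟨ +-identityˡ 0# ⟨
    0# + 0#  ≤⟨ +-mono-≤ 0≤x 0≤y ⟩
    x + y  ∎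

  x≤x+y : 0# ≤ y → x ≤ x + y
  x≤x+y {y} {x} 0≤y = begin
    x  ≈⟨ +-identityʳ x ⟨
    x + 0#  ≤⟨ +-monoʳ-≤ x 0≤y ⟩
    x + y  ∎

  x≤y+x : 0# ≤ y → x ≤ y + x
  x≤y+x {y} {x} 0≤y = ≤-trans (x≤x+y 0≤y) (≤-reflexive (+-comm x y))

  x≤y⇒0≤y-x : x ≤ y → 0# ≤ y - x
  x≤y⇒0≤y-x {x} {y} x≤y = begin
    0#  ≈⟨ -‿inverseʳ x ⟨
    x - x  ≤⟨ +-monoˡ-≤ (- x) x≤y ⟩
    y - x  ∎

  0≤y-x⇒x≤y : 0# ≤ y - x → x ≤ y
  0≤y-x⇒x≤y {y} {x} 0≤y-x = begin
    x  ≈⟨ +-identityʳ x ⟨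
    x + 0#  ≤⟨ +-monoʳ-≤ x 0≤y-x ⟩
    x + (y - x)  ≈⟨ solve 2 (λ x y → x :+ (y :- x) := y) refl x y ⟩
    y  ∎

  +-cancelʳ-≤ : ∀ z → x + z ≤ y + z → x ≤ y
  +-cancelʳ-≤ {x} {y} z p = begin
    x  ≈⟨ solve 2 (λ x z → x := x :+ z :- z) refl x z ⟩
    x + z - z  ≤⟨ +-monoˡ-≤ (- z) p ⟩
    y + z - z  ≈⟨ solve 2 (λ x z → x :+ z :- z := x) refl y z ⟩
    y  ∎

  x+y≤z⇒x≤z-y : x + y ≤ z → x ≤ z - y
  x+y≤z⇒x≤z-y {x} {y} {z} p = +-cancelʳ-≤ y (begin
    x + y  ≤⟨ p ⟩
    z  ≈⟨ solve 2 (λ y z → z := z :- y :+ y) refl y z ⟩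
    z - y + y  ∎)

  -‿antimono-≤ : x ≤ y → - y ≤ - x
  -‿antimono-≤ {x} {y} x≤y = 0≤y-x⇒x≤y (begin
    0#  ≤⟨ x≤y⇒0≤y-x x≤y ⟩
    y - x  ≈⟨ solve 2 (λ x y → y :- x := :- x :- :- y) refl x y ⟩
    - x - - y  ∎)

  x-y≤x : 0# ≤ y → x - y ≤ x
  x-y≤x {y} {x} 0≤y = begin
    x - y  ≤⟨ x≤x+y 0≤y ⟩
    x - y + y ≈⟨ solve 2 (λ x y → x :- y :+ y := x) refl x y ⟩
    x  ∎

  *-monoʳ-≤ : 0# ≤ z → x ≤ y → z * x ≤ z * y
  *-monoʳ-≤ {z} {x} {y} 0≤z x≤y = 0≤y-x⇒x≤y (begin
    0#  ≤⟨ *-nonneg 0≤z (x≤y⇒0≤y-x x≤y) ⟩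
    z * (y - x)  ≈⟨ solve 3 (λ x y z → z :* (y :- x) := z :* y :- z :* x) refl x y z ⟩
    z * y - z * x  ∎)

  *-monoˡ-≤ : 0# ≤ z → x ≤ y → x * z ≤ y * z
  *-monoˡ-≤ {z} {x} {y} 0≤z x≤y = begin
    x * z  ≈⟨ *-comm x z ⟩
    z * x  ≤⟨ *-monoʳ-≤ 0≤z x≤y ⟩
    z * y  ≈⟨ *-comm z y ⟩
    y * z  ∎

  *-mono-≤ : 0# ≤ x → 0# ≤ w → x ≤ y → z ≤ w → x * z ≤ y * w
  *-mono-≤ {x} {w} {y} {z} 0≤x 0≤w x≤y z≤w = begin
    x * z  ≤⟨ *-monoʳ-≤ 0≤x z≤w ⟩
    x * w  ≤⟨ *-monoˡ-≤ 0≤w x≤y ⟩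
    y * w  ∎

  0≤x*x : ∀ x → 0# ≤ x * x
  0≤x*x x with total 0# x
  ... | inj₁ 0≤x = *-nonneg 0≤x 0≤x
  ... | inj₂ x≤0 = begin
    0#  ≤⟨ *-nonneg 0≤-x 0≤-x ⟩
    - x * - x  ≈⟨ solve 1 (λ x → :- x :* :- x := x :* x) refl x ⟩
    x * x  ∎
    where
    0≤-x : 0# ≤ - x
    0≤-x = ≤-trans (≤-reflexive (sym -0#≈0#)) (-‿antimono-≤ x≤0)

  0≤1 : 0# ≤ 1#
  0≤1 = ≤-trans (0≤x*x 1#) (≤-reflexive (*-identityˡ 1#))

  0<1 : 0# < 1#
  0<1 = 0≤1 , 0≉1

  <⇒≉0 : 0# < x → ¬ (x ≈ 0#)
  <⇒≉0 (_ , 0≉x) x≈0 = 0≉x (sym x≈0)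

  ⁻¹-inverseˡ : 0# < x → x ⁻¹ * x ≈ 1#
  ⁻¹-inverseˡ {x} 0<x = trans (*-comm _ _) (⁻¹-inverseʳ x (<⇒≉0 0<x))

  0<⇒*⁻¹≈1 : 0# < x → x * x ⁻¹ ≈ 1#
  0<⇒*⁻¹≈1 {x} 0<x = ⁻¹-inverseʳ x (<⇒≉0 0<x)

  ⁻¹-nonneg : 0# < x → 0# ≤ x ⁻¹
  ⁻¹-nonneg {x} 0<x with total 0# (x ⁻¹)
  ... | inj₁ 0≤x⁻¹ = 0≤x⁻¹
  ... | inj₂ x⁻¹≤0 = ⊥-elim (0≉1 (antisym 0≤1 (begin
    1#  ≈⟨ 0<⇒*⁻¹≈1 0<x ⟨
    x * x ⁻¹  ≤⟨ *-monoʳ-≤ (<⇒≤ 0<x) x⁻¹≤0 ⟩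
    x * 0#  ≈⟨ zeroʳ x ⟩
    0#  ∎)))

  *-cancelˡ-≤ : 0# < z → z * x ≤ z * y → x ≤ y
  *-cancelˡ-≤ {z} {x} {y} 0<z p = begin
    x  ≈⟨ lem x ⟩
    z ⁻¹ * (z * x)  ≤⟨ *-monoʳ-≤ (⁻¹-nonneg 0<z) p ⟩
    z ⁻¹ * (z * y)  ≈⟨ lem y ⟨
    y  ∎
    where
    lem : ∀ x → x ≈ z ⁻¹ * (z * x)
    lem x = trans (sym (*-identityˡ x)) (trans (*-congʳ (sym (⁻¹-inverseˡ 0<z))) (*-assoc _ _ _))

  *-cancelˡ-≈ : 0# < z → z * x ≈ z * y → x ≈ y
  *-cancelˡ-≈ 0<z p = antisym (*-cancelˡ-≤ 0<z (≤-reflexive p)) (*-cancelˡ-≤ 0<z (≤-reflexive (sym p)))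

  0<-* : 0# < x → 0# < y → 0# < x * y
  0<-* {x} {y} 0<x 0<y = *-nonneg (<⇒≤ 0<x) (<⇒≤ 0<y) , λ 0≈xy →
    proj₂ 0<y (*-cancelˡ-≈ 0<x (trans (zeroʳ x) 0≈xy))

  0<⁻¹ : 0# < x → 0# < x ⁻¹
  0<⁻¹ {x} 0<x = ⁻¹-nonneg 0<x , λ 0≈x⁻¹ → 0≉1 (begin-equality
    0#  ≈⟨ zeroʳ x ⟨
    x * 0#  ≈⟨ *-congˡ 0≈x⁻¹ ⟩
    x * x ⁻¹  ≈⟨ 0<⇒*⁻¹≈1 0<x ⟩
    1#  ∎)

  *-monoʳ-< : 0# < z → x < y → z * x < z * y
  *-monoʳ-< 0<z (x≤y , x≉y) = *-monoʳ-≤ (<⇒≤ 0<z) x≤y , λ eq → x≉y (*-cancelˡ-≈ 0<z eq)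

  x/y≤z : 0# < y → x ≤ z * y → x / y ≤ z
  x/y≤z {y} {x} {z} 0<y p = *-cancelˡ-≤ 0<y (begin
    y * (x * y ⁻¹)  ≈⟨ solve 3 (λ x y w → y :* (x :* w) := x :* (y :* w)) refl x y (y ⁻¹) ⟩
    x * (y * y ⁻¹)  ≈⟨ *-congˡ (0<⇒*⁻¹≈1 0<y) ⟩
    x * 1#  ≈⟨ *-identityʳ x ⟩
    x  ≤⟨ p ⟩
    z * y  ≈⟨ *-comm z y ⟩
    y * z  ∎)

  z≤x/y : 0# < y → z * y ≤ x → z ≤ x / y
  z≤x/y {y} {z} {x} 0<y p = *-cancelˡ-≤ 0<y (begin
    y * z  ≈⟨ *-comm y z ⟩
    z * y  ≤⟨ p ⟩
    x  ≈⟨ *-identityʳ x ⟨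
    x * 1#  ≈⟨ *-congˡ (0<⇒*⁻¹≈1 0<y) ⟨
    x * (y * y ⁻¹)  ≈⟨ solve 3 (λ x y w → y :* (x :* w) := x :* (y :* w)) refl x y (y ⁻¹) ⟨
    y * (x * y ⁻¹)  ∎)

  x≤z/y⇒x*y≤z : 0# < y → x ≤ z / y → x * y ≤ z
  x≤z/y⇒x*y≤z {y} {x} {z} 0<y p = begin
    x * y  ≤⟨ *-monoˡ-≤ (<⇒≤ 0<y) p ⟩
    z * y ⁻¹ * y  ≈⟨ *-assoc _ _ _ ⟩
    z * (y ⁻¹ * y) ≈⟨ *-congˡ (⁻¹-inverseˡ 0<y) ⟩
    z * 1#  ≈⟨ *-identityʳ z ⟩
    z  ∎

  ⁻¹-unique : 0# < x → x * y ≈ 1# → y ≈ x ⁻¹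
  ⁻¹-unique 0<x p = *-cancelˡ-≈ 0<x (trans p (sym (0<⇒*⁻¹≈1 0<x)))

  0≤ι : ∀ n → 0# ≤ ι n
  0≤ι zero          = ≤-refl
  0≤ι (suc zero)    = 0≤1
  0≤ι (suc (suc n)) = 0≤-+ 0≤1 (0≤ι (suc n))

  ι-mono : ∀ {m n} → m ℕ.≤ n → ι m ≤ ι n
  ι-mono {m} {n} m≤n = begin
    ι m  ≤⟨ x≤x+y (0≤ι (n ℕ.∸ m)) ⟩
    ι m + ι (n ℕ.∸ m)  ≈⟨ ι-+ m (n ℕ.∸ m) ⟨
    ι (m ℕ.+ (n ℕ.∸ m))  ≡⟨ ≡.cong ι (ℕP.m+[n∸m]≡n m≤n) ⟩
    ι n  ∎

  0<ι : ∀ n → 0# < ι (suc n)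
  0<ι n = <-≤-trans 0<1 (ι-mono {1} {suc n} (ℕ.s≤s ℕ.z≤n))

  0<ι′ : ∀ {n} → 1 ℕ.≤ n → 0# < ι n
  0<ι′ {suc n} _ = 0<ι n

  x<1+x : ∀ x → x < 1# + x
  x<1+x x = x≤y+x 0≤1 , λ eq → 0≉1 (begin-equality
    0#  ≈⟨ -‿inverseʳ x ⟨
    x - x  ≈⟨ +-congʳ eq ⟩
    1# + x - x  ≈⟨ solve 1 (λ x → con (+ 1) :+ x :- x := con (+ 1)) refl x ⟩
    1#  ∎)

  ι-cancel-≤ : ∀ {m n} → ι m ≤ ι n → m ℕ.≤ n
  ι-cancel-≤ {m} {n} p with ℕP.≤-total m n
  ... | inj₁ m≤n = m≤n
  ... | inj₂ n≤m with ℕP.m≤n⇒m<n∨m≡n n≤m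
  ...   | inj₂ ≡.refl = ℕP.≤-refl
  ...   | inj₁ n<m    = ⊥-elim (<⇒≱ (x<1+x (ι n)) (begin
    1# + ι n  ≈⟨ ι-suc n ⟨
    ι (suc n)  ≤⟨ ι-mono n<m ⟩
    ι m  ≤⟨ p ⟩
    ι n  ∎))

  ^-nonneg : ∀ n → 0# ≤ x → 0# ≤ x ^ n
  ^-nonneg zero    0≤x = 0≤1
  ^-nonneg (suc n) 0≤x = *-nonneg 0≤x (^-nonneg n 0≤x)

  ^-pos : ∀ n → 0# < x → 0# < x ^ n
  ^-pos zero    0<x = 0<1
  ^-pos (suc n) 0<x = 0<-* 0<x (^-pos n 0<x)

  ^-mono-≤ : ∀ n → 0# ≤ x → x ≤ y → x ^ n ≤ y ^ n
  ^-mono-≤ zero    0≤x x≤y = ≤-refl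
  ^-mono-≤ (suc n) 0≤x x≤y =
    *-mono-≤ 0≤x (^-nonneg n (≤-trans 0≤x x≤y)) x≤y (^-mono-≤ n 0≤x x≤y)

  1^n≈1 : ∀ n → 1# ^ n ≈ 1#
  1^n≈1 zero    = refl
  1^n≈1 (suc n) = trans (*-identityˡ _) (1^n≈1 n)

  ^-≤1 : ∀ n → 0# ≤ x → x ≤ 1# → x ^ n ≤ 1#
  ^-≤1 n 0≤x x≤1 = ≤-trans (^-mono-≤ n 0≤x x≤1) (≤-reflexive (1^n≈1 n))

  1≤^ : ∀ n → 1# ≤ x → 1# ≤ x ^ n
  1≤^ n 1≤x = ≤-trans (≤-reflexive (sym (1^n≈1 n))) (^-mono-≤ n 0≤1 1≤x)

  ^-antitone : ∀ {m n} → 0# ≤ x → x ≤ 1# → m ℕ.≤ n → x ^ n ≤ x ^ m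
  ^-antitone {x} {m} {n} 0≤x x≤1 m≤n = begin
    x ^ n  ≡⟨ ≡.cong (x ^_) (≡.sym (ℕP.m+[n∸m]≡n m≤n)) ⟩
    x ^ (m ℕ.+ (n ℕ.∸ m))  ≈⟨ ^-homo-* x m (n ℕ.∸ m) ⟩
    x ^ m * x ^ (n ℕ.∸ m)  ≤⟨ *-monoʳ-≤ (^-nonneg m 0≤x) (^-≤1 (n ℕ.∸ m) 0≤x x≤1) ⟩
    x ^ m * 1#  ≈⟨ *-identityʳ _ ⟩
    x ^ m  ∎

  ^-monoʳ-≤ : ∀ {m n} → 1# ≤ x → m ℕ.≤ n → x ^ m ≤ x ^ n
  ^-monoʳ-≤ {x} {m} {n} 1≤x m≤n = begin
    x ^ m  ≈⟨ *-identityʳ _ ⟨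
    x ^ m * 1#  ≤⟨ *-monoʳ-≤ (^-nonneg m (≤-trans 0≤1 1≤x)) (1≤^ (n ℕ.∸ m) 1≤x) ⟩
    x ^ m * x ^ (n ℕ.∸ m)  ≈⟨ ^-homo-* x m (n ℕ.∸ m) ⟨
    x ^ (m ℕ.+ (n ℕ.∸ m))  ≡⟨ ≡.cong (x ^_) (ℕP.m+[n∸m]≡n m≤n) ⟩
    x ^ n  ∎

  -- This stands in for taking logarithms: a comparison of two powers of `1# - q₀` becomes one of
  -- natural exponents.
  ^-cancel-≥ : ∀ {m n} → 0# < x → x < 1# → x ^ m ≤ x ^ n → n ℕ.≤ m
  ^-cancel-≥ {x} {m} {n} 0<x x<1 p with ℕP.≤-total n m
  ... | inj₁ n≤m = n≤m
  ... | inj₂ m≤n with ℕP.m≤n⇒m<n∨m≡n m≤n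
  ...   | inj₂ ≡.refl = ℕP.≤-refl
  ...   | inj₁ m<n    = ⊥-elim (<⇒≱ (*-monoʳ-< (^-pos m 0<x) x<1) (begin
    x ^ m * 1#  ≈⟨ *-identityʳ _ ⟩
    x ^ m  ≤⟨ p ⟩
    x ^ n  ≤⟨ ^-antitone (<⇒≤ 0<x) (<⇒≤ x<1) m<n ⟩
    x * x ^ m  ≈⟨ *-comm _ _ ⟩
    x ^ m * x  ∎))

  ^-cancel-≤ : ∀ n → 0# < y → x ^ suc n ≤ y ^ suc n → x ≤ y
  ^-cancel-≤ {y} {x} n 0<y p with total x y
  ... | inj₁ x≤y = x≤y
  ... | inj₂ y≤x = *-cancelˡ-≤ (^-pos n (<-≤-trans 0<y y≤x)) (begin
    x ^ n * x  ≈⟨ *-comm _ _ ⟩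
    x * x ^ n  ≤⟨ p ⟩
    y * y ^ n  ≤⟨ *-monoʳ-≤ (<⇒≤ 0<y) (^-mono-≤ n (<⇒≤ 0<y) y≤x) ⟩
    y * x ^ n  ≈⟨ *-comm _ _ ⟩
    x ^ n * y  ∎)

  bernoulli : ∀ n → 0# ≤ x → 1# + ι n * x ≤ (1# + x) ^ n
  bernoulli {x} zero 0≤x = ≤-reflexive (solve 1 (λ x → con (+ 1) :+ con (+ 0) :* x := con (+ 1)) refl x)
  bernoulli {x} (suc n) 0≤x = begin
    1# + ι (suc n) * x  ≈⟨ +-congˡ (*-congʳ (ι-suc n)) ⟩
    1# + (1# + ι n) * x  ≤⟨ x≤x+y (*-nonneg (0≤ι n) (0≤x*x x)) ⟩
    1# + (1# + ι n) * x + ι n * (x * x)  ≈⟨ solve 2 (λ x k → con (+ 1) :+ (con (+ 1) :+ k) :* x :+ k :* (x :* x) := (con (+ 1) :+ x) :* (con (+ 1) :+ k :* x)) refl x (ι n) ⟩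
    (1# + x) * (1# + ι n * x)  ≤⟨ *-monoʳ-≤ (0≤-+ 0≤1 0≤x) (bernoulli n 0≤x) ⟩
    (1# + x) * (1# + x) ^ n  ∎

  bernoulli⁻ : ∀ n → 0# ≤ x → x ≤ 1# → 1# - ι n * x ≤ (1# - x) ^ n
  bernoulli⁻ {x} zero 0≤x x≤1 = ≤-reflexive (solve 1 (λ x → con (+ 1) :- con (+ 0) :* x := con (+ 1)) refl x)
  bernoulli⁻ {x} (suc n) 0≤x x≤1 = begin
    1# - ι (suc n) * x  ≈⟨ +-congˡ (-‿cong (*-congʳ (ι-suc n))) ⟩
    1# - (1# + ι n) * x  ≤⟨ x≤x+y (*-nonneg (0≤ι n) (0≤x*x x)) ⟩
    1# - (1# + ι n) * x + ι n * (x * x)  ≈⟨ solve 2 (λ x k → con (+ 1) :- (con (+ 1) :+ k) :* x :+ k :* (x :* x) := (con (+ 1) :- x) :* (con (+ 1) :- k :* x)) refl x (ι n) ⟩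
    (1# - x) * (1# - ι n * x)  ≤⟨ *-monoʳ-≤ (x≤y⇒0≤y-x x≤1) (bernoulli⁻ n 0≤x x≤1) ⟩
    (1# - x) * (1# - x) ^ n  ∎

-- Boolean inclusion of vertex sets.

infix 7 _⊆ᵇ_

-- Defined by recursion along the vectors, so that it reduces one vertex at a time and sums over all
-- subsets can be computed by induction on `N`.
_⊆ᵇ_ : ∀ {N} → Subset N → Subset N → Bool
[]      ⊆ᵇ []      = true
(a ∷ A) ⊆ᵇ (b ∷ B) = (not a ∨ b) ∧ A ⊆ᵇ B

⊆ᵇ⇒⊆ : ∀ {N} (A B : Subset N) → T (A ⊆ᵇ B) → A ⊆ B
⊆ᵇ⇒⊆ []            []           _ ()
⊆ᵇ⇒⊆ (outside ∷ A) (b ∷ B)      p = out⊆ (⊆ᵇ⇒⊆ A B p)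
⊆ᵇ⇒⊆ (inside ∷ A)  (inside ∷ B) p = in⊆in (⊆ᵇ⇒⊆ A B p)

⊆⇒⊆ᵇ : ∀ {N} (A B : Subset N) → A ⊆ B → T (A ⊆ᵇ B)
⊆⇒⊆ᵇ []            []            _ = tt
⊆⇒⊆ᵇ (outside ∷ A) (b ∷ B)       p = ⊆⇒⊆ᵇ A B (drop-∷-⊆ p)
⊆⇒⊆ᵇ (inside ∷ A)  (inside ∷ B)  p = ⊆⇒⊆ᵇ A B (drop-∷-⊆ p)
⊆⇒⊆ᵇ (inside ∷ A)  (outside ∷ B) p with p (Vec.here)
... | ()

does-⊆? : ∀ {N} (A B : Subset N) → does (A ⊆? B) ≡ A ⊆ᵇ B
does-⊆? A B with A ⊆? B | A ⊆ᵇ B in eq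
... | yes _ | true  = ≡.refl
... | no _  | false = ≡.refl
... | yes p | false = ⊥-elim (≡.subst T eq (⊆⇒⊆ᵇ A B p))
... | no ¬p | true  = ⊥-elim (¬p (⊆ᵇ⇒⊆ A B (≡.subst T (≡.sym eq) tt)))

⊆ᵇ-∩ : ∀ {N} (A B C : Subset N) → A ⊆ᵇ (B ∩ C) ≡ (A ⊆ᵇ B) ∧ (A ⊆ᵇ C)
⊆ᵇ-∩ [] [] [] = ≡.refl
⊆ᵇ-∩ (outside ∷ A) (b ∷ B) (c ∷ C) = ⊆ᵇ-∩ A B C
⊆ᵇ-∩ (inside ∷ A) (outside ∷ B) (c ∷ C) = ≡.refl
⊆ᵇ-∩ (inside ∷ A) (inside ∷ B) (inside ∷ C) = ⊆ᵇ-∩ A B C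
⊆ᵇ-∩ (inside ∷ A) (inside ∷ B) (outside ∷ C) with A ⊆ᵇ B
... | true  = ≡.refl
... | false = ≡.refl

⊆ᵇ-lookup : ∀ {N} (A B : Subset N) → T (A ⊆ᵇ B) → ∀ v → lookup A v ≡ inside → lookup B v ≡ inside
⊆ᵇ-lookup A B p v eq = VecP.[]=⇒lookup (⊆ᵇ⇒⊆ A B p (VecP.lookup⇒[]= v A eq))

lookup-⊆ᵇ : ∀ {N} (A B : Subset N) → (∀ v → lookup A v ≡ inside → lookup B v ≡ inside) → T (A ⊆ᵇ B)
lookup-⊆ᵇ A B f = ⊆⇒⊆ᵇ A B (λ {v} v∈A → VecP.lookup⇒[]= v B (f v (VecP.[]=⇒lookup v∈A)))

⊆ᵇ⇒∣∣≤ : ∀ {N} (A B : Subset N) → T (A ⊆ᵇ B) → ∣ A ∣ ℕ.≤ ∣ B ∣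
⊆ᵇ⇒∣∣≤ A B p = p⊆q⇒∣p∣≤∣q∣ (⊆ᵇ⇒⊆ A B p)

∈-subsets : ∀ {N} (A : Subset N) → A ∈ subsets N
∈-subsets []            = here ≡.refl
∈-subsets (outside ∷ A) = ∈-++⁺ˡ (∈-map⁺ (outside ∷_) (∈-subsets A))
∈-subsets {suc N} (inside ∷ A)  = ∈-++⁺ʳ (map (outside ∷_) (subsets N)) (∈-map⁺ (inside ∷_) (∈-subsets A))

∣remove∣ : ∀ {N} (A : Subset N) v → lookup A v ≡ inside → suc ∣ A [ v ]≔ outside ∣ ≡ ∣ A ∣
∣remove∣ (inside ∷ A)  zero    _  = ≡.refl
∣remove∣ (inside ∷ A)  (suc v) eq = ≡.cong suc (∣remove∣ A v eq)
∣remove∣ (outside ∷ A) (suc v) eq = ∣remove∣ A v eq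

-- Indicators, finite sums and products.

module Sums (ℝ : Reals) where
  open Reals ℝ hiding (zero)
  open OrderedField ℝ
  open ≤R

  ind : Bool → Carrier
  ind true  = 1#
  ind false = 0#

  0≤ind : ∀ b → 0# ≤ ind b
  0≤ind true  = 0≤1
  0≤ind false = ≤-refl

  ind≤1 : ∀ b → ind b ≤ 1#
  ind≤1 true  = ≤-refl
  ind≤1 false = 0≤1

  ind-∧ : ∀ a b → ind (a ∧ b) ≈ ind a * ind b
  ind-∧ true  b = sym (*-identityˡ _)
  ind-∧ false b = sym (zeroˡ _)

  ind-mono : ∀ a b → (T a → T b) → ind a ≤ ind b
  ind-mono false b     f = 0≤ind b
  ind-mono true  true  f = ≤-refl
  ind-mono true  false f = ⊥-elim (f tt)

  module _ {A : Set} where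
    private
      variable
        f g : A → Carrier

    sum-cong : ∀ xs → (∀ x → f x ≈ g x) → sumOver xs f ≈ sumOver xs g
    sum-cong []       eq = refl
    sum-cong (x ∷ xs) eq = +-cong (eq x) (sum-cong xs eq)

    sum-mono-All : ∀ {xs} → All (λ x → f x ≤ g x) xs → sumOver xs f ≤ sumOver xs g
    sum-mono-All []       = ≤-refl
    sum-mono-All (p ∷ ps) = +-mono-≤ p (sum-mono-All ps)

    sum-mono : ∀ xs → (∀ x → f x ≤ g x) → sumOver xs f ≤ sumOver xs g
    sum-mono xs le = sum-mono-All (All.universal le xs)

    sum-0 : ∀ (xs : List A) → sumOver xs (λ _ → 0#) ≈ 0#
    sum-0 []       = refl
    sum-0 (x ∷ xs) = trans (+-identityˡ _) (sum-0 xs)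

    sum-nonneg : ∀ xs → (∀ x → 0# ≤ f x) → 0# ≤ sumOver xs f
    sum-nonneg xs le = ≤-trans (≤-reflexive (sym (sum-0 xs))) (sum-mono xs le)

    sum-const : ∀ (xs : List A) c → sumOver xs (λ _ → c) ≈ ι (length xs) * c
    sum-const []       c = sym (zeroˡ c)
    sum-const (x ∷ xs) c = begin-equality
      c + sumOver xs (λ _ → c)  ≈⟨ +-congˡ (sum-const xs c) ⟩
      c + ι (length xs) * c  ≈⟨ solve 2 (λ c n → c :+ n :* c := (con (+ 1) :+ n) :* c) refl c _ ⟩
      (1# + ι (length xs)) * c  ≈⟨ *-congʳ (ι-suc (length xs)) ⟨
      ι (suc (length xs)) * c  ∎

    sum-+ : ∀ xs (f g : A → Carrier) → sumOver xs (λ x → f x + g x) ≈ sumOver xs f + sumOver xs g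
    sum-+ []       f g = sym (+-identityˡ 0#)
    sum-+ (x ∷ xs) f g = trans (+-congˡ (sum-+ xs f g))
      (solve 4 (λ a b c d → a :+ b :+ (c :+ d) := a :+ c :+ (b :+ d)) refl _ _ _ _)

    sum-*ˡ : ∀ xs c (f : A → Carrier) → sumOver xs (λ x → c * f x) ≈ c * sumOver xs f
    sum-*ˡ []       c f = sym (zeroʳ c)
    sum-*ˡ (x ∷ xs) c f = trans (+-congˡ (sum-*ˡ xs c f)) (sym (distribˡ _ _ _))

    sum-*ʳ : ∀ xs c (f : A → Carrier) → sumOver xs (λ x → f x * c) ≈ sumOver xs f * c
    sum-*ʳ xs c f = trans (sum-cong xs (λ x → *-comm _ _)) (trans (sum-*ˡ xs c f) (*-comm _ _))

    sum-term : ∀ {xs x} → x ∈ xs → (∀ y → 0# ≤ f y) → f x ≤ sumOver xs f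
    sum-term {xs = _ ∷ xs} (here ≡.refl) 0≤f = x≤x+y (sum-nonneg xs 0≤f)
    sum-term (there x∈xs)       0≤f = ≤-trans (sum-term x∈xs 0≤f) (x≤y+x (0≤f _))

    sum-filter : ∀ {ℓ} {P : Pred A ℓ} (P? : Decidable P) xs (f : A → Carrier) →
                 sumOver (filter P? xs) f ≈ sumOver xs (λ x → ind (does (P? x)) * f x)
    sum-filter P? []       f = refl
    sum-filter P? (x ∷ xs) f with does (P? x)
    ... | true  = +-cong (sym (*-identityˡ _)) (sum-filter P? xs f)
    ... | false = trans (sum-filter P? xs f) (sym (trans (+-congʳ (zeroˡ _)) (+-identityˡ _)))

    length-filter : ∀ {ℓ} {P : Pred A ℓ} (P? : Decidable P) xs →
                    ι (length (filter P? xs)) ≈ sumOver xs (λ x → ind (does (P? x)))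
    length-filter P? []       = refl
    length-filter P? (x ∷ xs) with does (P? x)
    ... | true  = trans (ι-suc (length (filter P? xs))) (+-congˡ (length-filter P? xs))
    ... | false = trans (length-filter P? xs) (sym (+-identityˡ _))

    sum-++ : ∀ xs ys (f : A → Carrier) → sumOver (xs ++ ys) f ≈ sumOver xs f + sumOver ys f
    sum-++ []       ys f = sym (+-identityˡ _)
    sum-++ (x ∷ xs) ys f = trans (+-congˡ (sum-++ xs ys f)) (sym (+-assoc _ _ _))

    -- Cauchy-Schwarz against the constant 1, by induction: the cross terms of a new entry are
    -- bounded through 2ab ≤ a² + b².
    sum-square : ∀ xs (f : A → Carrier) →
                 sumOver xs f * sumOver xs f ≤ ι (length xs) * sumOver xs (λ x → f x * f x)
    sum-square []       f = ≤-reflexive (trans (zeroˡ _) (sym (zeroˡ _)))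
    sum-square (x ∷ xs) f = begin
      (a + S) * (a + S)  ≈⟨ solve 2 (λ a S → (a :+ S) :* (a :+ S) := a :* a :+ con (+ 2) :* (a :* S) :+ S :* S) refl a S ⟩
      a * a + ι 2 * (a * S) + S * S  ≤⟨ +-mono-≤ (+-monoʳ-≤ (a * a) cross) (sum-square xs f) ⟩
      a * a + (n * (a * a) + Q) + n * Q  ≈⟨ solve 3 (λ a n Q → a :* a :+ (n :* (a :* a) :+ Q) :+ n :* Q := (con (+ 1) :+ n) :* (a :* a :+ Q)) refl a n Q ⟩
      (1# + n) * (a * a + Q)  ≈⟨ *-congʳ (ι-suc (length xs)) ⟨
      ι (suc (length xs)) * (a * a + Q)  ∎
      where
      a S n Q : Carrier
      a = f x
      S = sumOver xs f
      n = ι (length xs)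
      Q = sumOver xs (λ y → f y * f y)

      cross : ι 2 * (a * S) ≤ n * (a * a) + Q
      cross = begin
        ι 2 * (a * S)  ≈⟨ *-congˡ (sum-*ˡ xs a f) ⟨
        ι 2 * sumOver xs (λ y → a * f y)  ≈⟨ sum-*ˡ xs (ι 2) (λ y → a * f y) ⟨
        sumOver xs (λ y → ι 2 * (a * f y))  ≤⟨ sum-mono xs (λ y → 0≤y-x⇒x≤y (≤-trans (0≤x*x (a - f y))
                                                            (≤-reflexive (solve 2 (λ a b → (a :- b) :* (a :- b) := a :* a :+ b :* b :- con (+ 2) :* (a :* b)) refl a (f y))))) ⟩
        sumOver xs (λ y → a * a + f y * f y)  ≈⟨ sum-+ xs (λ _ → a * a) (λ y → f y * f y) ⟩
        sumOver xs (λ _ → a * a) + Q  ≈⟨ +-congʳ (sum-const xs (a * a)) ⟩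
        n * (a * a) + Q  ∎

  sum-swap : ∀ {A B : Set} (xs : List A) (ys : List B) (f : A → B → Carrier) →
             sumOver xs (λ x → sumOver ys (f x)) ≈ sumOver ys (λ y → sumOver xs (λ x → f x y))
  sum-swap []       ys f = sym (sum-0 ys)
  sum-swap (x ∷ xs) ys f = trans (+-congˡ (sum-swap xs ys f)) (sym (sum-+ ys (f x) (λ y → sumOver xs (λ x → f x y))))

  sum-map : ∀ {A B : Set} (h : A → B) xs (f : B → Carrier) → sumOver (map h xs) f ≈ sumOver xs (f ∘ h)
  sum-map h []       f = refl
  sum-map h (x ∷ xs) f = +-congˡ (sum-map h xs f)

  sum-*-sum : ∀ {A B : Set} (xs : List A) (ys : List B) f g →
              sumOver xs f * sumOver ys g ≈ sumOver xs (λ x → sumOver ys (λ y → f x * g y))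
  sum-*-sum xs ys f g = trans (sym (sum-*ʳ xs _ f)) (sum-cong xs (λ x → sym (sum-*ˡ ys (f x) g)))

  -- The entries are distinct, so removing the current one from `A` changes no later indicator and
  -- lowers the size by one.
  sum-unique : ∀ {N} (A : Subset N) {vs} → Unique vs → sumOver vs (λ v → ind (lookup A v)) ≤ ι ∣ A ∣
  sum-unique A [] = 0≤ι ∣ A ∣
  sum-unique {N} A (_∷_ {v} {vs} v∉vs vs!) with lookup A v in eq
  ... | false = ≤-trans (≤-reflexive (+-identityˡ _)) (sum-unique A vs!)
  ... | true  = begin
    1# + sumOver vs (λ w → ind (lookup A w))  ≤⟨ +-monoʳ-≤ 1# (sum-mono-All (All.map same v∉vs)) ⟩
    1# + sumOver vs (λ w → ind (lookup A′ w))  ≤⟨ +-monoʳ-≤ 1# (sum-unique A′ vs!) ⟩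
    1# + ι ∣ A′ ∣  ≈⟨ ι-suc ∣ A′ ∣ ⟨
    ι (suc ∣ A′ ∣)  ≡⟨ ≡.cong ι (∣remove∣ A v eq) ⟩
    ι ∣ A ∣  ∎
    where
    A′ = A [ v ]≔ outside
    same : ∀ {w} → v ≢ w → ind (lookup A w) ≤ ind (lookup A′ w)
    same {w} v≢w = ≤-reflexive (reflexive (≡.cong ind (≡.sym (VecP.lookup∘update′ (v≢w ∘ ≡.sym) A outside))))

  -- The binomial theorem as a product: each element of `I` is left out, with factor 1, or taken,
  -- with factor `c`.
  sum-subsets-⊆ : ∀ {N} (I : Subset N) c →
                  sumOver (subsets N) (λ A → ind (A ⊆ᵇ I) * c ^ ∣ A ∣) ≈ (1# + c) ^ ∣ I ∣
  sum-subsets-⊆ [] c = solve 0 (con (+ 1) :* con (+ 1) :+ con (+ 0) := con (+ 1)) refl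
  sum-subsets-⊆ {suc N} (i ∷ I) c = begin-equality
    sumOver (map (outside ∷_) Ss ++ map (inside ∷_) Ss) g
      ≈⟨ sum-++ (map (outside ∷_) Ss) (map (inside ∷_) Ss) g ⟩
    sumOver (map (outside ∷_) Ss) g + sumOver (map (inside ∷_) Ss) g
      ≈⟨ +-cong (sum-map (outside ∷_) Ss g) (sum-map (inside ∷_) Ss g) ⟩
    sumOver Ss (λ A → ind (A ⊆ᵇ I) * c ^ ∣ A ∣) + sumOver Ss (λ A → ind (i ∧ (A ⊆ᵇ I)) * (c * c ^ ∣ A ∣))
      ≈⟨ +-cong (sum-subsets-⊆ I c) (sum-cong Ss (λ A → trans (*-congʳ (ind-∧ i (A ⊆ᵇ I)))
           (solve 4 (λ a b c d → a :* b :* (c :* d) := a :* c :* (b :* d)) refl (ind i) (ind (A ⊆ᵇ I)) c _))) ⟩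
    (1# + c) ^ ∣ I ∣ + sumOver Ss (λ A → ind i * c * (ind (A ⊆ᵇ I) * c ^ ∣ A ∣))
      ≈⟨ +-congˡ (trans (sum-*ˡ Ss (ind i * c) _) (*-congˡ (sum-subsets-⊆ I c))) ⟩
    (1# + c) ^ ∣ I ∣ + ind i * c * (1# + c) ^ ∣ I ∣
      ≈⟨ last i ⟩
    (1# + c) ^ ∣ i ∷ I ∣
      ∎
    where
    Ss = subsets N
    g : Subset (suc N) → Carrier
    g A = ind (A ⊆ᵇ (i ∷ I)) * c ^ ∣ A ∣
    last : ∀ i → (1# + c) ^ ∣ I ∣ + ind i * c * (1# + c) ^ ∣ I ∣ ≈ (1# + c) ^ ∣ i ∷ I ∣
    last true  = solve 2 (λ c y → y :+ con (+ 1) :* c :* y := (con (+ 1) :+ c) :* y) refl c _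
    last false = solve 2 (λ c y → y :+ con (+ 0) :* c :* y := y) refl c _

  ∏ : ∀ {N} → (Fin N → Carrier) → Carrier
  ∏ {zero}  f = 1#
  ∏ {suc N} f = f zero * ∏ (f ∘ suc)

  ∏-cong : ∀ {N} {f g : Fin N → Carrier} → (∀ v → f v ≈ g v) → ∏ f ≈ ∏ g
  ∏-cong {zero}  eq = refl
  ∏-cong {suc N} eq = *-cong (eq zero) (∏-cong (eq ∘ suc))

  ∏-nonneg : ∀ {N} {f : Fin N → Carrier} → (∀ v → 0# ≤ f v) → 0# ≤ ∏ f
  ∏-nonneg {zero}  le = 0≤1
  ∏-nonneg {suc N} le = *-nonneg (le zero) (∏-nonneg (le ∘ suc))

  ∏-mono : ∀ {N} {f g : Fin N → Carrier} → (∀ v → 0# ≤ f v) → (∀ v → f v ≤ g v) → ∏ f ≤ ∏ g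
  ∏-mono {zero}  0≤f le = ≤-refl
  ∏-mono {suc N} 0≤f le = *-mono-≤ (0≤f zero) (∏-nonneg (λ v → ≤-trans (0≤f (suc v)) (le (suc v)))) (le zero)
                            (∏-mono (0≤f ∘ suc) (le ∘ suc))

  ∏-* : ∀ {N} (f g : Fin N → Carrier) → ∏ (λ v → f v * g v) ≈ ∏ f * ∏ g
  ∏-* {zero}  f g = sym (*-identityˡ 1#)
  ∏-* {suc N} f g = trans (*-congˡ (∏-* (f ∘ suc) (g ∘ suc)))
    (solve 4 (λ a b c d → a :* b :* (c :* d) := a :* c :* (b :* d)) refl _ _ _ _)

  ∏-0 : ∀ {N} {f : Fin N → Carrier} v → f v ≈ 0# → ∏ f ≈ 0#
  ∏-0 zero    eq = trans (*-congʳ eq) (zeroˡ _)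
  ∏-0 (suc v) eq = trans (*-congˡ (∏-0 v eq)) (zeroʳ _)

  -- With the factor 1 off `A`, products over different vertex sets all run over `Fin N` and can be
  -- multiplied and compared vertex by vertex.
  on : ∀ {N} → Subset N → Fin N → Carrier → Carrier
  on A v x = if lookup A v then x else 1#

  ∏-on : ∀ {N} (A : Subset N) c → ∏ (λ v → on A v c) ≈ c ^ ∣ A ∣
  ∏-on []            c = refl
  ∏-on (inside ∷ A)  c = *-congˡ (∏-on A c)
  ∏-on (outside ∷ A) c = trans (*-identityˡ _) (∏-on A c)

  except : ∀ {N} → Fin N → (Fin N → Carrier) → Carrier
  except {suc N} zero    f = ∏ (f ∘ suc)
  except {suc N} (suc v) f = f zero * except v (f ∘ suc)

  ∏-split : ∀ {N} (v : Fin N) f → ∏ f ≈ f v * except v f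
  ∏-split zero    f = refl
  ∏-split (suc v) f = trans (*-congˡ (∏-split v (f ∘ suc)))
    (solve 3 (λ a b c → a :* (b :* c) := b :* (a :* c)) refl _ _ _)

  except-cong : ∀ {N} (v : Fin N) {f g} → (∀ w → w ≢ v → f w ≈ g w) → except v f ≈ except v g
  except-cong zero    eq = ∏-cong (λ w → eq (suc w) (λ ()))
  except-cong (suc v) eq = *-cong (eq zero (λ ())) (except-cong v (λ w w≢v → eq (suc w) (w≢v ∘ FinP.suc-injective)))

  except-nonneg : ∀ {N} (v : Fin N) {f} → (∀ w → 0# ≤ f w) → 0# ≤ except v f
  except-nonneg zero    le = ∏-nonneg (le ∘ suc)
  except-nonneg (suc v) le = *-nonneg (le zero) (except-nonneg v (le ∘ suc))

-- Adaptive explorations, their expectations and product martingales.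

data Status : Set where
  pending included skipped : Status

pending? : (a : Status) → Dec (a ≡ pending)
pending? pending  = yes ≡.refl
pending? included = no λ ()
pending? skipped  = no λ ()

module Exploration (ℝ : Reals) (N : ℕ) where
  open Reals ℝ hiding (zero)
  open OrderedField ℝ
  open Sums ℝ
  open ≤R

  State : Set
  State = Fin N → Status

  _[_↦_] : State → Fin N → Status → State
  (σ [ v ↦ a ]) w = if does (w FinP.≟ v) then a else σ w

  ↦-same : ∀ σ v a → (σ [ v ↦ a ]) v ≡ a
  ↦-same σ v a = ≡.cong (λ b → if b then a else σ v) (dec-true (v FinP.≟ v) ≡.refl)

  ↦-other : ∀ σ {v w} a → w ≢ v → (σ [ v ↦ a ]) w ≡ σ w
  ↦-other σ {v} {w} a w≢v = ≡.cong (λ b → if b then a else σ w) (dec-false (w FinP.≟ v) w≢v)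

  -- The number r stored at a node is the conditional probability that the
  -- random subset of L picks up the vertex, given that L contains it.
  data Tree : Set where
    leaf : Tree
    node : (v : Fin N) (r : Carrier) (t₁ t₂ : Tree) → Tree

  -- Keeping the inclusion probability outside the tree allows one tree to be run with `q₀`-coins
  -- and also, for each fixed `L`, with the thinned coins of `L`.
  Coin : Set
  Coin = Fin N → Carrier → Carrier

  Ex : Coin → Tree → State → (State → Carrier) → Carrier
  Ex g leaf               σ f = f σ
  Ex g (node v r t₁ t₂) σ f =
    g v r * Ex g t₁ (σ [ v ↦ included ]) f + (1# - g v r) * Ex g t₂ (σ [ v ↦ skipped ]) f

  module _ (g : Coin) where

    Ex-cong : ∀ t σ {f h} → (∀ σ → f σ ≈ h σ) → Ex g t σ f ≈ Ex g t σ h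
    Ex-cong leaf             σ eq = eq σ
    Ex-cong (node v r t₁ t₂) σ eq = +-cong (*-congˡ (Ex-cong t₁ _ eq)) (*-congˡ (Ex-cong t₂ _ eq))

    Ex-const : ∀ t σ c → Ex g t σ (λ _ → c) ≈ c
    Ex-const leaf             σ c = refl
    Ex-const (node v r t₁ t₂) σ c = trans (+-cong (*-congˡ (Ex-const t₁ _ c)) (*-congˡ (Ex-const t₂ _ c)))
      (solve 2 (λ a c → a :* c :+ (con (+ 1) :- a) :* c := c) refl (g v r) c)

    Ex-+ : ∀ t σ f h → Ex g t σ (λ σ → f σ + h σ) ≈ Ex g t σ f + Ex g t σ h
    Ex-+ leaf             σ f h = refl
    Ex-+ (node v r t₁ t₂) σ f h = trans (+-cong (*-congˡ (Ex-+ t₁ _ f h)) (*-congˡ (Ex-+ t₂ _ f h)))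
      (solve 6 (λ a b x y z w → a :* (x :+ y) :+ b :* (z :+ w) := (a :* x :+ b :* z) :+ (a :* y :+ b :* w)) refl
        (g v r) (1# - g v r) _ _ _ _)

    Ex-*ˡ : ∀ t σ c f → Ex g t σ (λ σ → c * f σ) ≈ c * Ex g t σ f
    Ex-*ˡ leaf             σ c f = refl
    Ex-*ˡ (node v r t₁ t₂) σ c f = trans (+-cong (*-congˡ (Ex-*ˡ t₁ _ c f)) (*-congˡ (Ex-*ˡ t₂ _ c f)))
      (solve 5 (λ a b c x y → a :* (c :* x) :+ b :* (c :* y) := c :* (a :* x :+ b :* y)) refl (g v r) (1# - g v r) c _ _)

    Ex-sum : ∀ {A : Set} t σ (xs : List A) (f : A → State → Carrier) →
             Ex g t σ (λ σ → sumOver xs (λ x → f x σ)) ≈ sumOver xs (λ x → Ex g t σ (f x))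
    Ex-sum t σ []       f = Ex-const t σ 0#
    Ex-sum t σ (x ∷ xs) f = trans (Ex-+ t σ (f x) _) (+-congˡ (Ex-sum t σ xs f))

  module WellFormed (r̄ : Carrier) where

    -- No vertex is queried twice on a path. Hence a product still has its pending factor at the
    -- vertex being queried, which the martingale arguments rely on.
    WF : State → Tree → Set
    WF σ leaf             = ⊤
    WF σ (node v r t₁ t₂) = σ v ≡ pending × (0# ≤ r × r ≤ r̄) × WF (σ [ v ↦ included ]) t₁ × WF (σ [ v ↦ skipped ]) t₂

    Fair : Coin → Set
    Fair g = ∀ v r → 0# ≤ r → r ≤ r̄ → 0# ≤ g v r × g v r ≤ 1#

    module _ {g : Coin} (fair : Fair g) where

      Ex-mono : ∀ t {σ f h} → WF σ t → (∀ σ → f σ ≤ h σ) → Ex g t σ f ≤ Ex g t σ h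
      Ex-mono leaf             wf le = le _
      Ex-mono (node v r t₁ t₂) (_ , (0≤r , r≤r̄) , wf₁ , wf₂) le = +-mono-≤
        (*-monoʳ-≤ (proj₁ (fair v r 0≤r r≤r̄)) (Ex-mono t₁ wf₁ le))
        (*-monoʳ-≤ (x≤y⇒0≤y-x (proj₂ (fair v r 0≤r r≤r̄))) (Ex-mono t₂ wf₂ le))

      Ex-nonneg : ∀ t {σ f} → WF σ t → (∀ σ → 0# ≤ f σ) → 0# ≤ Ex g t σ f
      Ex-nonneg t {σ} wf le = ≤-trans (≤-reflexive (sym (Ex-const g t σ 0#))) (Ex-mono t wf le)

      -- Cauchy–Schwarz in the form (E χF)² ≤ c E F² whenever E χ² ≤ c.
      Ex-cauchy : ∀ t {σ} → WF σ t → (χ F : State → Carrier) (c : Carrier) → 0# < c →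
                  Ex g t σ (λ σ → χ σ * χ σ) ≤ c →
                  Ex g t σ (λ σ → χ σ * F σ) * Ex g t σ (λ σ → χ σ * F σ) ≤ c * Ex g t σ (λ σ → F σ * F σ)
      Ex-cauchy t {σ} wf χ F c 0<c a≤c = *-cancelˡ-≤ 0<c (0≤y-x⇒x≤y (begin
        0#
          ≤⟨ Ex-nonneg t wf (λ σ → 0≤x*x (b * χ σ - c * F σ)) ⟩
        Ex g t σ (λ σ → (b * χ σ - c * F σ) * (b * χ σ - c * F σ))
          ≈⟨ Ex-cong g t σ (λ σ → solve 4 (λ b c x y → (b :* x :- c :* y) :* (b :* x :- c :* y) :=
               b :* b :* (x :* x) :+ ((:- (con (+ 2) :* b :* c)) :* (x :* y) :+ c :* c :* (y :* y))) refl b c (χ σ) (F σ)) ⟩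
        Ex g t σ (λ σ → b * b * (χ σ * χ σ) + ((- (ι 2 * b * c)) * (χ σ * F σ) + c * c * (F σ * F σ)))
          ≈⟨ trans (Ex-+ g t σ _ _) (+-cong (Ex-*ˡ g t σ _ _) (trans (Ex-+ g t σ _ _) (+-cong (Ex-*ˡ g t σ _ _) (Ex-*ˡ g t σ _ _)))) ⟩
        b * b * a + ((- (ι 2 * b * c)) * b + c * c * d)
          ≤⟨ +-monoˡ-≤ _ (*-monoʳ-≤ (0≤x*x b) a≤c) ⟩
        b * b * c + ((- (ι 2 * b * c)) * b + c * c * d)
          ≈⟨ solve 3 (λ b c d → b :* b :* c :+ ((:- (con (+ 2) :* b :* c)) :* b :+ c :* c :* d) := c :* (c :* d) :- c :* (b :* b)) refl b c d ⟩
        c * (c * d) - c * (b * b)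
          ∎))
        where
        a b d : Carrier
        a = Ex g t σ (λ σ → χ σ * χ σ)
        b = Ex g t σ (λ σ → χ σ * F σ)
        d = Ex g t σ (λ σ → F σ * F σ)

    module _ (h : Fin N → Status → Carrier) where

      Prod : State → Carrier
      Prod σ = ∏ (λ w → h w (σ w))

      Prod-↦ : ∀ σ v a → Prod (σ [ v ↦ a ]) ≈ h v a * except v (λ w → h w (σ w))
      Prod-↦ σ v a = trans (∏-split v _) (*-cong
        (reflexive (≡.cong (h v) (↦-same σ v a)))
        (except-cong v (λ w w≢v → reflexive (≡.cong (h w) (↦-other σ a w≢v)))))

      Prod-pending : ∀ σ v → σ v ≡ pending → Prod σ ≈ h v pending * except v (λ w → h w (σ w))
      Prod-pending σ v eq = trans (∏-split v _) (*-congʳ (reflexive (≡.cong (h v) eq)))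

      private
        step : ∀ (x : Carrier) σ v → Carrier
        step x σ v = x * Prod (σ [ v ↦ included ]) + (1# - x) * Prod (σ [ v ↦ skipped ])

        step≈ : ∀ x σ v → step x σ v ≈ (x * h v included + (1# - x) * h v skipped) * except v (λ w → h w (σ w))
        step≈ x σ v = trans (+-cong (*-congˡ (Prod-↦ σ v included)) (*-congˡ (Prod-↦ σ v skipped)))
          (solve 5 (λ a b x y e → a :* (x :* e) :+ b :* (y :* e) := (a :* x :+ b :* y) :* e) refl x (1# - x) (h v included) (h v skipped) _)

      -- A query changes a single factor of the product, so it suffices that at every vertex the
      -- pending value is the mean of the two outcomes.
      Ex-martingale : ∀ {g} → (∀ v r → g v r * h v included + (1# - g v r) * h v skipped ≈ h v pending) →
                      ∀ t {σ} → WF σ t → Ex g t σ Prod ≈ Prod σ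
      Ex-martingale     mart leaf             wf = refl
      Ex-martingale {g} mart (node v r t₁ t₂) {σ} (σv , _ , wf₁ , wf₂) = begin-equality
        Ex g (node v r t₁ t₂) σ Prod  ≈⟨ +-cong (*-congˡ (Ex-martingale mart t₁ wf₁)) (*-congˡ (Ex-martingale mart t₂ wf₂)) ⟩
        step (g v r) σ v  ≈⟨ step≈ (g v r) σ v ⟩
        _ * except v (λ w → h w (σ w))  ≈⟨ *-congʳ (mart v r) ⟩
        h v pending * except v (λ w → h w (σ w))  ≈⟨ Prod-pending σ v σv ⟨
        Prod σ  ∎

      -- The version for the coins of a fixed `L`, whose bias varies from node to node: there only
      -- inequalities hold, and only for `r ≤ r̄`.
      Ex-supermartingale : ∀ {g} → Fair g → (∀ v a → 0# ≤ h v a) →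
                           (∀ v r → 0# ≤ r → r ≤ r̄ → g v r * h v included + (1# - g v r) * h v skipped ≤ h v pending) →
                           ∀ t {σ} → WF σ t → Ex g t σ Prod ≤ Prod σ
      Ex-supermartingale     fair 0≤h super leaf             wf = ≤-refl
      Ex-supermartingale {g} fair 0≤h super (node v r t₁ t₂) {σ} (σv , (0≤r , r≤r̄) , wf₁ , wf₂) = begin
        Ex g (node v r t₁ t₂) σ Prod  ≤⟨ +-mono-≤
                                                        (*-monoʳ-≤ (proj₁ (fair v r 0≤r r≤r̄)) (Ex-supermartingale fair 0≤h super t₁ wf₁))
                                                        (*-monoʳ-≤ (x≤y⇒0≤y-x (proj₂ (fair v r 0≤r r≤r̄))) (Ex-supermartingale fair 0≤h super t₂ wf₂)) ⟩
        step (g v r) σ v  ≈⟨ step≈ (g v r) σ v ⟩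
        _ * except v (λ w → h w (σ w))  ≤⟨ *-monoˡ-≤ (except-nonneg v (λ w → 0≤h w (σ w))) (super v r 0≤r r≤r̄) ⟩
        h v pending * except v (λ w → h w (σ w))  ≈⟨ Prod-pending σ v σv ⟨
        Prod σ  ∎

  cnt : State → List (Fin N) → ℕ
  cnt σ vs = length (filter (λ v → pending? (σ v)) vs)

  cnt-≤ : ∀ σ vs → cnt σ vs ℕ.≤ length vs
  cnt-≤ σ vs = ListP.length-filter (λ v → pending? (σ v)) vs

  private
    ↦-pending : ∀ σ v {a} → a ≢ pending → ∀ w → (σ [ v ↦ a ]) w ≡ pending → σ w ≡ pending
    ↦-pending σ v a≢ w eq with w FinP.≟ v
    ... | yes _ = ⊥-elim (a≢ eq)
    ... | no  _ = eq

    filter-⊑ : ∀ {A : Set} {P Q : A → Set} (P? : Decidable P) (Q? : Decidable Q) → (∀ x → P x → Q x) →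
               ∀ xs → length (filter P? xs) ℕ.≤ length (filter Q? xs)
    filter-⊑ P? Q? imp [] = ℕ.z≤n
    filter-⊑ P? Q? imp (x ∷ xs) with P? x | Q? x
    ... | yes p | yes q = ℕ.s≤s (filter-⊑ P? Q? imp xs)
    ... | yes p | no ¬q = ⊥-elim (¬q (imp x p))
    ... | no ¬p | yes q = ℕP.m≤n⇒m≤1+n (filter-⊑ P? Q? imp xs)
    ... | no ¬p | no ¬q = filter-⊑ P? Q? imp xs

  cnt-↦ : ∀ σ v {a} → a ≢ pending → ∀ vs → cnt (σ [ v ↦ a ]) vs ℕ.≤ cnt σ vs
  cnt-↦ σ v a≢ vs = filter-⊑ _ _ (↦-pending σ v a≢) vs

  cnt-drop : ∀ σ v {a} → a ≢ pending → σ v ≡ pending → ∀ {vs} → v ∈ vs → suc (cnt (σ [ v ↦ a ]) vs) ℕ.≤ cnt σ vs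
  cnt-drop σ v {a} a≢ σv {w ∷ vs} v∈ with pending? ((σ [ v ↦ a ]) w) | pending? (σ w) | v∈
  ... | yes p | no ¬q | _          = ⊥-elim (¬q (↦-pending σ v a≢ w p))
  ... | yes p | _     | here ≡.refl = ⊥-elim (a≢ (≡.trans (≡.sym (↦-same σ v a)) p))
  ... | no ¬p | yes q | here ≡.refl = ℕ.s≤s (cnt-↦ σ v a≢ vs)
  ... | no ¬p | no ¬q | here ≡.refl = ⊥-elim (¬q σv)
  ... | yes p | yes q | there v∈vs = ℕ.s≤s (cnt-drop σ v a≢ σv v∈vs)
  ... | no ¬p | yes q | there v∈vs = ℕP.m≤n⇒m≤1+n (cnt-drop σ v a≢ σv v∈vs)
  ... | no ¬p | no ¬q | there v∈vs = cnt-drop σ v a≢ σv v∈vs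

-- Construction of the exploration from a list of sets.

private
  -- Applied with `pre` the vertices scanned before the queried `v`: an initial segment `P` of the
  -- order either contains `v` or was scanned completely.
  ++-split : ∀ {A : Set} (pre : List A) {v post} (P : List A) {Q} → pre ++ v ∷ post ≡ P ++ Q →
             v ∈ P ⊎ ∃ λ R → pre ≡ P ++ R
  ++-split pre       []      eq = inj₂ (pre , ≡.refl)
  ++-split []        (x ∷ P) ≡.refl = inj₁ (here ≡.refl)
  ++-split (y ∷ pre) (x ∷ P) eq with ListP.∷-injective eq
  ... | ≡.refl , eq′ with ++-split pre P eq′
  ...   | inj₁ v∈P         = inj₁ (there v∈P)
  ...   | inj₂ (R , ≡.refl) = inj₂ (R , ≡.refl)

  Unique-++⁻ˡ : ∀ {A : Set} (P : List A) {Q} → Unique (P ++ Q) → Unique P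
  Unique-++⁻ˡ []      _            = []
  Unique-++⁻ˡ (x ∷ P) (x∉ ∷ P++Q!) = AllP.++⁻ˡ P x∉ ∷ Unique-++⁻ˡ P P++Q!

module _ (ℝ : Reals) where
  open Reals ℝ hiding (zero)
  open OrderedField ℝ

  module Construction {N : ℕ}
    (𝓜 : List (Subset N)) (ρ : List (Fin N)) (q q₀ r̄ : Carrier)
    (0<q : 0# < q) (0<q₀ : 0# < q₀) (q₀<1 : q₀ < 1#) (0≤r̄ : 0# ≤ r̄) (r̄≤1 : r̄ ≤ 1#) (r̄q≈q₀ : r̄ * q ≈ q₀) where
    open Sums ℝ
    open Exploration ℝ N
    open WellFormed r̄
    open ≤R

    Weight : Set
    Weight = Subset N → Carrier

    mass : Weight → Carrier
    mass κ = sumOver 𝓜 κ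

    massAt : Weight → Fin N → Carrier
    massAt κ v = sumOver 𝓜 (λ L → κ L * ind (lookup L v))

    Light : Weight → Fin N → Set
    Light κ v = massAt κ v ≤ q * mass κ

    thin : Fin N → Carrier → Subset N → Carrier
    thin v r L = r * ind (lookup L v)

    -- Bayes' rule without normalisation: `κ L` is the probability, given `L`, of the answers
    -- received so far, so `massAt κ v` over `mass κ` is the conditional probability that `v` lies
    -- in the random set.
    inc sk : Fin N → Carrier → Weight → Weight
    inc v r κ L = κ L * thin v r L
    sk  v r κ L = κ L * (1# - thin v r L)

    LightPending : Weight → State → List (Fin N) → Set
    LightPending κ σ = All (λ w → σ w ≡ pending → Light κ w)

    -- The indices `i` and `j` count the inclusions and exclusions on the path. The condition on `P`
    -- records that queries respect the order `ρ`: when the queried vertex is outside an initial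
    -- segment, the pending vertices of that segment are all light.
    data Good (κ : Weight) (i j : ℕ) (σ : State) : Tree → Set where
      leaf : LightPending κ σ ρ → Good κ i j σ leaf
      node : ∀ {v r t₁ t₂} → v ∈ ρ → σ v ≡ pending → 0# ≤ r → r ≤ r̄ →
             mass (inc v r κ) ≈ q₀ * mass κ →
             (∀ P Q → ρ ≡ P ++ Q → v ∈ P ⊎ LightPending κ σ P) →
             Good (inc v r κ) (suc i) j (σ [ v ↦ included ]) t₁ →
             Good (sk v r κ) i (suc j) (σ [ v ↦ skipped ]) t₂ →
             Good κ i j σ (node v r t₁ t₂)

    private
      FirstHeavy : Weight → State → List (Fin N) → Set
      FirstHeavy κ σ vs = ∃₂ λ pre v → ∃ λ post →
        vs ≡ pre ++ v ∷ post × LightPending κ σ pre × σ v ≡ pending × q * mass κ ≤ massAt κ v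

      extend : ∀ {κ σ v vs} → (σ v ≡ pending → Light κ v) →
               LightPending κ σ vs ⊎ FirstHeavy κ σ vs → LightPending κ σ (v ∷ vs) ⊎ FirstHeavy κ σ (v ∷ vs)
      extend l (inj₁ ls) = inj₁ (l ∷ ls)
      extend {v = v} l (inj₂ (pre , w , post , eq , ls , rest)) = inj₂ (v ∷ pre , w , post , ≡.cong (v ∷_) eq , l ∷ ls , rest)

      scan : ∀ κ σ vs → LightPending κ σ vs ⊎ FirstHeavy κ σ vs
      scan κ σ [] = inj₁ []
      scan κ σ (v ∷ vs) with pending? (σ v)
      ... | no σv≢ = extend (λ σv → ⊥-elim (σv≢ σv)) (scan κ σ vs)
      ... | yes σv with total (massAt κ v) (q * mass κ)
      ...   | inj₂ heavy = inj₂ ([] , v , vs , ≡.refl , [] , σv , heavy)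
      ...   | inj₁ light = extend (λ _ → light) (scan κ σ vs)

    mass-inc : ∀ v r κ → mass (inc v r κ) ≈ r * massAt κ v
    mass-inc v r κ = trans
      (sum-cong 𝓜 (λ L → solve 3 (λ k r b → k :* (r :* b) := r :* (k :* b)) refl (κ L) r (ind (lookup L v))))
      (sum-*ˡ 𝓜 r (λ L → κ L * ind (lookup L v)))

    mass-sk : ∀ v r κ → mass (inc v r κ) ≈ q₀ * mass κ → mass (sk v r κ) ≈ (1# - q₀) * mass κ
    mass-sk v r κ eq = begin-equality
      mass (sk v r κ)
        ≈⟨ sum-cong 𝓜 (λ L → solve 2 (λ k x → k :* (con (+ 1) :- x) := k :+ (:- con (+ 1)) :* (k :* x)) refl (κ L) (thin v r L)) ⟩
      sumOver 𝓜 (λ L → κ L + (- 1#) * inc v r κ L)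
        ≈⟨ trans (sum-+ 𝓜 κ _) (+-congˡ (sum-*ˡ 𝓜 (- 1#) (inc v r κ))) ⟩
      mass κ + (- 1#) * mass (inc v r κ)
        ≈⟨ +-congˡ (*-congˡ eq) ⟩
      mass κ + (- 1#) * (q₀ * mass κ)
        ≈⟨ solve 2 (λ m q → m :+ (:- con (+ 1)) :* (q :* m) := (con (+ 1) :- q) :* m) refl (mass κ) q₀ ⟩
      (1# - q₀) * mass κ
        ∎

    0<1-q₀ : 0# < 1# - q₀
    0<1-q₀ = x≤y⇒0≤y-x (<⇒≤ q₀<1) , λ eq → proj₂ q₀<1 (begin-equality
      q₀  ≈⟨ +-identityˡ q₀ ⟨
      0# + q₀  ≈⟨ +-congʳ eq ⟩
      1# - q₀ + q₀  ≈⟨ solve 1 (λ q → con (+ 1) :- q :+ q := con (+ 1)) refl q₀ ⟩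
      1#  ∎)

    -- Always queries the first pending vertex that is not light. Each query settles a vertex of
    -- `ρ`, so the number of pending vertices suffices as fuel.
    build : ∀ fuel κ i j σ → 0# < mass κ → cnt σ ρ ℕ.≤ fuel → ∃ (Good κ i j σ)
    build fuel κ i j σ 0<m cnt≤ with scan κ σ ρ
    ... | inj₁ ls = leaf , leaf ls
    ... | inj₂ (pre , v , post , eq , ls , σv , heavy) = go fuel cnt≤
      where
      v∈ρ : v ∈ ρ
      v∈ρ = ≡.subst (v ∈_) (≡.sym eq) (∈-++⁺ʳ pre (here ≡.refl))

      0<at : 0# < massAt κ v
      0<at = <-≤-trans (0<-* 0<q 0<m) heavy

      -- Thinning by this `r` makes the conditional probability of inclusion exactly `q₀`; heaviness
      -- of `v` is what gives `r ≤ r̄`.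
      r : Carrier
      r = q₀ * mass κ * massAt κ v ⁻¹

      0≤r : 0# ≤ r
      0≤r = *-nonneg (*-nonneg (<⇒≤ 0<q₀) (<⇒≤ 0<m)) (⁻¹-nonneg 0<at)

      r*at : r * massAt κ v ≈ q₀ * mass κ
      r*at = trans (*-assoc _ _ _) (trans (*-congˡ (⁻¹-inverseˡ 0<at)) (*-identityʳ _))

      r≤r̄ : r ≤ r̄
      r≤r̄ = *-cancelˡ-≤ 0<at (begin
        massAt κ v * r  ≈⟨ trans (*-comm _ _) r*at ⟩
        q₀ * mass κ  ≈⟨ *-congʳ r̄q≈q₀ ⟨
        r̄ * q * mass κ  ≈⟨ *-assoc _ _ _ ⟩
        r̄ * (q * mass κ)  ≤⟨ *-monoʳ-≤ 0≤r̄ heavy ⟩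
        r̄ * massAt κ v  ≈⟨ *-comm _ _ ⟩
        massAt κ v * r̄  ∎)

      mass₁ : mass (inc v r κ) ≈ q₀ * mass κ
      mass₁ = trans (mass-inc v r κ) r*at

      prefix : ∀ P Q → ρ ≡ P ++ Q → v ∈ P ⊎ LightPending κ σ P
      prefix P Q eq′ with ++-split pre P (≡.trans (≡.sym eq) eq′)
      ... | inj₁ v∈P          = inj₁ v∈P
      ... | inj₂ (R , ≡.refl) = inj₂ (AllP.++⁻ˡ P ls)

      go : ∀ fuel → cnt σ ρ ℕ.≤ fuel → ∃ (Good κ i j σ)
      go zero    le = ⊥-elim (ℕP.n≮0 (ℕP.≤-trans (cnt-drop σ v {included} (λ ()) σv v∈ρ) le))
      go (suc fuel) le = combine
        (build fuel (inc v r κ) (suc i) j (σ [ v ↦ included ])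
          (<-≤-trans (0<-* 0<q₀ 0<m) (≤-reflexive (sym mass₁)))
          (ℕP.≤-pred (ℕP.≤-trans (cnt-drop σ v (λ ()) σv v∈ρ) le)))
        (build fuel (sk v r κ) i (suc j) (σ [ v ↦ skipped ])
          (<-≤-trans (0<-* 0<1-q₀ 0<m) (≤-reflexive (sym (mass-sk v r κ mass₁))))
          (ℕP.≤-pred (ℕP.≤-trans (cnt-drop σ v (λ ()) σv v∈ρ) le)))
        where
        combine : ∃ (Good (inc v r κ) (suc i) j (σ [ v ↦ included ])) →
                  ∃ (Good (sk v r κ) i (suc j) (σ [ v ↦ skipped ])) → ∃ (Good κ i j σ)
        combine (t₁ , g₁) (t₂ , g₂) = node v r t₁ t₂ , node v∈ρ σv 0≤r r≤r̄ mass₁ prefix g₁ g₂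

    Good⇒WF : ∀ {κ i j σ t} → Good κ i j σ t → WF σ t
    Good⇒WF (leaf _)                          = tt
    Good⇒WF (node _ σv 0≤r r≤r̄ _ _ g₁ g₂) = σv , (0≤r , r≤r̄) , Good⇒WF g₁ , Good⇒WF g₂

    coin : Coin
    coin _ _ = q₀

    coinOf : Subset N → Coin
    coinOf L v r = thin v r L

    coin-fair : Fair coin
    coin-fair _ _ _ _ = <⇒≤ 0<q₀ , <⇒≤ q₀<1

    thin-bounds : ∀ L v r → 0# ≤ r → r ≤ r̄ → 0# ≤ thin v r L × thin v r L ≤ r̄
    thin-bounds L v r 0≤r r≤r̄ = *-nonneg 0≤r (0≤ind (lookup L v)) ,
      (begin
        r * ind (lookup L v)  ≤⟨ *-monoʳ-≤ 0≤r (ind≤1 (lookup L v)) ⟩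
        r * 1#  ≈⟨ *-identityʳ r ⟩
        r  ≤⟨ r≤r̄ ⟩
        r̄  ∎)

    coinOf-fair : ∀ L → Fair (coinOf L)
    coinOf-fair L v r 0≤r r≤r̄ with thin-bounds L v r 0≤r r≤r̄
    ... | 0≤ , ≤r̄ = 0≤ , ≤-trans ≤r̄ r̄≤1

    -- Averaged over L, the thinned exploration of L is the exploration with q₀-coins.
    Ex-average : ∀ {κ i j σ t} → Good κ i j σ t → ∀ f →
                 sumOver 𝓜 (λ L → κ L * Ex (coinOf L) t σ f) ≈ mass κ * Ex coin t σ f
    Ex-average {κ} {σ = σ} (leaf _) f = sum-*ʳ 𝓜 (f σ) κ
    Ex-average {κ} {σ = σ} (node {v} {r} {t₁} {t₂} _ _ _ _ mass₁ _ g₁ g₂) f = begin-equality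
      sumOver 𝓜 (λ L → κ L * (thin v r L * E₁ L + (1# - thin v r L) * E₂ L))
        ≈⟨ sum-cong 𝓜 (λ L → solve 5 (λ k x y a b → k :* (x :* a :+ y :* b) := k :* x :* a :+ k :* y :* b) refl
             (κ L) (thin v r L) (1# - thin v r L) (E₁ L) (E₂ L)) ⟩
      sumOver 𝓜 (λ L → inc v r κ L * E₁ L + sk v r κ L * E₂ L)
        ≈⟨ sum-+ 𝓜 _ _ ⟩
      sumOver 𝓜 (λ L → inc v r κ L * E₁ L) + sumOver 𝓜 (λ L → sk v r κ L * E₂ L)
        ≈⟨ +-cong (Ex-average g₁ f) (Ex-average g₂ f) ⟩
      mass (inc v r κ) * F₁ + mass (sk v r κ) * F₂
        ≈⟨ +-cong (*-congʳ mass₁) (*-congʳ (mass-sk v r κ mass₁)) ⟩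
      q₀ * mass κ * F₁ + (1# - q₀) * mass κ * F₂
        ≈⟨ solve 5 (λ q p m a b → q :* m :* a :+ p :* m :* b := m :* (q :* a :+ p :* b)) refl q₀ (1# - q₀) (mass κ) F₁ F₂ ⟩
      mass κ * (q₀ * F₁ + (1# - q₀) * F₂)
        ∎
      where
      E₁ E₂ : Subset N → Carrier
      E₁ L = Ex (coinOf L) t₁ (σ [ v ↦ included ]) f
      E₂ L = Ex (coinOf L) t₂ (σ [ v ↦ skipped ]) f
      F₁ F₂ : Carrier
      F₁ = Ex coin t₁ (σ [ v ↦ included ]) f
      F₂ = Ex coin t₂ (σ [ v ↦ skipped ]) f

    -- An inclusion costs a factor `r̄` pointwise but the smaller `q₀ = r̄ q` in total mass. So `κ`,
    -- divided by `r̄ ^ i`, is at most 1 and still has average at least `q ^ i * (1# - q₀) ^ j`;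
    -- such a weight cannot have too many light vertices.
    record Reached (κ : Weight) (i j : ℕ) : Set where
      constructor reach
      field
        κ-nonneg : ∀ L → 0# ≤ κ L
        κ≤r̄^i    : ∀ L → κ L ≤ r̄ ^ i
        mass≈    : mass κ ≈ ι (length 𝓜) * (q₀ ^ i * (1# - q₀) ^ j)

    Reached-inc : ∀ {κ i j} v r → 0# ≤ r → r ≤ r̄ → mass (inc v r κ) ≈ q₀ * mass κ → Reached κ i j → Reached (inc v r κ) (suc i) j
    Reached-inc {κ} {i} {j} v r 0≤r r≤r̄ mass₁ (reach 0≤κ κ≤ mass≈) = reach
      (λ L → *-nonneg (0≤κ L) (proj₁ (thin-bounds L v r 0≤r r≤r̄)))
      (λ L → ≤-trans (*-mono-≤ (0≤κ L) 0≤r̄ (κ≤ L) (proj₂ (thin-bounds L v r 0≤r r≤r̄))) (≤-reflexive (*-comm _ _)))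
      (trans mass₁ (trans (*-congˡ mass≈)
        (solve 4 (λ q m a b → q :* (m :* (a :* b)) := m :* (q :* a :* b)) refl q₀ (ι (length 𝓜)) (q₀ ^ i) ((1# - q₀) ^ j))))

    Reached-sk : ∀ {κ i j} v r → 0# ≤ r → r ≤ r̄ → mass (inc v r κ) ≈ q₀ * mass κ → Reached κ i j → Reached (sk v r κ) i (suc j)
    Reached-sk {κ} {i} {j} v r 0≤r r≤r̄ mass₁ (reach 0≤κ κ≤ mass≈) = reach
      (λ L → *-nonneg (0≤κ L) (x≤y⇒0≤y-x (proj₂ (coinOf-fair L v r 0≤r r≤r̄))))
      (λ L → begin
        κ L * (1# - thin v r L)  ≤⟨ *-monoʳ-≤ (0≤κ L) (x-y≤x (proj₁ (thin-bounds L v r 0≤r r≤r̄))) ⟩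
        κ L * 1#  ≈⟨ *-identityʳ _ ⟩
        κ L  ≤⟨ κ≤ L ⟩
        r̄ ^ i  ∎)
      (trans (mass-sk v r κ mass₁) (trans (*-congˡ mass≈)
        (solve 4 (λ q m a b → q :* (m :* (a :* b)) := m :* (a :* (q :* b))) refl (1# - q₀) (ι (length 𝓜)) (q₀ ^ i) ((1# - q₀) ^ j))))

    -- Expected number of pending vertices in initial segments.

    module Prefix (G a c : ℕ) (ρ! : Unique ρ)
      (light-bound : ∀ κ i j W → Reached κ i j → Unique W → All (_∈ ρ) W → All (Light κ) W →
                     G ℕ.* length W ℕ.≤ a ℕ.* i ℕ.+ j)
      (balance : q₀ * ι a + (1# - q₀) ≈ ι c) where

      private
        bound : ∀ {κ i j σ} P Q → ρ ≡ P ++ Q → Reached κ i j → LightPending κ σ P → G ℕ.* cnt σ P ℕ.≤ a ℕ.* i ℕ.+ j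
        bound {κ} {i} {j} {σ} P Q eq reached lp = light-bound κ i j _ reached
          (UniqueP.filter⁺ (λ v → pending? (σ v)) (Unique-++⁻ˡ P (≡.subst Unique eq ρ!)))
          (AllP.filter⁺ (λ v → pending? (σ v)) (AllP.++⁻ˡ P (≡.subst (All (_∈ ρ)) eq (All.tabulate (λ z → z)))))
          (All.zipWith (λ (l , p) → l p)
            (AllP.filter⁺ (λ v → pending? (σ v)) lp , AllP.all-filter (λ v → pending? (σ v)) P))

      -- A potential argument. While vertices of `P` are queried, the count drops by one and
      -- `a i + j` grows by `c` on average, by `balance`, so the right side does not increase in
      -- mean. At a leaf, or once a query leaves `P`, the pending vertices of `P` are light and
      -- `light-bound` applies; afterwards the count can only fall.
      pending-bound : ∀ P Q → ρ ≡ P ++ Q → ∀ {κ i j σ t} → Good κ i j σ t → Reached κ i j →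
                      ι G * Ex coin t σ (λ σ → ι (cnt σ P)) ≤ ι (a ℕ.* i ℕ.+ j) + ι c * ι (cnt σ P)
      pending-bound P Q eq {κ} {i} {j} {σ} (leaf lp) reached = begin
        ι G * ι (cnt σ P)  ≈⟨ ι-* G (cnt σ P) ⟨
        ι (G ℕ.* cnt σ P)  ≤⟨ ι-mono (bound P Q eq reached (AllP.++⁻ˡ P (≡.subst (LightPending κ σ) eq lp))) ⟩
        ι (a ℕ.* i ℕ.+ j)  ≤⟨ x≤x+y (*-nonneg (0≤ι c) (0≤ι (cnt σ P))) ⟩
        ι (a ℕ.* i ℕ.+ j) + ι c * ι (cnt σ P)  ∎
      pending-bound P Q eq {κ} {i} {j} {σ} (node {v} {r} {t₁} {t₂} v∈ρ σv 0≤r r≤r̄ mass₁ prefix g₁ g₂) reached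
        with prefix P Q eq
      ... | inj₂ lp = begin
        ι G * Ex coin (node v r t₁ t₂) σ (λ σ → ι (cnt σ P))
          ≤⟨ *-monoʳ-≤ (0≤ι G) (mono-cnt (Good⇒WF (node v∈ρ σv 0≤r r≤r̄ mass₁ prefix g₁ g₂))) ⟩
        ι G * ι (cnt σ P)  ≈⟨ ι-* G (cnt σ P) ⟨
        ι (G ℕ.* cnt σ P)  ≤⟨ ι-mono (bound P Q eq reached lp) ⟩
        ι (a ℕ.* i ℕ.+ j)  ≤⟨ x≤x+y (*-nonneg (0≤ι c) (0≤ι (cnt σ P))) ⟩
        ι (a ℕ.* i ℕ.+ j) + ι c * ι (cnt σ P)  ∎
        where
        mono-cnt : ∀ {t σ} → WF σ t → Ex coin t σ (λ σ → ι (cnt σ P)) ≤ ι (cnt σ P)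
        mono-cnt {leaf} wf = ≤-refl
        mono-cnt {node v r t₁ t₂} {σ} (_ , _ , wf₁ , wf₂) = begin
          q₀ * _ + (1# - q₀) * _
            ≤⟨ +-mono-≤ (*-monoʳ-≤ (<⇒≤ 0<q₀) (≤-trans (mono-cnt {t₁} wf₁) (ι-mono (cnt-↦ σ v (λ ()) P))))
                        (*-monoʳ-≤ (<⇒≤ 0<1-q₀) (≤-trans (mono-cnt {t₂} wf₂) (ι-mono (cnt-↦ σ v (λ ()) P)))) ⟩
          q₀ * ι (cnt σ P) + (1# - q₀) * ι (cnt σ P)
            ≈⟨ solve 2 (λ q x → q :* x :+ (con (+ 1) :- q) :* x := x) refl q₀ (ι (cnt σ P)) ⟩
          ι (cnt σ P) ∎
      ... | inj₁ v∈P = begin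
        ι G * (q₀ * F₁ + (1# - q₀) * F₂)
          ≈⟨ solve 5 (λ g q p x y → g :* (q :* x :+ p :* y) := q :* (g :* x) :+ p :* (g :* y)) refl (ι G) q₀ (1# - q₀) F₁ F₂ ⟩
        q₀ * (ι G * F₁) + (1# - q₀) * (ι G * F₂)
          ≤⟨ +-mono-≤ (*-monoʳ-≤ (<⇒≤ 0<q₀) (≤-trans (pending-bound P Q eq g₁ (Reached-inc v r 0≤r r≤r̄ mass₁ reached)) (drop (a ℕ.* suc i ℕ.+ j) (λ ()))))
                      (*-monoʳ-≤ (<⇒≤ 0<1-q₀) (≤-trans (pending-bound P Q eq g₂ (Reached-sk v r 0≤r r≤r̄ mass₁ reached)) (drop (a ℕ.* i ℕ.+ suc j) (λ ())))) ⟩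
        q₀ * (ι (a ℕ.* suc i ℕ.+ j) + ι c * (n - 1#)) + (1# - q₀) * (ι (a ℕ.* i ℕ.+ suc j) + ι c * (n - 1#))
          ≈⟨ +-cong (*-congˡ (+-congʳ inc≈)) (*-congˡ (+-congʳ sk≈)) ⟩
        q₀ * (ι a + B + ι c * (n - 1#)) + (1# - q₀) * (1# + B + ι c * (n - 1#))
          ≈⟨ solve 5 (λ q a B c n → q :* (a :+ B :+ c :* (n :- con (+ 1))) :+ (con (+ 1) :- q) :* (con (+ 1) :+ B :+ c :* (n :- con (+ 1)))
                        := (q :* a :+ (con (+ 1) :- q)) :+ B :+ c :* n :- c) refl q₀ (ι a) B (ι c) n ⟩
        (q₀ * ι a + (1# - q₀)) + B + ι c * n - ι c
          ≈⟨ +-congʳ (+-congʳ (+-congʳ balance)) ⟩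
        ι c + B + ι c * n - ι c
          ≈⟨ solve 3 (λ c B x → c :+ B :+ x :- c := B :+ x) refl (ι c) B (ι c * n) ⟩
        B + ι c * n
          ∎
        where
        F₁ F₂ n B : Carrier
        F₁ = Ex coin t₁ (σ [ v ↦ included ]) (λ σ → ι (cnt σ P))
        F₂ = Ex coin t₂ (σ [ v ↦ skipped ]) (λ σ → ι (cnt σ P))
        n = ι (cnt σ P)
        B = ι (a ℕ.* i ℕ.+ j)
        inc≈ : ι (a ℕ.* suc i ℕ.+ j) ≈ ι a + B
        inc≈ = trans (reflexive (≡.cong ι (≡.trans (≡.cong (ℕ._+ j) (ℕP.*-suc a i)) (ℕP.+-assoc a (a ℕ.* i) j)))) (ι-+ a _)
        sk≈ : ι (a ℕ.* i ℕ.+ suc j) ≈ 1# + B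
        sk≈ = trans (reflexive (≡.cong ι (ℕP.+-suc (a ℕ.* i) j))) (ι-suc (a ℕ.* i ℕ.+ j))
        drop : ∀ k {s} → s ≢ pending → ι k + ι c * ι (cnt (σ [ v ↦ s ]) P) ≤ ι k + ι c * (n - 1#)
        drop k {s} s≢ = +-monoʳ-≤ _ (*-monoʳ-≤ (0≤ι c) (x+y≤z⇒x≤z-y (begin
          ι (cnt (σ [ v ↦ s ]) P) + 1#  ≈⟨ +-comm _ _ ⟩
          1# + ι (cnt (σ [ v ↦ s ]) P)  ≈⟨ ι-suc (cnt (σ [ v ↦ s ]) P) ⟨
          ι (suc (cnt (σ [ v ↦ s ]) P))  ≤⟨ ι-mono (cnt-drop σ v s≢ σv v∈P) ⟩
          n  ∎)))

-- Parameters as powers of `1# - q₀`.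

-- With `q` equal to 2^(-ℓ) this says that `ℓ q` is at most 1/4, which keeps `v` above 3/4.
4ℓ≤2^ℓ : ∀ {ℓ} → 4 ℕ.≤ ℓ → 4 ℕ.* ℓ ℕ.≤ 2 ℕ.^ ℓ
4ℓ≤2^ℓ 4≤ℓ = ≡.subst (λ ℓ → 4 ℕ.* ℓ ℕ.≤ 2 ℕ.^ ℓ) (ℕP.m+[n∸m]≡n 4≤ℓ) (go _)
  where
  go : ∀ k → 4 ℕ.* (4 ℕ.+ k) ℕ.≤ 2 ℕ.^ (4 ℕ.+ k)
  go zero    = ℕP.≤-refl
  go (suc k) = begin
    4 ℕ.* (5 ℕ.+ k)  ≡⟨ solve 1 (λ k → con 4 :* (con 5 :+ k) := con 4 :+ con 4 :* (con 4 :+ k)) ≡.refl k ⟩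
    4 ℕ.+ 4 ℕ.* (4 ℕ.+ k)  ≤⟨ ℕP.+-monoˡ-≤ _ (ℕP.*-monoʳ-≤ 4 (ℕ.s≤s (ℕ.z≤n {3 ℕ.+ k}))) ⟩
    4 ℕ.* (4 ℕ.+ k) ℕ.+ 4 ℕ.* (4 ℕ.+ k)  ≤⟨ ℕP.+-mono-≤ (go k) (go k) ⟩
    2 ℕ.^ (4 ℕ.+ k) ℕ.+ 2 ℕ.^ (4 ℕ.+ k)  ≡⟨ solve 1 (λ x → x :+ x := con 2 :* x) ≡.refl (2 ℕ.^ (4 ℕ.+ k)) ⟩
    2 ℕ.* 2 ℕ.^ (4 ℕ.+ k)  ∎
    where
    open ℕP.≤-Reasoning
    open +-*-Solver

module Parameters (ℝ : Reals) (s ℓ : ℕ) (2≤s : 2 ℕ.≤ s) (4≤ℓ : 4 ℕ.≤ ℓ) where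
  open Reals ℝ hiding (zero)
  open OrderedField ℝ
  open ≤R

  -- The reciprocals of `q`, `r̄` and `q₀` as natural numbers, so that they can occur in exponents.
  A g K : ℕ
  A = 2 ℕ.^ ℓ
  g = 16 ℕ.* (s ℕ.* s)
  K = A ℕ.* g

  1≤A : 1 ℕ.≤ A
  1≤A = ℕP.m^n>0 2 ℓ

  4≤s*s : 4 ℕ.≤ s ℕ.* s
  4≤s*s = ℕP.*-mono-≤ 2≤s 2≤s

  64≤g : 64 ℕ.≤ g
  64≤g = ℕP.*-monoʳ-≤ 16 4≤s*s

  1≤g : 1 ℕ.≤ g
  1≤g = ℕP.≤-trans (ℕ.s≤s ℕ.z≤n) 64≤g

  64≤K : 64 ℕ.≤ K
  64≤K = ℕP.≤-trans 64≤g (≡.subst (ℕ._≤ K) (ℕP.*-identityˡ g) (ℕP.*-monoˡ-≤ g 1≤A))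

  0<ιK : 0# < ι K
  0<ιK = 0<ι′ (ℕP.≤-trans (ℕ.s≤s ℕ.z≤n) 64≤K)

  0<ιg : 0# < ι g
  0<ιg = 0<ι′ 1≤g

  -- `u` plays the part of 1 - q. The cube in `b` leaves the room needed to average `b ^ length U`
  -- over random subsets of a light set and still obtain a power of `v`. In terms of `y`, `b` has
  -- exponent 3gℓ, so that `b ^ n` is at least 2^(-6ℓqn).
  half q q₀ r̄ y u v b : Carrier
  half = ι 2 ⁻¹
  q    = half ^ ℓ
  q₀   = ι K ⁻¹
  r̄    = ι g ⁻¹
  y    = 1# - q₀
  u    = y ^ g
  v    = u ^ ℓ
  b    = v ^ 3

  0<half : 0# < half
  0<half = 0<⁻¹ (0<ι 1)

  2*half≈1 : ι 2 * half ≈ 1#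
  2*half≈1 = 0<⇒*⁻¹≈1 (0<ι 1)

  0<q : 0# < q
  0<q = ^-pos ℓ 0<half

  0<q₀ : 0# < q₀
  0<q₀ = 0<⁻¹ 0<ιK

  0<r̄ : 0# < r̄
  0<r̄ = 0<⁻¹ 0<ιg

  K*q₀≈1 : ι K * q₀ ≈ 1#
  K*q₀≈1 = 0<⇒*⁻¹≈1 0<ιK

  ι-^ : ∀ m n → ι (m ℕ.^ n) ≈ ι m ^ n
  ι-^ m zero    = refl
  ι-^ m (suc n) = trans (ι-* m (m ℕ.^ n)) (*-congˡ (ι-^ m n))

  A*q≈1 : ι A * q ≈ 1#
  A*q≈1 = begin-equality
    ι A * q  ≈⟨ *-congʳ (ι-^ 2 ℓ) ⟩
    ι 2 ^ ℓ * half ^ ℓ  ≈⟨ ^-distrib-* (ι 2) half ℓ ⟨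
    (ι 2 * half) ^ ℓ  ≈⟨ ^-congˡ ℓ 2*half≈1 ⟩
    1# ^ ℓ  ≈⟨ 1^n≈1 ℓ ⟩
    1#  ∎

  r̄q≈q₀ : r̄ * q ≈ q₀
  r̄q≈q₀ = ⁻¹-unique 0<ιK (begin-equality
    ι K * (r̄ * q)  ≈⟨ *-congʳ (ι-* A g) ⟩
    ι A * ι g * (r̄ * q)  ≈⟨ solve 4 (λ a g r q → a :* g :* (r :* q) := (a :* q) :* (g :* r)) refl (ι A) (ι g) r̄ q ⟩
    (ι A * q) * (ι g * r̄)  ≈⟨ *-cong A*q≈1 (0<⇒*⁻¹≈1 0<ιg) ⟩
    1# * 1#  ≈⟨ *-identityˡ 1# ⟩
    1#  ∎)

  ⁻¹≤1 : ∀ {n} → 1 ℕ.≤ n → ι n ⁻¹ ≤ 1#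
  ⁻¹≤1 {n} 1≤n = *-cancelˡ-≤ (0<ι′ 1≤n) (begin
    ι n * ι n ⁻¹  ≈⟨ 0<⇒*⁻¹≈1 (0<ι′ 1≤n) ⟩
    1#  ≤⟨ ι-mono {1} 1≤n ⟩
    ι n  ≈⟨ *-identityʳ _ ⟨
    ι n * 1#  ∎)

  r̄≤1 : r̄ ≤ 1#
  r̄≤1 = ⁻¹≤1 1≤g

  q₀<1 : q₀ < 1#
  q₀<1 = ⁻¹≤1 (ℕP.≤-trans (ℕ.s≤s ℕ.z≤n) 64≤K) , λ q₀≈1 → <⇒≱ (x<1+x 1#) (begin
    1# + 1#  ≤⟨ ι-mono {2} (ℕP.≤-trans (ℕ.s≤s (ℕ.s≤s ℕ.z≤n)) 64≤K) ⟩
    ι K  ≈⟨ trans (sym (*-identityʳ _)) (*-congˡ (sym q₀≈1)) ⟩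
    ι K * q₀  ≈⟨ K*q₀≈1 ⟩
    1#  ∎)

  0<y : 0# < y
  0<y = x≤y⇒0≤y-x (<⇒≤ q₀<1) , λ 0≈y → proj₂ q₀<1 (trans (trans (sym (+-identityʳ _)) (+-congˡ 0≈y))
    (solve 1 (λ q → q :+ (con (+ 1) :- q) := con (+ 1)) refl q₀))

  y<1 : y < 1#
  y<1 = x-y≤x (<⇒≤ 0<q₀) , λ y≈1 → proj₂ 0<q₀ (begin-equality
    0#  ≈⟨ -‿inverseʳ 1# ⟨
    1# - 1#  ≈⟨ +-congˡ (-‿cong y≈1) ⟨
    1# - y  ≈⟨ solve 1 (λ q → con (+ 1) :- (con (+ 1) :- q) := q) refl q₀ ⟩
    q₀  ∎)

  y^K*2≤1 : y ^ K * ι 2 ≤ 1#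
  y^K*2≤1 = begin
    y ^ K * ι 2  ≈⟨ *-congˡ (+-congˡ (sym K*q₀≈1)) ⟩
    y ^ K * (1# + ι K * q₀)  ≤⟨ *-monoʳ-≤ (^-nonneg K (<⇒≤ 0<y)) (bernoulli K (<⇒≤ 0<q₀)) ⟩
    y ^ K * (1# + q₀) ^ K  ≈⟨ ^-distrib-* y (1# + q₀) K ⟨
    (y * (1# + q₀)) ^ K  ≤⟨ ^-≤1 K (*-nonneg (<⇒≤ 0<y) (0≤-+ 0≤1 (<⇒≤ 0<q₀))) (begin
        y * (1# + q₀)  ≈⟨ solve 1 (λ q → (con (+ 1) :- q) :* (con (+ 1) :+ q) := con (+ 1) :- q :* q) refl q₀ ⟩
        1# - q₀ * q₀  ≤⟨ x-y≤x (0≤x*x q₀) ⟩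
        1#  ∎) ⟩
    1#  ∎

  y^K≤half : y ^ K ≤ half
  y^K≤half = *-cancelˡ-≤ (0<ι 1) (begin
    ι 2 * y ^ K  ≈⟨ *-comm _ _ ⟩
    y ^ K * ι 2  ≤⟨ y^K*2≤1 ⟩
    1#  ≈⟨ 2*half≈1 ⟨
    ι 2 * half  ∎)

  y^Kℓ≤q : y ^ (K ℕ.* ℓ) ≤ q
  y^Kℓ≤q = ≤-trans (≤-reflexive (sym (^-assocʳ y K ℓ))) (^-mono-≤ ℓ (^-nonneg K (<⇒≤ 0<y)) y^K≤half)

  0<u : 0# < u
  0<u = ^-pos g 0<y

  u≤1 : u ≤ 1#
  u≤1 = ^-≤1 g (<⇒≤ 0<y) (<⇒≤ y<1)

  0<v : 0# < v
  0<v = ^-pos ℓ 0<u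

  v≤1 : v ≤ 1#
  v≤1 = ^-≤1 ℓ (<⇒≤ 0<u) u≤1

  0<b : 0# < b
  0<b = ^-pos 3 0<v

  b≤1 : b ≤ 1#
  b≤1 = ^-≤1 3 (<⇒≤ 0<v) v≤1

  g*q₀≈q : ι g * q₀ ≈ q
  g*q₀≈q = begin-equality
    ι g * q₀  ≈⟨ *-congˡ r̄q≈q₀ ⟨
    ι g * (r̄ * q)  ≈⟨ *-assoc _ _ _ ⟨
    ι g * r̄ * q  ≈⟨ *-congʳ (0<⇒*⁻¹≈1 0<ιg) ⟩
    1# * q  ≈⟨ *-identityˡ q ⟩
    q  ∎

  1-q≤u : 1# - q ≤ u
  1-q≤u = ≤-trans (≤-reflexive (+-congˡ (-‿cong (sym g*q₀≈q)))) (bernoulli⁻ g (<⇒≤ 0<q₀) (<⇒≤ q₀<1))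

  4ℓq≤1 : ι 4 * (ι ℓ * q) ≤ 1#
  4ℓq≤1 = begin
    ι 4 * (ι ℓ * q)  ≈⟨ *-assoc _ _ _ ⟨
    ι 4 * ι ℓ * q  ≈⟨ *-congʳ (ι-* 4 ℓ) ⟨
    ι (4 ℕ.* ℓ) * q  ≤⟨ *-monoˡ-≤ (<⇒≤ 0<q) (ι-mono (4ℓ≤2^ℓ 4≤ℓ)) ⟩
    ι A * q  ≈⟨ A*q≈1 ⟩
    1#  ∎

  -- Bernoulli twice: `v` is at least 1 - ℓ(1 - u), and 1 - u is at most `q`.
  3≤4v : ι 3 ≤ ι 4 * v
  3≤4v = begin
    ι 3  ≈⟨ solve 0 (con (+ 3) := con (+ 4) :- con (+ 1)) refl ⟩
    ι 4 - 1#  ≤⟨ +-monoʳ-≤ (ι 4) (-‿antimono-≤ 4ℓq≤1) ⟩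
    ι 4 - ι 4 * (ι ℓ * q)  ≤⟨ +-monoʳ-≤ (ι 4) (-‿antimono-≤ (*-monoʳ-≤ (0≤ι 4) (*-monoʳ-≤ (0≤ι ℓ) 1-u≤q))) ⟩
    ι 4 - ι 4 * (ι ℓ * (1# - u))  ≈⟨ solve 1 (λ x → con (+ 4) :- con (+ 4) :* x := con (+ 4) :* (con (+ 1) :- x)) refl (ι ℓ * (1# - u)) ⟩
    ι 4 * (1# - ι ℓ * (1# - u))  ≤⟨ *-monoʳ-≤ (0≤ι 4) (bernoulli⁻ ℓ (x≤y⇒0≤y-x u≤1) (x-y≤x (<⇒≤ 0<u))) ⟩
    ι 4 * (1# - (1# - u)) ^ ℓ  ≈⟨ *-congˡ (^-congˡ ℓ (solve 1 (λ u → con (+ 1) :- (con (+ 1) :- u) := u) refl u)) ⟩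
    ι 4 * v  ∎
    where
    1-u≤q : 1# - u ≤ q
    1-u≤q = 0≤y-x⇒x≤y (≤-trans (x≤y⇒0≤y-x 1-q≤u) (≤-reflexive
      (solve 2 (λ q u → u :- (con (+ 1) :- q) := q :- (con (+ 1) :- u)) refl q u)))

  -- 2v - 1 - v³ = (1 - v)(v² + v - 1), and v ≥ 3/4.
  z-bound : ∀ {z} → z ≤ half → z + (1# - z) * b ≤ v
  z-bound {z} z≤half = *-cancelˡ-≤ (0<ι 1) (begin
    ι 2 * (z + (1# - z) * b)
      ≈⟨ solve 2 (λ z b → con (+ 2) :* (z :+ (con (+ 1) :- z) :* b) := con (+ 2) :* b :+ con (+ 2) :* z :* (con (+ 1) :- b)) refl z b ⟩
    ι 2 * b + ι 2 * z * (1# - b)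
      ≤⟨ +-monoʳ-≤ _ (*-monoˡ-≤ (x≤y⇒0≤y-x b≤1) (≤-trans (*-monoʳ-≤ (0≤ι 2) z≤half) (≤-reflexive 2*half≈1))) ⟩
    ι 2 * b + 1# * (1# - b)
      ≤⟨ x≤x+y (*-nonneg (x≤y⇒0≤y-x v≤1) 0≤poly) ⟩
    ι 2 * b + 1# * (1# - b) + (1# - v) * (v * v + v - 1#)
      ≈⟨ solve 1 (λ v → con (+ 2) :* (v :^ 3) :+ con (+ 1) :* (con (+ 1) :- v :^ 3) :+ (con (+ 1) :- v) :* (v :* v :+ v :- con (+ 1))
            := con (+ 2) :* v) refl v ⟩
    ι 2 * v
      ∎)
    where
    0≤poly : 0# ≤ v * v + v - 1#
    0≤poly = *-cancelˡ-≤ (0<ι 15) (begin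
      ι 16 * 0#  ≈⟨ zeroʳ _ ⟩
      0#  ≤⟨ 0≤ι 5 ⟩
      ι 5  ≈⟨ solve 0 (con (+ 5) := con (+ 3) :* con (+ 3) :+ con (+ 4) :* con (+ 3) :- con (+ 16)) refl ⟩
      ι 3 * ι 3 + ι 4 * ι 3 - ι 16  ≤⟨ +-monoˡ-≤ _ (+-mono-≤ (*-mono-≤ (0≤ι 3) (*-nonneg (0≤ι 4) (<⇒≤ 0<v)) 3≤4v 3≤4v) (*-monoʳ-≤ (0≤ι 4) 3≤4v)) ⟩
      ι 4 * v * (ι 4 * v) + ι 4 * (ι 4 * v) - ι 16  ≈⟨ solve 1 (λ v → con (+ 4) :* v :* (con (+ 4) :* v) :+ con (+ 4) :* (con (+ 4) :* v) :- con (+ 16) := con (+ 16) :* (v :* v :+ v :- con (+ 1))) refl v ⟩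
      ι 16 * (v * v + v - 1#)  ∎)

  -- A supporting line at `w` of the convex function j ↦ u^j, with slope -(1 - u)u^w in place of the
  -- derivative, so that no logarithm enters. To the right of `w` it is Bernoulli's inequality; to
  -- the left, use 1 + d(1 - u) ≤ (2 - u)^d and u(2 - u) ≤ 1.
  tangent : ∀ j w → u ^ w * (1# - (1# - u) * (ι j - ι w)) ≤ u ^ j
  tangent j w with ℕP.≤-total w j
  ... | inj₁ w≤j = begin
    u ^ w * (1# - (1# - u) * (ι j - ι w))  ≈⟨ *-congˡ (+-congˡ (-‿cong (trans (*-comm _ _) (*-congʳ (sym d≈))))) ⟩
    u ^ w * (1# - ι d * (1# - u))  ≤⟨ *-monoʳ-≤ (^-nonneg w (<⇒≤ 0<u)) (bernoulli⁻ d (x≤y⇒0≤y-x u≤1) (x-y≤x (<⇒≤ 0<u))) ⟩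
    u ^ w * (1# - (1# - u)) ^ d  ≈⟨ *-congˡ (^-congˡ d (solve 1 (λ u → con (+ 1) :- (con (+ 1) :- u) := u) refl u)) ⟩
    u ^ w * u ^ d  ≈⟨ ^-homo-* u w d ⟨
    u ^ (w ℕ.+ d)  ≡⟨ ≡.cong (u ^_) (ℕP.m+[n∸m]≡n w≤j) ⟩
    u ^ j  ∎
    where
    d = j ℕ.∸ w
    d≈ : ι d ≈ ι j - ι w
    d≈ = trans (solve 2 (λ d w → d := w :+ d :- w) refl (ι d) (ι w))
      (+-congʳ (trans (sym (ι-+ w d)) (reflexive (≡.cong ι (ℕP.m+[n∸m]≡n w≤j)))))
  ... | inj₂ j≤w = begin
    u ^ w * (1# - (1# - u) * (ι j - ι w))  ≈⟨ *-cong (trans (reflexive (≡.cong (u ^_) (≡.sym (ℕP.m+[n∸m]≡n j≤w)))) (^-homo-* u j d))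
                                                      (trans (solve 3 (λ u j w → con (+ 1) :- (con (+ 1) :- u) :* (j :- w) := con (+ 1) :+ (w :- j) :* (con (+ 1) :- u)) refl u (ι j) (ι w))
                                                             (+-congˡ (*-congʳ (sym d≈)))) ⟩
    u ^ j * u ^ d * (1# + ι d * (1# - u))  ≤⟨ *-monoʳ-≤ (*-nonneg (^-nonneg j (<⇒≤ 0<u)) (^-nonneg d (<⇒≤ 0<u))) (bernoulli d (x≤y⇒0≤y-x u≤1)) ⟩
    u ^ j * u ^ d * (1# + (1# - u)) ^ d  ≈⟨ trans (*-assoc _ _ _) (*-congˡ (sym (^-distrib-* u _ d))) ⟩
    u ^ j * (u * (1# + (1# - u))) ^ d  ≤⟨ *-monoʳ-≤ (^-nonneg j (<⇒≤ 0<u)) (^-≤1 d (*-nonneg (<⇒≤ 0<u) (0≤-+ 0≤1 (x≤y⇒0≤y-x u≤1))) (begin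
        u * (1# + (1# - u))  ≈⟨ solve 1 (λ u → u :* (con (+ 1) :+ (con (+ 1) :- u)) := con (+ 1) :- (con (+ 1) :- u) :* (con (+ 1) :- u)) refl u ⟩
        1# - (1# - u) * (1# - u)  ≤⟨ x-y≤x (0≤x*x (1# - u)) ⟩
        1#  ∎)) ⟩
    u ^ j * 1#  ≈⟨ *-identityʳ _ ⟩
    u ^ j  ∎
    where
    d = w ℕ.∸ j
    d≈ : ι d ≈ ι w - ι j
    d≈ = trans (solve 2 (λ d j → d := j :+ d :- j) refl (ι d) (ι j))
      (+-congʳ (trans (sym (ι-+ j d)) (reflexive (≡.cong ι (ℕP.m+[n∸m]≡n j≤w)))))

-- The hitting property and the number of light vertices.

module Hitting (ℝ : Reals) {N : ℕ} where
  open Reals ℝ hiding (zero)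
  open OrderedField ℝ
  open Sums ℝ

  avoids : List (Fin N) → Subset N → Carrier
  avoids []      L = 1#
  avoids (w ∷ U) L = ind (not (lookup L w)) * avoids U L

  Hits : List (Subset N) → List (Fin N) → Carrier → Set
  Hits 𝓜 ρ b = ∀ U → Unique U → All (_∈ ρ) U → sumOver 𝓜 (avoids U) ≤ b ^ length U * ι (length 𝓜)

module LightSets (ℝ : Reals) (s ℓ : ℕ) (2≤s : 2 ℕ.≤ s) (4≤ℓ : 4 ℕ.≤ ℓ) {N : ℕ}
  (𝓜 : List (Subset N)) (1≤∣𝓜∣ : 1 ℕ.≤ length 𝓜) (ρ : List (Fin N))
  (hits : Hitting.Hits ℝ 𝓜 ρ (Parameters.b ℝ s ℓ 2≤s 4≤ℓ)) where
  open Reals ℝ hiding (zero)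
  open OrderedField ℝ
  open Sums ℝ
  open Hitting ℝ
  open Parameters ℝ s ℓ 2≤s 4≤ℓ
  open Construction ℝ 𝓜 ρ q q₀ r̄ 0<q 0<q₀ q₀<1 (<⇒≤ 0<r̄) r̄≤1 r̄q≈q₀
  open ≤R

  private
    m z : Carrier
    m = ι (length 𝓜)
    z = u ^ A

    z≈y^K : z ≈ y ^ K
    z≈y^K = trans (^-assocʳ y g A) (reflexive (≡.cong (y ^_) (ℕP.*-comm g A)))

    z≤half : z ≤ half
    z≤half = ≤-trans (≤-reflexive z≈y^K) y^K≤half

    0≤z : 0# ≤ z
    0≤z = ^-nonneg A (<⇒≤ 0<u)

    z≤1 : z ≤ 1#
    z≤1 = ^-≤1 A (<⇒≤ 0<u) u≤1

    damp : List (Fin N) → Subset N → Carrier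
    damp []      L = 1#
    damp (w ∷ W) L = (if lookup L w then z else 1#) * damp W L

    common : List (Fin N) → Subset N → ℕ
    common []      L = 0
    common (w ∷ W) L = (if lookup L w then 1 else 0) ℕ.+ common W L

    -- Under a weight for which all of `W` is light, the exponent has mean at most `length W`,
    -- because `ι A * q ≈ 1#`. This normalisation is the reason for `z = u ^ A`.
    damp≈ : ∀ W L → damp W L ≈ u ^ (A ℕ.* common W L)
    damp≈ []      L = reflexive (≡.cong (u ^_) (≡.sym (ℕP.*-zeroʳ A)))
    damp≈ (w ∷ W) L with lookup L w
    ... | false = trans (*-identityˡ _) (damp≈ W L)
    ... | true  = begin-equality
      u ^ A * damp W L  ≈⟨ *-congˡ (damp≈ W L) ⟩
      u ^ A * u ^ (A ℕ.* common W L)  ≈⟨ ^-homo-* u A _ ⟨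
      u ^ (A ℕ.+ A ℕ.* common W L)  ≡⟨ ≡.cong (u ^_) (≡.sym (ℕP.*-suc A (common W L))) ⟩
      u ^ (A ℕ.* suc (common W L))  ∎

    ι-common : ∀ W L → ι (common W L) ≈ sumOver W (λ w → ind (lookup L w))
    ι-common []      L = refl
    ι-common (w ∷ W) L with lookup L w
    ... | false = trans (ι-common W L) (sym (+-identityˡ _))
    ... | true  = trans (ι-suc (common W L)) (+-congˡ (ι-common W L))

    -- The damping factor is the probability that a random subset of W, each
    -- vertex being kept with probability 1 - z, avoids L.
    damp-total : ∀ W U → Unique W → Unique U → All (λ w → All (w ≢_) U) W → All (_∈ ρ) W → All (_∈ ρ) U →
                 sumOver 𝓜 (λ L → avoids U L * damp W L) ≤ b ^ length U * (v ^ length W * m)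
    damp-total [] U _ U! _ _ U⊆ρ = begin
      sumOver 𝓜 (λ L → avoids U L * 1#)  ≈⟨ sum-cong 𝓜 (λ L → *-identityʳ _) ⟩
      sumOver 𝓜 (avoids U)  ≤⟨ hits U U! U⊆ρ ⟩
      b ^ length U * m  ≈⟨ *-congˡ (*-identityˡ m) ⟨
      b ^ length U * (1# * m)  ∎
    damp-total (w ∷ W) U (w∉W ∷ W!) U! (w∉U ∷ W∉U) (w∈ρ ∷ W⊆ρ) U⊆ρ = begin
      sumOver 𝓜 (λ L → avoids U L * ((if lookup L w then z else 1#) * damp W L))
        ≈⟨ sum-cong 𝓜 (λ L → trans (*-congˡ (*-congʳ (split (lookup L w))))
             (solve 4 (λ a z i d → a :* ((z :+ (con (+ 1) :- z) :* i) :* d) := z :* (a :* d) :+ (con (+ 1) :- z) :* (i :* a :* d)) refl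
               (avoids U L) z (ind (not (lookup L w))) (damp W L))) ⟩
      sumOver 𝓜 (λ L → z * (avoids U L * damp W L) + (1# - z) * (avoids (w ∷ U) L * damp W L))
        ≈⟨ trans (sum-+ 𝓜 _ _) (+-cong (sum-*ˡ 𝓜 z _) (sum-*ˡ 𝓜 (1# - z) _)) ⟩
      z * sumOver 𝓜 (λ L → avoids U L * damp W L) + (1# - z) * sumOver 𝓜 (λ L → avoids (w ∷ U) L * damp W L)
        ≤⟨ +-mono-≤ (*-monoʳ-≤ 0≤z (damp-total W U W! U! W∉U W⊆ρ U⊆ρ))
                    (*-monoʳ-≤ (x≤y⇒0≤y-x z≤1) (damp-total W (w ∷ U) W! (w∉U ∷ U!)
                       (All.zipWith (λ (w≢x , x∉U) → (w≢x ∘ ≡.sym) ∷ x∉U) (w∉W , W∉U)) W⊆ρ (w∈ρ ∷ U⊆ρ))) ⟩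
      z * (b ^ length U * X) + (1# - z) * (b * b ^ length U * X)
        ≈⟨ solve 4 (λ z B b X → z :* (B :* X) :+ (con (+ 1) :- z) :* (b :* B :* X) := (B :* X) :* (z :+ (con (+ 1) :- z) :* b)) refl z (b ^ length U) b X ⟩
      (b ^ length U * X) * (z + (1# - z) * b)
        ≤⟨ *-monoʳ-≤ (*-nonneg (^-nonneg (length U) (<⇒≤ 0<b)) (*-nonneg (^-nonneg (length W) (<⇒≤ 0<v)) (0≤ι (length 𝓜)))) (z-bound z≤half) ⟩
      (b ^ length U * X) * v
        ≈⟨ solve 4 (λ B V m v → (B :* (V :* m)) :* v := B :* (v :* V :* m)) refl (b ^ length U) (v ^ length W) m v ⟩
      b ^ length U * (v * v ^ length W * m)
        ∎
      where
      X : Carrier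
      X = v ^ length W * m
      split : ∀ c → (if c then z else 1#) ≈ z + (1# - z) * ind (not c)
      split true  = solve 1 (λ z → z := z :+ (con (+ 1) :- z) :* con (+ 0)) refl z
      split false = solve 1 (λ z → con (+ 1) := z :+ (con (+ 1) :- z) :* con (+ 1)) refl z

    0<m : 0# < m
    0<m = 0<ι′ 1≤∣𝓜∣

    -- Jensen's inequality for the convex function j ↦ u ^ j.
    damp-lower : ∀ κ W → (∀ L → 0# ≤ κ L) → All (Light κ) W →
                 u ^ length W * mass κ ≤ sumOver 𝓜 (λ L → κ L * damp W L)
    damp-lower κ W 0≤κ light = begin
      U * M
        ≤⟨ *-monoʳ-≤ 0≤U (x+y≤z⇒x≤z-y (begin
             M + (1# - u) * D  ≤⟨ +-monoʳ-≤ M (begin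
                  (1# - u) * D  ≤⟨ *-monoʳ-≤ (x≤y⇒0≤y-x u≤1) D≤0 ⟩
                  (1# - u) * 0#  ≈⟨ zeroʳ _ ⟩
                  0#  ∎) ⟩
             M + 0#  ≈⟨ +-identityʳ M ⟩
             M  ∎)) ⟩
      U * (M - (1# - u) * D)
        ≈⟨ *-congˡ (+-congˡ (trans (-‿distribˡ-* _ _) (sym (sum-*ˡ 𝓜 _ _)))) ⟩
      U * (M + sumOver 𝓜 (λ L → - (1# - u) * (κ L * (ι (A ℕ.* common W L) - w))))
        ≈⟨ trans (*-congˡ (sym (sum-+ 𝓜 κ _))) (sym (sum-*ˡ 𝓜 U _)) ⟩
      sumOver 𝓜 (λ L → U * (κ L + - (1# - u) * (κ L * (ι (A ℕ.* common W L) - w))))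
        ≈⟨ sum-cong 𝓜 (λ L → solve 4 (λ U k x t → U :* (k :+ (:- x) :* (k :* t)) := k :* (U :* (con (+ 1) :- x :* t))) refl U (κ L) (1# - u) _) ⟩
      sumOver 𝓜 (λ L → κ L * (U * (1# - (1# - u) * (ι (A ℕ.* common W L) - w))))
        ≤⟨ sum-mono 𝓜 (λ L → *-monoʳ-≤ (0≤κ L) (tangent (A ℕ.* common W L) (length W))) ⟩
      sumOver 𝓜 (λ L → κ L * u ^ (A ℕ.* common W L))
        ≈⟨ sum-cong 𝓜 (λ L → *-congˡ (damp≈ W L)) ⟨
      sumOver 𝓜 (λ L → κ L * damp W L)
        ∎
      where
      U M w D : Carrier
      U = u ^ length W
      M = mass κ
      w = ι (length W)
      D = sumOver 𝓜 (λ L → κ L * (ι (A ℕ.* common W L) - w))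

      0≤U : 0# ≤ U
      0≤U = ^-nonneg (length W) (<⇒≤ 0<u)

      D≤0 : D ≤ 0#
      D≤0 = begin
        D
          ≈⟨ sum-cong 𝓜 (λ L → trans (*-congˡ (+-congʳ (trans (ι-* A (common W L)) (*-congˡ (ι-common W L)))))
               (solve 4 (λ k a c w → k :* (a :* c :- w) := a :* (k :* c) :+ (:- w) :* k) refl (κ L) (ι A) (sumOver W (λ w → ind (lookup L w))) w)) ⟩
        sumOver 𝓜 (λ L → ι A * (κ L * sumOver W (λ w → ind (lookup L w))) + (- w) * κ L)
          ≈⟨ trans (sum-+ 𝓜 _ _) (+-cong (sum-*ˡ 𝓜 (ι A) _) (sum-*ˡ 𝓜 (- w) κ)) ⟩
        ι A * sumOver 𝓜 (λ L → κ L * sumOver W (λ w → ind (lookup L w))) + (- w) * M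
          ≈⟨ +-congʳ (*-congˡ (trans (sum-cong 𝓜 (λ L → sym (sum-*ˡ W (κ L) _))) (sum-swap 𝓜 W _))) ⟩
        ι A * sumOver W (massAt κ) + (- w) * M
          ≤⟨ +-monoˡ-≤ _ (*-monoʳ-≤ (0≤ι A) (sum-mono-All light)) ⟩
        ι A * sumOver W (λ _ → q * M) + (- w) * M
          ≈⟨ +-congʳ (*-congˡ (sum-const W (q * M))) ⟩
        ι A * (w * (q * M)) + (- w) * M
          ≈⟨ solve 4 (λ a q w M → a :* (w :* (q :* M)) :+ (:- w) :* M := (a :* q) :* (w :* M) :- w :* M) refl (ι A) q w M ⟩
        (ι A * q) * (w * M) - w * M
          ≈⟨ +-congʳ (trans (*-congʳ A*q≈1) (*-identityˡ _)) ⟩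
        w * M - w * M
          ≈⟨ -‿inverseʳ _ ⟩
        0#
          ∎

  -- The weighted sum of damping factors is estimated twice: from below by `damp-lower`, from above
  -- by `κ L ≤ r̄ ^ i` and `damp-total`. After cancelling, `q ^ i * y ^ j * u ^ w ≤ v ^ w` remains;
  -- since y^(Kℓ) ≤ q and v = u^ℓ, both sides become powers of `y`, and their exponents are
  -- compared.
  light-bound : ∀ κ i j W → Reached κ i j → Unique W → All (_∈ ρ) W → All (Light κ) W →
                g ℕ.* (ℓ ℕ.∸ 1) ℕ.* length W ℕ.≤ suc (K ℕ.* ℓ) ℕ.* i ℕ.+ j
  light-bound κ i j W (reach 0≤κ κ≤ mass≈) W! W⊆ρ light = ℕP.+-cancelʳ-≤ (g ℕ.* w) _ _
    (≡.subst (ℕ._≤ suc (K ℕ.* ℓ) ℕ.* i ℕ.+ j ℕ.+ g ℕ.* w) (≡.sym lhs)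
      (ℕP.≤-trans exponents (ℕP.+-monoˡ-≤ (g ℕ.* w) (ℕP.+-monoˡ-≤ j (ℕP.*-monoˡ-≤ i (ℕP.n≤1+n (K ℕ.* ℓ)))))))
    where
    w = length W

    lhs : g ℕ.* (ℓ ℕ.∸ 1) ℕ.* w ℕ.+ g ℕ.* w ≡ g ℕ.* ℓ ℕ.* w
    lhs = ≡.trans (eq (ℓ ℕ.∸ 1)) (≡.cong (λ k → g ℕ.* k ℕ.* w) (ℕP.m+[n∸m]≡n {1} {ℓ} (ℕP.≤-trans (ℕ.s≤s ℕ.z≤n) 4≤ℓ)))
      where
      open +-*-Solver using () renaming (solve to solveℕ; _:=_ to _:≡_; _:+_ to _⊕_; _:*_ to _⊗_; con to lit)
      eq : ∀ k → g ℕ.* k ℕ.* w ℕ.+ g ℕ.* w ≡ g ℕ.* (1 ℕ.+ k) ℕ.* w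
      eq k = solveℕ 3 (λ g k w → g ⊗ k ⊗ w ⊕ g ⊗ w :≡ g ⊗ (lit 1 ⊕ k) ⊗ w) ≡.refl g k w

    key : q ^ i * y ^ j * u ^ w ≤ v ^ w
    key = *-cancelˡ-≤ (0<-* (^-pos i 0<r̄) 0<m) (begin
      r̄ ^ i * m * (q ^ i * y ^ j * u ^ w)
        ≈⟨ solve 5 (λ r m q y u → r :* m :* (q :* y :* u) := u :* (m :* (r :* q :* y))) refl (r̄ ^ i) m (q ^ i) (y ^ j) (u ^ w) ⟩
      u ^ w * (m * (r̄ ^ i * q ^ i * y ^ j))
        ≈⟨ *-congˡ (*-congˡ (*-congʳ (trans (sym (^-distrib-* r̄ q i)) (^-congˡ i r̄q≈q₀)))) ⟩
      u ^ w * (m * (q₀ ^ i * y ^ j))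
        ≈⟨ *-congˡ mass≈ ⟨
      u ^ w * mass κ
        ≤⟨ damp-lower κ W 0≤κ light ⟩
      sumOver 𝓜 (λ L → κ L * damp W L)
        ≤⟨ sum-mono 𝓜 (λ L → *-monoˡ-≤ (≤-trans (^-nonneg (A ℕ.* common W L) (<⇒≤ 0<u)) (≤-reflexive (sym (damp≈ W L)))) (κ≤ L)) ⟩
      sumOver 𝓜 (λ L → r̄ ^ i * damp W L)
        ≈⟨ sum-*ˡ 𝓜 (r̄ ^ i) _ ⟩
      r̄ ^ i * sumOver 𝓜 (damp W)
        ≤⟨ *-monoʳ-≤ (^-nonneg i (<⇒≤ 0<r̄)) (begin
             sumOver 𝓜 (damp W)  ≈⟨ sum-cong 𝓜 (λ L → *-identityˡ _) ⟨
             sumOver 𝓜 (λ L → 1# * damp W L)  ≤⟨ damp-total W [] W! [] (All.universal (λ _ → []) W) W⊆ρ [] ⟩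
             1# * (v ^ w * m)  ≈⟨ *-identityˡ _ ⟩
             v ^ w * m  ∎) ⟩
      r̄ ^ i * (v ^ w * m)
        ≈⟨ solve 3 (λ r v m → r :* (v :* m) := r :* m :* v) refl (r̄ ^ i) (v ^ w) m ⟩
      r̄ ^ i * m * v ^ w
        ∎)

    exponents : g ℕ.* ℓ ℕ.* w ℕ.≤ K ℕ.* ℓ ℕ.* i ℕ.+ j ℕ.+ g ℕ.* w
    exponents = ^-cancel-≥ 0<y y<1 (begin
      y ^ (K ℕ.* ℓ ℕ.* i ℕ.+ j ℕ.+ g ℕ.* w)  ≈⟨ trans (^-homo-* y (K ℕ.* ℓ ℕ.* i ℕ.+ j) (g ℕ.* w)) (*-congʳ (^-homo-* y (K ℕ.* ℓ ℕ.* i) j)) ⟩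
      y ^ (K ℕ.* ℓ ℕ.* i) * y ^ j * y ^ (g ℕ.* w)  ≈⟨ *-cong (*-congʳ (^-assocʳ y (K ℕ.* ℓ) i)) (^-assocʳ y g w) ⟨
      (y ^ (K ℕ.* ℓ)) ^ i * y ^ j * u ^ w  ≤⟨ *-monoˡ-≤ (^-nonneg w (<⇒≤ 0<u)) (*-monoˡ-≤ (^-nonneg j (<⇒≤ 0<y))
                                                            (^-mono-≤ i (^-nonneg (K ℕ.* ℓ) (<⇒≤ 0<y)) y^Kℓ≤q)) ⟩
      q ^ i * y ^ j * u ^ w  ≤⟨ key ⟩
      v ^ w  ≈⟨ trans (^-congˡ w (^-assocʳ y g ℓ)) (^-assocʳ y (g ℕ.* ℓ) w) ⟩
      y ^ (g ℕ.* ℓ ℕ.* w)  ∎)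

  -- The mean gain of the potential in one query. The coefficient was raised from `K ℓ` to `K ℓ + 1`
  -- so that this gain is the integer `ℓ + 1`.
  balance : q₀ * ι (suc (K ℕ.* ℓ)) + (1# - q₀) ≈ ι (suc ℓ)
  balance = begin-equality
    q₀ * ι (suc (K ℕ.* ℓ)) + (1# - q₀)  ≈⟨ +-congʳ (*-congˡ (trans (ι-suc (K ℕ.* ℓ)) (+-congˡ (ι-* K ℓ)))) ⟩
    q₀ * (1# + ι K * ι ℓ) + (1# - q₀)  ≈⟨ solve 3 (λ q k l → q :* (con (+ 1) :+ k :* l) :+ (con (+ 1) :- q) := con (+ 1) :+ (k :* q) :* l) refl q₀ (ι K) (ι ℓ) ⟩
    1# + (ι K * q₀) * ι ℓ  ≈⟨ +-congˡ (trans (*-congʳ K*q₀≈1) (*-identityˡ _)) ⟩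
    1# + ι ℓ  ≈⟨ ι-suc ℓ ⟨
    ι (suc ℓ)  ∎

-- Abel summation along decreasing degrees.

module Abel (ℝ : Reals) {A : Set} (d f : A → Reals.Carrier ℝ) where
  open Reals ℝ hiding (zero)
  open OrderedField ℝ
  open Sums ℝ
  open ≤R

  private
    abel-slack : (∀ x → 0# ≤ d x) → ∀ γ xs D τ → 0# ≤ D → 0# ≤ τ → All (λ x → d x ≤ D) xs → AllPairs (λ x y → d y ≤ d x) xs →
                 (∀ P Q → xs ≡ P ++ Q → sumOver P f ≤ τ + γ * ι (length P)) →
                 sumOver xs (λ x → d x * f x) ≤ D * τ + γ * sumOver xs d
    abel-slack 0≤d γ [] D τ 0≤D 0≤τ _ _ _ =
      ≤-trans (*-nonneg 0≤D 0≤τ) (≤-reflexive (sym (trans (+-congˡ (zeroʳ γ)) (+-identityʳ _))))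
    abel-slack 0≤d γ (x ∷ xs) D τ _ 0≤τ (dx≤D ∷ _) (d≤dx ∷ sorted) pre = begin
      d x * f x + sumOver xs (λ x → d x * f x)
        ≤⟨ +-monoʳ-≤ _ (abel-slack 0≤d γ xs (d x) τ′ (0≤d x) 0≤τ′ d≤dx sorted pre′) ⟩
      d x * f x + (d x * (τ + γ - f x) + γ * sumOver xs d)
        ≈⟨ solve 5 (λ d f t g S → d :* f :+ (d :* (t :+ g :- f) :+ g :* S) := d :* t :+ g :* (d :+ S)) refl (d x) (f x) τ γ (sumOver xs d) ⟩
      d x * τ + γ * (d x + sumOver xs d)
        ≤⟨ +-monoˡ-≤ _ (*-monoˡ-≤ 0≤τ dx≤D) ⟩
      D * τ + γ * (d x + sumOver xs d)
        ∎
      where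
      τ′ : Carrier
      τ′ = τ + γ - f x
      0≤τ′ : 0# ≤ τ′
      0≤τ′ = x≤y⇒0≤y-x (begin
        f x  ≈⟨ +-identityʳ _ ⟨
        f x + 0#  ≤⟨ pre (x ∷ []) xs ≡.refl ⟩
        τ + γ * 1#  ≈⟨ +-congˡ (*-identityʳ γ) ⟩
        τ + γ  ∎)
      pre′ : ∀ P Q → xs ≡ P ++ Q → sumOver P f ≤ τ′ + γ * ι (length P)
      pre′ P Q eq = begin
        sumOver P f  ≈⟨ solve 2 (λ S f → S := f :+ S :- f) refl (sumOver P f) (f x) ⟩
        f x + sumOver P f - f x  ≤⟨ +-monoˡ-≤ _ (pre (x ∷ P) Q (≡.cong (x ∷_) eq)) ⟩
        τ + γ * ι (suc (length P)) - f x  ≈⟨ +-congʳ (+-congˡ (*-congˡ (ι-suc (length P)))) ⟩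
        τ + γ * (1# + ι (length P)) - f x  ≈⟨ solve 4 (λ t g n f → t :+ g :* (con (+ 1) :+ n) :- f := t :+ g :- f :+ g :* n) refl τ γ (ι (length P)) (f x) ⟩
        τ + γ - f x + γ * ι (length P)  ∎

  abel : (∀ x → 0# ≤ d x) → ∀ γ xs → AllPairs (λ x y → d y ≤ d x) xs →
         (∀ P Q → xs ≡ P ++ Q → sumOver P f ≤ γ * ι (length P)) →
         sumOver xs (λ x → d x * f x) ≤ γ * sumOver xs d
  abel 0≤d γ []       _        _   = ≤-reflexive (sym (zeroʳ γ))
  abel 0≤d γ (x ∷ xs) (d≤dx ∷ sorted) pre = begin
    sumOver (x ∷ xs) (λ x → d x * f x)
      ≤⟨ abel-slack 0≤d γ (x ∷ xs) (d x) 0# (0≤d x) ≤-refl (≤-refl ∷ d≤dx) (d≤dx ∷ sorted)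
           (λ P Q eq → ≤-trans (pre P Q eq) (≤-reflexive (sym (+-identityˡ _)))) ⟩
    d x * 0# + γ * sumOver (x ∷ xs) d
      ≈⟨ trans (+-congʳ (zeroʳ _)) (+-identityˡ _) ⟩
    γ * sumOver (x ∷ xs) d
      ∎

-- First and second moments of products along the exploration.

module Moments (ℝ : Reals) (s ℓ : ℕ) (2≤s : 2 ℕ.≤ s) (4≤ℓ : 4 ℕ.≤ ℓ) (N : ℕ) where
  open Reals ℝ hiding (zero)
  open OrderedField ℝ
  open Sums ℝ
  open Parameters ℝ s ℓ 2≤s 4≤ℓ
  open Exploration ℝ N
  open WellFormed r̄
  open ≤R

  -- `φ` gives a pending vertex the mean `K q₀ = 1` of its value after a query, `ψ` treats it as
  -- lost, and `χ` is `ψ` without the factor `K`.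
  φ ψ χ : Status → Carrier
  φ pending  = 1#
  φ included = ι K
  φ skipped  = 0#
  ψ pending  = 0#
  ψ included = ι K
  ψ skipped  = 0#
  χ pending  = 0#
  χ included = 1#
  χ skipped  = 0#

  0≤φ : ∀ a → 0# ≤ φ a
  0≤φ pending  = 0≤1
  0≤φ included = 0≤ι K
  0≤φ skipped  = ≤-refl

  0≤ψ : ∀ a → 0# ≤ ψ a
  0≤ψ pending  = ≤-refl
  0≤ψ included = 0≤ι K
  0≤ψ skipped  = ≤-refl

  ψ≤φ : ∀ a → ψ a ≤ φ a
  ψ≤φ pending  = 0≤1
  ψ≤φ included = ≤-refl
  ψ≤φ skipped  = ≤-refl

  prodOn : (Status → Carrier) → Subset N → State → Carrier
  prodOn θ F σ = ∏ (λ w → on F w (θ (σ w)))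

  -- X F has mean 1, and Ψ F is K^|F| times the indicator of "F is included".
  X Ψ : Subset N → State → Carrier
  X = prodOn φ
  Ψ = prodOn ψ

  0≤on : ∀ (F : Subset N) w {x} → 0# ≤ x → 0# ≤ on F w x
  0≤on F w 0≤x with lookup F w
  ... | true  = 0≤x
  ... | false = 0≤1

  on-mono : ∀ (F : Subset N) w {x x′} → x ≤ x′ → on F w x ≤ on F w x′
  on-mono F w x≤x′ with lookup F w
  ... | true  = x≤x′
  ... | false = ≤-refl

  0≤prodOn : ∀ {θ} → (∀ a → 0# ≤ θ a) → ∀ F σ → 0# ≤ prodOn θ F σ
  0≤prodOn 0≤θ F σ = ∏-nonneg (λ w → 0≤on F w (0≤θ (σ w)))

  0≤X : ∀ F σ → 0# ≤ X F σ
  0≤X = 0≤prodOn 0≤φ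

  0≤Ψ : ∀ F σ → 0# ≤ Ψ F σ
  0≤Ψ = 0≤prodOn 0≤ψ

  Ψ≤X : ∀ F σ → Ψ F σ ≤ X F σ
  Ψ≤X F σ = ∏-mono (λ w → 0≤on F w (0≤ψ (σ w))) (λ w → on-mono F w (ψ≤φ (σ w)))

  σ₀ : State
  σ₀ _ = pending

  coin : Coin
  coin _ _ = q₀

  coin-fair : Fair coin
  coin-fair _ _ _ _ = <⇒≤ 0<q₀ , <⇒≤ q₀<1

  Ex-X : ∀ t → WF σ₀ t → ∀ F → Ex coin t σ₀ (X F) ≈ 1#
  Ex-X t wf F = trans (Ex-martingale (λ w a → on F w (φ a)) (λ w r → mart (lookup F w)) t wf)
    (trans (∏-on F 1#) (1^n≈1 ∣ F ∣))
    where
    mart : ∀ c → q₀ * (if c then ι K else 1#) + (1# - q₀) * (if c then 0# else 1#) ≈ (if c then 1# else 1#)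
    mart true  = trans (solve 2 (λ q k → q :* k :+ (con (+ 1) :- q) :* con (+ 0) := k :* q) refl q₀ (ι K)) K*q₀≈1
    mart false = solve 1 (λ q → q :* con (+ 1) :+ (con (+ 1) :- q) :* con (+ 1) := con (+ 1)) refl q₀

  private
    -- The square of `φ` is 1 at a pending vertex but has mean `K` after a query. Raising its
    -- pending value to `K` gives a martingale that dominates it.
    pair : Bool → Bool → Status → Carrier
    pair true  true  pending  = ι K
    pair true  true  included = ι K * ι K
    pair true  true  skipped  = 0#
    pair true  false a        = φ a
    pair false true  a        = φ a
    pair false false a        = 1#

    1≤K : 1# ≤ ι K
    1≤K = ι-mono {1} (ℕP.≤-trans (ℕ.s≤s ℕ.z≤n) 64≤K)

    pair-dominates : ∀ c c′ a → (if c then φ a else 1#) * (if c′ then φ a else 1#) ≤ pair c c′ a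
    pair-dominates true  true  pending  = ≤-trans (≤-reflexive (*-identityˡ 1#)) 1≤K
    pair-dominates true  true  included = ≤-refl
    pair-dominates true  true  skipped  = ≤-reflexive (zeroˡ _)
    pair-dominates true  false a        = ≤-reflexive (*-identityʳ _)
    pair-dominates false true  a        = ≤-reflexive (*-identityˡ _)
    pair-dominates false false a        = ≤-reflexive (*-identityˡ _)

    pair-mart : ∀ c c′ → q₀ * pair c c′ included + (1# - q₀) * pair c c′ skipped ≈ pair c c′ pending
    pair-mart true true = trans (solve 2 (λ q k → q :* (k :* k) :+ (con (+ 1) :- q) :* con (+ 0) := (k :* q) :* k) refl q₀ (ι K))
      (trans (*-congʳ K*q₀≈1) (*-identityˡ _))
    pair-mart true false = trans (solve 2 (λ q k → q :* k :+ (con (+ 1) :- q) :* con (+ 0) := k :* q) refl q₀ (ι K)) K*q₀≈1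
    pair-mart false true = trans (solve 2 (λ q k → q :* k :+ (con (+ 1) :- q) :* con (+ 0) := k :* q) refl q₀ (ι K)) K*q₀≈1
    pair-mart false false = solve 1 (λ q → q :* con (+ 1) :+ (con (+ 1) :- q) :* con (+ 1) := con (+ 1)) refl q₀

    pair-pending : ∀ c c′ → pair c c′ pending ≈ (if c ∧ c′ then ι K else 1#)
    pair-pending true  true  = refl
    pair-pending true  false = refl
    pair-pending false true  = refl
    pair-pending false false = refl

  -- As for independent coins: a common vertex contributes K²q₀ = K, every other vertex contributes
  -- 1, and vertices that are never queried only lower the product.
  Ex-XX : ∀ t → WF σ₀ t → ∀ F F′ → Ex coin t σ₀ (λ σ → X F σ * X F′ σ) ≤ ι K ^ ∣ F ∩ F′ ∣
  Ex-XX t wf F F′ = begin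
    Ex coin t σ₀ (λ σ → X F σ * X F′ σ)
      ≤⟨ Ex-mono coin-fair t wf (λ σ → ≤-trans (≤-reflexive (sym (∏-* (λ w → on F w (φ (σ w))) (λ w → on F′ w (φ (σ w))))))
           (∏-mono (λ w → *-nonneg (0≤on F w (0≤φ (σ w))) (0≤on F′ w (0≤φ (σ w)))) (λ w → pair-dominates (lookup F w) (lookup F′ w) (σ w)))) ⟩
    Ex coin t σ₀ (Prod h)
      ≈⟨ Ex-martingale h (λ w r → pair-mart (lookup F w) (lookup F′ w)) t wf ⟩
    ∏ (λ w → h w pending)
      ≈⟨ ∏-cong (λ w → trans (pair-pending (lookup F w) (lookup F′ w))
           (reflexive (≡.cong (λ c → if c then ι K else 1#) (≡.sym (VecP.lookup-zipWith _∧_ w F F′))))) ⟩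
    ∏ (λ w → on (F ∩ F′) w (ι K))
      ≈⟨ ∏-on (F ∩ F′) (ι K) ⟩
    ι K ^ ∣ F ∩ F′ ∣
      ∎
    where
    h : Fin N → Status → Carrier
    h w a = pair (lookup F w) (lookup F′ w) a

  X-remove : ∀ E v σ → σ v ≡ pending → X E σ ≈ X (E [ v ]≔ outside) σ
  X-remove E v σ σv = ∏-cong pointwise
    where
    pointwise : ∀ w → on E w (φ (σ w)) ≈ on (E [ v ]≔ outside) w (φ (σ w))
    pointwise w with w FinP.≟ v
    ... | no w≢v rewrite VecP.lookup∘update′ w≢v E outside = refl
    ... | yes ≡.refl rewrite VecP.lookup∘update v E outside | σv with lookup E v
    ...   | true  = refl
    ...   | false = refl

  X-settled : ∀ E σ → (∀ v → lookup E v ≡ true → σ v ≢ pending) → X E σ ≈ Ψ E σ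
  X-settled E σ settled = ∏-cong pointwise
    where
    same : ∀ a → a ≢ pending → φ a ≈ ψ a
    same pending  a≢ = ⊥-elim (a≢ ≡.refl)
    same included _  = refl
    same skipped  _  = refl
    pointwise : ∀ w → on E w (φ (σ w)) ≈ on E w (ψ (σ w))
    pointwise w with lookup E w in eq
    ... | true  = same (σ w) (settled w eq)
    ... | false = refl

∩-remove : ∀ {N} (E E′ : Subset N) v → (E [ v ]≔ outside) ∩ (E′ [ v ]≔ outside) ≡ (E ∩ E′) [ v ]≔ outside
∩-remove (e ∷ E) (e′ ∷ E′) zero    = ≡.refl
∩-remove (e ∷ E) (e′ ∷ E′) (suc v) = ≡.cong (e ∧ e′ ∷_) (∩-remove E E′ v)

-- Mass kept by the exploration, and the loss to pending vertices.

module Degrees (ℝ : Reals) {N : ℕ} (ν : Subset N → Reals.Carrier ℝ) where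
  open Reals ℝ hiding (zero)
  open Sums ℝ

  ∑ : (Subset N → Carrier) → Carrier
  ∑ = sumOver (subsets N)

  deg : Fin N → Carrier
  deg v = ∑ (λ E → ν E * ind (lookup E v))

  -- The part of Λ_p(ν) = Σ_{E,E'} ν(E) ν(E') Σ_{T ⊆ E∩E', |T| ≥ 2} p^{-|T|} with T = E ∩ E'.
  Γ : Carrier → Carrier
  Γ P = ∑ (λ E → ∑ (λ E′ → ν E * ν E′ * (ind (2 ℕ.≤ᵇ ∣ E ∩ E′ ∣) * P ^ ∣ E ∩ E′ ∣)))

module _ (ℝ : Reals) where
  open Reals ℝ hiding (zero)
  open OrderedField ℝ

  module Core (s ℓ : ℕ) (2≤s : 2 ℕ.≤ s) (4≤ℓ : 4 ℕ.≤ ℓ) {N : ℕ}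
    (𝓜 : List (Subset N)) (1≤∣𝓜∣ : 1 ℕ.≤ length 𝓜) (ρ : List (Fin N)) (ρ! : Unique ρ)
    (hits : Hitting.Hits ℝ 𝓜 ρ (Parameters.b ℝ s ℓ 2≤s 4≤ℓ))
    (ν : Subset N → Carrier) (0≤ν : ∀ E → 0# ≤ ν E)
    (supp : ∀ E → ν E ≈ 0# ⊎ (∣ E ∣ ≡ s × (∀ v → lookup E v ≡ true → v ∈ ρ)))
    (total-ν : Degrees.∑ ℝ ν ν ≈ 1#)
    (sorted : AllPairs (λ v w → Degrees.deg ℝ ν w ≤ Degrees.deg ℝ ν v) ρ)
    (p : Carrier) (0<p : 0# < p) (32p≤q₀ : ι 32 * p ≤ Parameters.q₀ ℝ s ℓ 2≤s 4≤ℓ)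
    (n : ℕ) (1≤n : 1 ℕ.≤ n) (∣ρ∣≤n : length ρ ℕ.≤ n)
    (pnΓ≤64 : p * ι n * Degrees.Γ ℝ ν (p ⁻¹) ≤ ι 64) where
    open Sums ℝ
    open Parameters ℝ s ℓ 2≤s 4≤ℓ
    open Exploration ℝ N
    open WellFormed r̄
    open Construction ℝ 𝓜 ρ q q₀ r̄ 0<q 0<q₀ q₀<1 (<⇒≤ 0<r̄) r̄≤1 r̄q≈q₀ hiding (coin; coin-fair)
    open LightSets ℝ s ℓ 2≤s 4≤ℓ 𝓜 1≤∣𝓜∣ ρ hits using (light-bound; balance)
    open Moments ℝ s ℓ 2≤s 4≤ℓ N
    open Degrees ℝ ν
    open ≤R

    private
      Ss : List (Subset N)
      Ss = subsets N

      P Kp : Carrier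
      P  = p ⁻¹
      Kp = ι K * p

      one : Weight
      one _ = 1#

      mass-one : mass one ≈ ι (length 𝓜)
      mass-one = trans (sum-const 𝓜 1#) (*-identityʳ _)

      abstract
        built : ∃ (Good one 0 0 σ₀)
        built = build (length ρ) one 0 0 σ₀ (<-≤-trans (0<ι′ 1≤∣𝓜∣) (≤-reflexive (sym mass-one))) (cnt-≤ σ₀ ρ)

    t : Tree
    t = proj₁ built

    good : Good one 0 0 σ₀ t
    good = proj₂ built

    wf : WF σ₀ t
    wf = Good⇒WF good

    reached : Reached one 0 0
    reached = reach (λ _ → 0≤1) (λ _ → ≤-refl)
      (trans mass-one (solve 1 (λ m → m := m :* (con (+ 1) :* con (+ 1))) refl (ι (length 𝓜))))

    𝔼 : (State → Carrier) → Carrier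
    𝔼 = Ex coin t σ₀

    -- `Y` is the mass of the edges inside the final random set, each rescaled by K^|E|. In `Φ`
    -- pending vertices are neutral, which makes its mean exactly 1; the difference of the two is
    -- the loss to be bounded.
    Y Φ : State → Carrier
    Y σ = ∑ (λ E → ν E * Ψ E σ)
    Φ σ = ∑ (λ E → ν E * X E σ)

    -- The factor at `v` is left out. It is 1 while `v` is pending, and without it edges that meet
    -- only in `v` add nothing positive to the variance.
    link : Fin N → State → Carrier
    link v σ = ∑ (λ E → ν E * ind (lookup E v) * X (E [ v ]≔ outside) σ)

    isPending : Status → Carrier
    isPending pending  = 1#
    isPending included = 0#
    isPending skipped  = 0#

    private
      0≤isPending : ∀ a → 0# ≤ isPending a
      0≤isPending pending  = 0≤1
      0≤isPending included = ≤-refl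
      0≤isPending skipped  = ≤-refl

      0≤lost : ∀ E σ v → 0# ≤ isPending (σ v) * (ν E * ind (lookup E v) * X (E [ v ]≔ outside) σ)
      0≤lost E σ v = *-nonneg (0≤isPending (σ v)) (*-nonneg (*-nonneg (0≤ν E) (0≤ind (lookup E v))) (0≤X (E [ v ]≔ outside) σ))

      -- If no vertex of `E` is pending, `X` and `Ψ` agree on `E`. Otherwise a single pending vertex
      -- pays for the whole edge, because its factor in `X` is 1 and can be removed.
      edge-loss : ∀ E σ → ν E * X E σ ≤ ν E * Ψ E σ + sumOver ρ (λ v → isPending (σ v) * (ν E * ind (lookup E v) * X (E [ v ]≔ outside) σ))
      edge-loss E σ with supp E
      ... | inj₁ νE≈0 = begin
        ν E * X E σ  ≈⟨ trans (*-congʳ νE≈0) (zeroˡ _) ⟩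
        0#  ≤⟨ 0≤-+ (*-nonneg (0≤ν E) (0≤Ψ E σ)) (sum-nonneg ρ (0≤lost E σ)) ⟩
        _  ∎
      ... | inj₂ (_ , E⊆ρ) with FinP.any? (λ v → (lookup E v BoolP.≟ true) ×-dec pending? (σ v))
      ...   | no none = ≤-trans (≤-reflexive (*-congˡ (X-settled E σ (λ v Ev σv → none (v , Ev , σv)))))
                                (x≤x+y (sum-nonneg ρ (0≤lost E σ)))
      ...   | yes (v , Ev , σv) = begin
        ν E * X E σ
          ≈⟨ *-congˡ (X-remove E v σ σv) ⟩
        ν E * X (E [ v ]≔ outside) σ
          ≈⟨ solve 2 (λ a b → a :* b := con (+ 1) :* (a :* con (+ 1) :* b)) refl (ν E) (X (E [ v ]≔ outside) σ) ⟩
        1# * (ν E * 1# * X (E [ v ]≔ outside) σ)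
          ≡⟨ ≡.cong₂ (λ a c → isPending a * (ν E * ind c * X (E [ v ]≔ outside) σ)) (≡.sym σv) (≡.sym Ev) ⟩
        isPending (σ v) * (ν E * ind (lookup E v) * X (E [ v ]≔ outside) σ)
          ≤⟨ sum-term (E⊆ρ v Ev) (0≤lost E σ) ⟩
        sumOver ρ (λ v → isPending (σ v) * (ν E * ind (lookup E v) * X (E [ v ]≔ outside) σ))
          ≤⟨ x≤y+x (*-nonneg (0≤ν E) (0≤Ψ E σ)) ⟩
        ν E * Ψ E σ + _
          ∎

    Φ≤Y+lost : ∀ σ → Φ σ ≤ Y σ + sumOver ρ (λ v → isPending (σ v) * link v σ)
    Φ≤Y+lost σ = begin
      Φ σ
        ≤⟨ sum-mono Ss (λ E → edge-loss E σ) ⟩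
      ∑ (λ E → ν E * Ψ E σ + sumOver ρ (λ v → isPending (σ v) * (ν E * ind (lookup E v) * X (E [ v ]≔ outside) σ)))
        ≈⟨ sum-+ Ss _ _ ⟩
      Y σ + ∑ (λ E → sumOver ρ (λ v → isPending (σ v) * (ν E * ind (lookup E v) * X (E [ v ]≔ outside) σ)))
        ≈⟨ +-congˡ (trans (sum-swap Ss ρ _) (sum-cong ρ (λ v → sum-*ˡ Ss (isPending (σ v)) _))) ⟩
      Y σ + sumOver ρ (λ v → isPending (σ v) * link v σ)
        ∎

    𝔼Φ≈1 : 𝔼 Φ ≈ 1#
    𝔼Φ≈1 = begin-equality
      𝔼 Φ  ≈⟨ Ex-sum coin t σ₀ Ss (λ E σ → ν E * X E σ) ⟩
      ∑ (λ E → 𝔼 (λ σ → ν E * X E σ))  ≈⟨ sum-cong Ss (λ E → trans (Ex-*ˡ coin t σ₀ (ν E) (X E)) (trans (*-congˡ (Ex-X t wf E)) (*-identityʳ _))) ⟩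
      ∑ ν  ≈⟨ total-ν ⟩
      1#  ∎

    𝔼link≈deg : ∀ v → 𝔼 (link v) ≈ deg v
    𝔼link≈deg v = trans (Ex-sum coin t σ₀ Ss (λ E σ → ν E * ind (lookup E v) * X (E [ v ]≔ outside) σ))
      (sum-cong Ss (λ E → trans (Ex-*ˡ coin t σ₀ (ν E * ind (lookup E v)) (X (E [ v ]≔ outside)))
        (trans (*-congˡ (Ex-X t wf (E [ v ]≔ outside))) (*-identityʳ _))))

    private
      νν : Subset N → Subset N → Carrier
      νν E E′ = ν E * ν E′

      0≤νν : ∀ E E′ → 0# ≤ νν E E′
      0≤νν E E′ = *-nonneg (0≤ν E) (0≤ν E′)

      both : Fin N → Subset N → Subset N → Carrier
      both v E E′ = ind (lookup E v) * ind (lookup E′ v)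

      both≈ : ∀ v E E′ → both v E E′ ≈ ind (lookup (E ∩ E′) v)
      both≈ v E E′ = trans (sym (ind-∧ (lookup E v) (lookup E′ v))) (reflexive (≡.cong ind (≡.sym (VecP.lookup-zipWith _∧_ v E E′))))

      two : Subset N → Subset N → Carrier
      two E E′ = ind (2 ℕ.≤ᵇ ∣ E ∩ E′ ∣)

      ∑∑ : (Subset N → Subset N → Carrier) → Carrier
      ∑∑ f = ∑ (λ E → ∑ (f E))

      ∑∑-cong : ∀ {f h} → (∀ E E′ → f E E′ ≈ h E E′) → ∑∑ f ≈ ∑∑ h
      ∑∑-cong eq = sum-cong Ss (λ E → sum-cong Ss (eq E))

      ∑∑-mono : ∀ {f h} → (∀ E E′ → f E E′ ≤ h E E′) → ∑∑ f ≤ ∑∑ h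
      ∑∑-mono le = sum-mono Ss (λ E → sum-mono Ss (le E))

      square : ∀ (f : Subset N → Carrier) → ∑ f * ∑ f ≈ ∑∑ (λ E E′ → f E * f E′)
      square f = sum-*-sum Ss Ss f f

      ∑∑-𝔼 : ∀ (f : Subset N → Subset N → State → Carrier) → 𝔼 (λ σ → ∑∑ (λ E E′ → f E E′ σ)) ≈ ∑∑ (λ E E′ → 𝔼 (f E E′))
      ∑∑-𝔼 f = trans (Ex-sum coin t σ₀ Ss (λ E σ → ∑ (λ E′ → f E E′ σ))) (sum-cong Ss (λ E → Ex-sum coin t σ₀ Ss (f E)))

      K^suc*q₀ : ∀ k → ι K ^ suc k * q₀ ≈ ι K ^ k
      K^suc*q₀ k = trans (solve 3 (λ K k q → K :* k :* q := (K :* q) :* k) refl (ι K) (ι K ^ k) q₀)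
        (trans (*-congʳ K*q₀≈1) (*-identityˡ _))

      -- When the edges meet only in `v`, the left side is K^0 - 1 = 0. So intersections of size 1,
      -- over which Λ gives no control, drop out of the variance.
      pair-excess : ∀ v E E′ →
        both v E E′ * (ι K ^ ∣ (E [ v ]≔ outside) ∩ (E′ [ v ]≔ outside) ∣ - 1#) ≤ both v E E′ * (two E E′ * (ι K ^ ∣ E ∩ E′ ∣ * q₀))
      pair-excess v E E′ with lookup (E ∩ E′) v in eq
      ... | false = ≤-reflexive (trans (trans (*-congʳ both≈0) (zeroˡ _)) (sym (trans (*-congʳ both≈0) (zeroˡ _))))
        where
        both≈0 : both v E E′ ≈ 0#
        both≈0 = trans (both≈ v E E′) (reflexive (≡.cong ind eq))
      ... | true = *-monoʳ-≤ (*-nonneg (0≤ind (lookup E v)) (0≤ind (lookup E′ v)))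
        (≡.subst₂ (λ a c → ι K ^ a - 1# ≤ ind (2 ℕ.≤ᵇ c) * (ι K ^ c * q₀))
          (≡.cong ∣_∣ (≡.sym (∩-remove E E′ v))) (∣remove∣ (E ∩ E′) v eq) (excess ∣ (E ∩ E′) [ v ]≔ outside ∣))
        where
        excess : ∀ k → ι K ^ k - 1# ≤ ind (2 ℕ.≤ᵇ suc k) * (ι K ^ suc k * q₀)
        excess zero    = ≤-reflexive (trans (-‿inverseʳ 1#) (sym (zeroˡ _)))
        excess (suc k) = begin
          ι K ^ suc k - 1#  ≤⟨ x-y≤x 0≤1 ⟩
          ι K ^ suc k  ≈⟨ K^suc*q₀ (suc k) ⟨
          ι K ^ suc (suc k) * q₀  ≈⟨ *-identityˡ _ ⟨
          1# * (ι K ^ suc (suc k) * q₀)  ∎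

    variance : Fin N → Carrier
    variance v = 𝔼 (λ σ → (link v σ - deg v) * (link v σ - deg v))

    private
      variance≤ : ∀ v → variance v ≤ ∑∑ (λ E E′ → νν E E′ * (both v E E′ * (two E E′ * (ι K ^ ∣ E ∩ E′ ∣ * q₀))))
      variance≤ v = begin
        variance v
          ≈⟨ Ex-cong coin t σ₀ (λ σ → solve 2 (λ w d → (w :- d) :* (w :- d) := w :* w :+ ((:- (con (+ 2) :* d)) :* w :+ d :* d)) refl (link v σ) (deg v)) ⟩
        𝔼 (λ σ → link v σ * link v σ + (- (ι 2 * deg v) * link v σ + deg v * deg v))
          ≈⟨ trans (Ex-+ coin t σ₀ _ _) (+-congˡ (trans (Ex-+ coin t σ₀ _ _) (+-cong (trans (Ex-*ˡ coin t σ₀ _ _) (*-congˡ (𝔼link≈deg v))) (Ex-const coin t σ₀ _)))) ⟩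
        𝔼 (λ σ → link v σ * link v σ) + (- (ι 2 * deg v) * deg v + deg v * deg v)
          ≈⟨ +-congˡ (solve 1 (λ d → (:- (con (+ 2) :* d)) :* d :+ d :* d := (:- con (+ 1)) :* (d :* d)) refl (deg v)) ⟩
        𝔼 (λ σ → link v σ * link v σ) + (- 1#) * (deg v * deg v)
          ≤⟨ +-monoˡ-≤ _ second-moment ⟩
        ∑∑ (λ E E′ → νν E E′ * (both v E E′ * K^ E E′)) + (- 1#) * (deg v * deg v)
          ≈⟨ +-congˡ (trans (*-congˡ (square _)) (sym (trans (sum-cong Ss (λ E → sum-*ˡ Ss (- 1#) _)) (sum-*ˡ Ss (- 1#) _)))) ⟩
        ∑∑ (λ E E′ → νν E E′ * (both v E E′ * K^ E E′)) + ∑∑ (λ E E′ → (- 1#) * (ν E * ind (lookup E v) * (ν E′ * ind (lookup E′ v))))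
          ≈⟨ sym (trans (sum-cong Ss (λ E → sum-+ Ss _ _)) (sum-+ Ss _ _)) ⟩
        ∑∑ (λ E E′ → νν E E′ * (both v E E′ * K^ E E′) + (- 1#) * (ν E * ind (lookup E v) * (ν E′ * ind (lookup E′ v))))
          ≈⟨ ∑∑-cong (λ E E′ → solve 5 (λ a b c d k → a :* b :* (c :* d :* k) :+ (:- con (+ 1)) :* (a :* c :* (b :* d)) := a :* b :* (c :* d :* (k :- con (+ 1)))) refl
               (ν E) (ν E′) (ind (lookup E v)) (ind (lookup E′ v)) (K^ E E′)) ⟩
        ∑∑ (λ E E′ → νν E E′ * (both v E E′ * (K^ E E′ - 1#)))
          ≤⟨ ∑∑-mono (λ E E′ → *-monoʳ-≤ (0≤νν E E′) (pair-excess v E E′)) ⟩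
        ∑∑ (λ E E′ → νν E E′ * (both v E E′ * (two E E′ * (ι K ^ ∣ E ∩ E′ ∣ * q₀))))
          ∎
        where
        K^ : Subset N → Subset N → Carrier
        K^ E E′ = ι K ^ ∣ (E [ v ]≔ outside) ∩ (E′ [ v ]≔ outside) ∣

        second-moment : 𝔼 (λ σ → link v σ * link v σ) ≤ ∑∑ (λ E E′ → νν E E′ * (both v E E′ * K^ E E′))
        second-moment = begin
          𝔼 (λ σ → link v σ * link v σ)
            ≈⟨ Ex-cong coin t σ₀ (λ σ → trans (square _) (∑∑-cong (λ E E′ →
                 solve 6 (λ a b c d x y → (a :* c :* x) :* (b :* d :* y) := (a :* b :* (c :* d)) :* (x :* y)) refl
                   (ν E) (ν E′) (ind (lookup E v)) (ind (lookup E′ v)) (X (E [ v ]≔ outside) σ) (X (E′ [ v ]≔ outside) σ)))) ⟩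
          𝔼 (λ σ → ∑∑ (λ E E′ → (νν E E′ * both v E E′) * (X (E [ v ]≔ outside) σ * X (E′ [ v ]≔ outside) σ)))
            ≈⟨ trans (∑∑-𝔼 _) (∑∑-cong (λ E E′ → Ex-*ˡ coin t σ₀ (νν E E′ * both v E E′) _)) ⟩
          ∑∑ (λ E E′ → (νν E E′ * both v E E′) * 𝔼 (λ σ → X (E [ v ]≔ outside) σ * X (E′ [ v ]≔ outside) σ))
            ≤⟨ ∑∑-mono (λ E E′ → *-monoʳ-≤ (*-nonneg (0≤νν E E′) (*-nonneg (0≤ind (lookup E v)) (0≤ind (lookup E′ v))))
                 (Ex-XX t wf (E [ v ]≔ outside) (E′ [ v ]≔ outside))) ⟩
          ∑∑ (λ E E′ → (νν E E′ * both v E E′) * K^ E E′)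
            ≈⟨ ∑∑-cong (λ E E′ → *-assoc _ _ _) ⟩
          ∑∑ (λ E E′ → νν E E′ * (both v E E′ * K^ E E′))
            ∎

      32Kp≤1 : ι 32 * Kp ≤ 1#
      32Kp≤1 = begin
        ι 32 * (ι K * p)  ≈⟨ solve 3 (λ a k p → a :* (k :* p) := k :* (a :* p)) refl (ι 32) (ι K) p ⟩
        ι K * (ι 32 * p)  ≤⟨ *-monoʳ-≤ (0≤ι K) 32p≤q₀ ⟩
        ι K * q₀  ≈⟨ K*q₀≈1 ⟩
        1#  ∎

      0≤Kp : 0# ≤ Kp
      0≤Kp = *-nonneg (0≤ι K) (<⇒≤ 0<p)

      0≤P : 0# ≤ P
      0≤P = ⁻¹-nonneg 0<p

      K^≈ : ∀ j → ι K ^ j ≈ Kp ^ j * P ^ j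
      K^≈ j = sym (trans (sym (^-distrib-* Kp P j)) (^-congˡ j (trans (*-assoc _ _ _) (trans (*-congˡ (0<⇒*⁻¹≈1 0<p)) (*-identityʳ _)))))

      -- The geometric factor beats the linear one, because Kp is at most 1/32 and k + 3 ≤ 32(k +
      -- 2).
      jx^j : ∀ k → ι (2 ℕ.+ k) * Kp ^ k ≤ ι 2
      jx^j zero    = ≤-reflexive (*-identityʳ _)
      jx^j (suc k) = begin
        ι (3 ℕ.+ k) * (Kp * Kp ^ k)  ≈⟨ *-assoc _ _ _ ⟨
        ι (3 ℕ.+ k) * Kp * Kp ^ k  ≤⟨ *-monoˡ-≤ (^-nonneg k 0≤Kp) (begin
            ι (3 ℕ.+ k) * Kp  ≤⟨ *-monoˡ-≤ 0≤Kp (ι-mono (ℕP.≤-trans (ℕ.s≤s (ℕP.m≤n+m (2 ℕ.+ k) (1 ℕ.+ k)))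
                                                (ℕP.+-monoʳ-≤ (2 ℕ.+ k) (ℕP.m≤m+n (2 ℕ.+ k) (30 ℕ.* (2 ℕ.+ k)))))) ⟩
            ι (32 ℕ.* (2 ℕ.+ k)) * Kp  ≈⟨ *-congʳ (ι-* 32 (2 ℕ.+ k)) ⟩
            ι 32 * ι (2 ℕ.+ k) * Kp  ≈⟨ solve 3 (λ a b c → a :* b :* c := b :* (a :* c)) refl (ι 32) (ι (2 ℕ.+ k)) Kp ⟩
            ι (2 ℕ.+ k) * (ι 32 * Kp)  ≤⟨ *-monoʳ-≤ (0≤ι (2 ℕ.+ k)) 32Kp≤1 ⟩
            ι (2 ℕ.+ k) * 1#  ≈⟨ *-identityʳ _ ⟩
            ι (2 ℕ.+ k)  ∎) ⟩
        ι (2 ℕ.+ k) * Kp ^ k  ≤⟨ jx^j k ⟩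
        ι 2  ∎

      -- For `j` the size of E ∩ E′: the sum of variances over all vertices counts a pair of edges
      -- `j` times, and K^j q₀ equals Kp² (Kp)^(j-2) p^(-j). With `jx^j` the total variance is at
      -- most 2Kp² times `Γ`.
      pair-weight : ∀ j → ι j * (ind (2 ℕ.≤ᵇ j) * (ι K ^ j * q₀)) ≤ ι 2 * (Kp * p) * (ind (2 ℕ.≤ᵇ j) * P ^ j)
      pair-weight zero          = ≤-reflexive (trans (zeroˡ _) (sym (trans (*-congˡ (zeroˡ _)) (zeroʳ _))))
      pair-weight (suc zero)    = ≤-reflexive (trans (*-congˡ (zeroˡ _)) (trans (zeroʳ _) (sym (trans (*-congˡ (zeroˡ _)) (zeroʳ _)))))
      pair-weight (suc (suc k)) = begin
        ι j * (1# * (ι K ^ j * q₀))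
          ≈⟨ *-congˡ (*-congˡ (*-congʳ (K^≈ j))) ⟩
        ι j * (1# * (Kp * (Kp * Kp ^ k) * P ^ j * q₀))
          ≈⟨ solve 6 (λ j x K p Pj q → j :* (con (+ 1) :* ((K :* p) :* ((K :* p) :* x) :* Pj :* q)) := (j :* x) :* ((K :* q) :* (K :* p :* p) :* (con (+ 1) :* Pj))) refl
               (ι j) (Kp ^ k) (ι K) p (P ^ j) q₀ ⟩
        (ι j * Kp ^ k) * ((ι K * q₀) * (Kp * p) * (1# * P ^ j))
          ≤⟨ *-monoˡ-≤ (*-nonneg (*-nonneg (*-nonneg (0≤ι K) (<⇒≤ 0<q₀)) (*-nonneg 0≤Kp (<⇒≤ 0<p))) (*-nonneg 0≤1 (^-nonneg j 0≤P))) (jx^j k) ⟩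
        ι 2 * ((ι K * q₀) * (Kp * p) * (1# * P ^ j))
          ≈⟨ *-congˡ (*-congʳ (trans (*-congʳ K*q₀≈1) (*-identityˡ _))) ⟩
        ι 2 * ((Kp * p) * (1# * P ^ j))
          ≈⟨ *-assoc _ _ _ ⟨
        ι 2 * (Kp * p) * (1# * P ^ j)
          ∎
        where
        j = suc (suc k)

    total-variance : sumOver ρ variance ≤ ι 2 * (Kp * p) * Γ P
    total-variance = begin
      sumOver ρ variance
        ≤⟨ sum-mono ρ variance≤ ⟩
      sumOver ρ (λ v → ∑∑ (λ E E′ → νν E E′ * (both v E E′ * Z E E′)))
        ≈⟨ trans (sum-swap ρ Ss _) (sum-cong Ss (λ E → sum-swap ρ Ss _)) ⟩
      ∑∑ (λ E E′ → sumOver ρ (λ v → νν E E′ * (both v E E′ * Z E E′)))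
        ≈⟨ ∑∑-cong (λ E E′ → trans (sum-*ˡ ρ (νν E E′) _) (*-congˡ (trans (sum-cong ρ (λ v → *-congʳ (both≈ v E E′))) (sum-*ʳ ρ (Z E E′) _)))) ⟩
      ∑∑ (λ E E′ → νν E E′ * (sumOver ρ (λ v → ind (lookup (E ∩ E′) v)) * Z E E′))
        ≤⟨ ∑∑-mono (λ E E′ → *-monoʳ-≤ (0≤νν E E′) (≤-trans (*-monoˡ-≤ (0≤Z E E′) (sum-unique (E ∩ E′) ρ!)) (pair-weight ∣ E ∩ E′ ∣))) ⟩
      ∑∑ (λ E E′ → νν E E′ * (c * (two E E′ * P ^ ∣ E ∩ E′ ∣)))
        ≈⟨ ∑∑-cong (λ E E′ → solve 3 (λ a c d → a :* (c :* d) := c :* (a :* d)) refl (νν E E′) c _) ⟩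
      ∑∑ (λ E E′ → c * (νν E E′ * (two E E′ * P ^ ∣ E ∩ E′ ∣)))
        ≈⟨ trans (sum-cong Ss (λ E → sum-*ˡ Ss c _)) (sum-*ˡ Ss c _) ⟩
      c * Γ P
        ∎
      where
      c : Carrier
      c = ι 2 * (Kp * p)
      Z : Subset N → Subset N → Carrier
      Z E E′ = two E E′ * (ι K ^ ∣ E ∩ E′ ∣ * q₀)
      0≤Z : ∀ E E′ → 0# ≤ Z E E′
      0≤Z E E′ = *-nonneg (0≤ind (2 ℕ.≤ᵇ ∣ E ∩ E′ ∣)) (*-nonneg (^-nonneg ∣ E ∩ E′ ∣ (0≤ι K)) (<⇒≤ 0<q₀))

    private
      nr i32 a8 a32 : Carrier
      nr  = ι n
      i32 = ι 32 ⁻¹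
      -- The weights 8/n and n/32 balance the two errors: over at most n vertices the first acts
      -- like 8 more units of total degree, and the second makes the variances contribute at most
      -- 1/8.
      a8  = ι 8 * nr ⁻¹
      a32 = nr * i32

      0<nr : 0# < nr
      0<nr = 0<ι′ 1≤n

      0≤a32 : 0# ≤ a32
      0≤a32 = *-nonneg (0≤ι n) (⁻¹-nonneg (0<ι 31))

      32*i32≈1 : ι 32 * i32 ≈ 1#
      32*i32≈1 = 0<⇒*⁻¹≈1 (0<ι 31)

      -- The parabola a32 (x - 16/n)² is nonnegative.
      am-gm : ∀ x → x ≤ a8 + a32 * (x * x)
      am-gm x = 0≤y-x⇒x≤y (begin
        0#
          ≤⟨ *-nonneg 0≤a32 (0≤x*x (x - ι 16 * nr ⁻¹)) ⟩
        a32 * ((x - ι 16 * nr ⁻¹) * (x - ι 16 * nr ⁻¹))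
          ≈⟨ solve 4 (λ n m i x → (n :* i) :* ((x :- con (+ 16) :* m) :* (x :- con (+ 16) :* m)) :=
               (con (+ 8) :* m) :* (n :* m) :* (con (+ 32) :* i) :+ (n :* i) :* (x :* x) :- x :* (n :* m) :* (con (+ 32) :* i)) refl nr (nr ⁻¹) i32 x ⟩
        a8 * (nr * nr ⁻¹) * (ι 32 * i32) + a32 * (x * x) - x * (nr * nr ⁻¹) * (ι 32 * i32)
          ≈⟨ +-cong (+-congʳ (collapse a8)) (-‿cong (collapse x)) ⟩
        a8 + a32 * (x * x) - x
          ∎)
        where
        collapse : ∀ z → z * (nr * nr ⁻¹) * (ι 32 * i32) ≈ z
        collapse z = trans (*-cong (trans (*-congˡ (0<⇒*⁻¹≈1 0<nr)) (*-identityʳ z)) 32*i32≈1) (*-identityʳ z)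

      -- Being pending may be correlated with a large link. Splitting the link into its mean and a
      -- deviation separates the two: the mean is charged to the pending probability, and the
      -- deviation to the variance by `am-gm`.
      lost-term : ∀ v σ → isPending (σ v) * link v σ ≤ (deg v + a8) * isPending (σ v) + a32 * ((link v σ - deg v) * (link v σ - deg v))
      lost-term v σ with σ v
      ... | included = ≤-trans (≤-reflexive (zeroˡ _)) (0≤-+ (≤-reflexive (sym (zeroʳ _))) (*-nonneg 0≤a32 (0≤x*x (link v σ - deg v))))
      ... | skipped  = ≤-trans (≤-reflexive (zeroˡ _)) (0≤-+ (≤-reflexive (sym (zeroʳ _))) (*-nonneg 0≤a32 (0≤x*x (link v σ - deg v))))
      ... | pending  = begin
        1# * w  ≈⟨ solve 2 (λ w d → con (+ 1) :* w := d :+ (w :- d)) refl w (deg v) ⟩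
        deg v + (w - deg v)  ≤⟨ +-monoʳ-≤ (deg v) (am-gm (w - deg v)) ⟩
        deg v + (a8 + a32 * D)  ≈⟨ solve 3 (λ d a x → d :+ (a :+ x) := (d :+ a) :* con (+ 1) :+ x) refl (deg v) a8 (a32 * D) ⟩
        (deg v + a8) * 1# + a32 * D  ∎
        where
        w D : Carrier
        w = link v σ
        D = (w - deg v) * (w - deg v)

      lostProb : Fin N → Carrier
      lostProb v = 𝔼 (λ σ → isPending (σ v))

      ι-cnt : ∀ Q σ → ι (cnt σ Q) ≈ sumOver Q (λ v → isPending (σ v))
      ι-cnt []      σ = refl
      ι-cnt (v ∷ Q) σ with σ v
      ... | pending  = trans (ι-suc (cnt σ Q)) (+-congˡ (ι-cnt Q σ))
      ... | included = trans (ι-cnt Q σ) (sym (+-identityˡ _))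
      ... | skipped  = trans (ι-cnt Q σ) (sym (+-identityˡ _))

      G c : ℕ
      G = g ℕ.* (ℓ ℕ.∸ 1)
      c = suc ℓ

      open Prefix G (suc (K ℕ.* ℓ)) c ρ! light-bound balance using (pending-bound)

      prefix-bound : ∀ Q Q′ → ρ ≡ Q ++ Q′ → sumOver Q (λ v → ι G * lostProb v) ≤ ι c * ι (length Q)
      prefix-bound Q Q′ eq = begin
        sumOver Q (λ v → ι G * lostProb v)
          ≈⟨ trans (sum-*ˡ Q (ι G) lostProb) (*-congˡ (trans (sym (Ex-sum coin t σ₀ Q _)) (Ex-cong coin t σ₀ (λ σ → sym (ι-cnt Q σ))))) ⟩
        ι G * 𝔼 (λ σ → ι (cnt σ Q))
          ≤⟨ pending-bound Q Q′ eq good reached ⟩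
        ι (suc (K ℕ.* ℓ) ℕ.* 0 ℕ.+ 0) + ι c * ι (cnt σ₀ Q)
          ≡⟨ ≡.cong (λ k → ι (k ℕ.+ 0) + ι c * ι (cnt σ₀ Q)) (ℕP.*-zeroʳ (suc (K ℕ.* ℓ))) ⟩
        0# + ι c * ι (cnt σ₀ Q)
          ≈⟨ +-identityˡ _ ⟩
        ι c * ι (cnt σ₀ Q)
          ≤⟨ *-monoʳ-≤ (0≤ι c) (ι-mono (cnt-≤ σ₀ Q)) ⟩
        ι c * ι (length Q)
          ∎

      0≤deg : ∀ v → 0# ≤ deg v
      0≤deg v = sum-nonneg Ss (λ E → *-nonneg (0≤ν E) (0≤ind (lookup E v)))

      sum-deg : sumOver ρ deg ≤ ι s
      sum-deg = begin
        sumOver ρ deg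
          ≈⟨ trans (sum-swap ρ Ss _) (sum-cong Ss (λ E → sum-*ˡ ρ (ν E) _)) ⟩
        ∑ (λ E → ν E * sumOver ρ (λ v → ind (lookup E v)))
          ≤⟨ sum-mono Ss (λ E → *-monoʳ-≤ (0≤ν E) (sum-unique E ρ!)) ⟩
        ∑ (λ E → ν E * ι ∣ E ∣)
          ≤⟨ sum-mono Ss size ⟩
        ∑ (λ E → ν E * ι s)
          ≈⟨ trans (sum-*ʳ Ss (ι s) ν) (trans (*-congʳ total-ν) (*-identityˡ _)) ⟩
        ι s
          ∎
        where
        size : ∀ E → ν E * ι ∣ E ∣ ≤ ν E * ι s
        size E with supp E
        ... | inj₁ νE≈0      = ≤-reflexive (trans (trans (*-congʳ νE≈0) (zeroˡ _)) (sym (trans (*-congʳ νE≈0) (zeroˡ _))))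
        ... | inj₂ (∣E∣ , _) = ≤-reflexive (reflexive (≡.cong (λ k → ν E * ι k) ∣E∣))

      -- The expected pending fraction is at most c/G = (ℓ + 1)/(16s²(ℓ - 1)); times the total
      -- degree s plus the 8 from `a8` it has to stay below 3/8. With s = 2 + a and ℓ = 4 + l, the
      -- difference of the two sides is a polynomial with nonnegative coefficients.
      8c[s+8]≤3G : 8 ℕ.* (c ℕ.* (s ℕ.+ 8)) ℕ.≤ 3 ℕ.* G
      8c[s+8]≤3G = ≡.subst₂ (λ s ℓ → 8 ℕ.* (suc ℓ ℕ.* (s ℕ.+ 8)) ℕ.≤ 3 ℕ.* (16 ℕ.* (s ℕ.* s) ℕ.* (ℓ ℕ.∸ 1)))
        (ℕP.m+[n∸m]≡n 2≤s) (ℕP.m+[n∸m]≡n 4≤ℓ) (ℕP.≤-trans (ℕP.m≤m+n _ _) (ℕP.≤-reflexive (identity (s ℕ.∸ 2) (ℓ ℕ.∸ 4))))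
        where
        open +-*-Solver using () renaming (solve to solveℕ; _:=_ to _:≡_; _:+_ to _⊕_; _:*_ to _⊗_; con to lit)
        identity : ∀ a l → 8 ℕ.* (suc (4 ℕ.+ l) ℕ.* ((2 ℕ.+ a) ℕ.+ 8)) ℕ.+ (176 ℕ.+ 112 ℕ.* l ℕ.+ 536 ℕ.* a ℕ.+ 184 ℕ.* (a ℕ.* l) ℕ.+ 144 ℕ.* (a ℕ.* a) ℕ.+ 48 ℕ.* (a ℕ.* a ℕ.* l))
                   ≡ 3 ℕ.* (16 ℕ.* ((2 ℕ.+ a) ℕ.* (2 ℕ.+ a)) ℕ.* (3 ℕ.+ l))
        identity = solveℕ 2 (λ a l → lit 8 ⊗ ((lit 5 ⊕ l) ⊗ ((lit 2 ⊕ a) ⊕ lit 8)) ⊕ (lit 176 ⊕ lit 112 ⊗ l ⊕ lit 536 ⊗ a ⊕ lit 184 ⊗ (a ⊗ l) ⊕ lit 144 ⊗ (a ⊗ a) ⊕ lit 48 ⊗ (a ⊗ a ⊗ l))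
                   :≡ lit 3 ⊗ (lit 16 ⊗ ((lit 2 ⊕ a) ⊗ (lit 2 ⊕ a)) ⊗ (lit 3 ⊕ l))) ≡.refl

      1≤G : 1 ℕ.≤ G
      1≤G = ℕP.*-mono-≤ 1≤g (ℕP.∸-monoˡ-≤ 1 (ℕP.≤-trans (ℕ.s≤s (ℕ.s≤s ℕ.z≤n)) 4≤ℓ))

      S₁ S₂ : Carrier
      S₁ = sumOver ρ (λ v → (deg v + a8) * lostProb v)
      S₂ = a32 * sumOver ρ variance

      8S₁≤3 : ι 8 * S₁ ≤ ι 3
      8S₁≤3 = *-cancelˡ-≤ (0<ι′ 1≤G) (begin
        ι G * (ι 8 * S₁)
          ≈⟨ solve 3 (λ a b c → a :* (b :* c) := b :* (a :* c)) refl (ι G) (ι 8) S₁ ⟩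
        ι 8 * (ι G * S₁)
          ≤⟨ *-monoʳ-≤ (0≤ι 8) GS₁ ⟩
        ι 8 * (ι c * ι (s ℕ.+ 8))
          ≈⟨ trans (ι-* 8 (c ℕ.* (s ℕ.+ 8))) (*-congˡ (ι-* c (s ℕ.+ 8))) ⟨
        ι (8 ℕ.* (c ℕ.* (s ℕ.+ 8)))
          ≤⟨ ι-mono 8c[s+8]≤3G ⟩
        ι (3 ℕ.* G)
          ≈⟨ trans (ι-* 3 G) (*-comm _ _) ⟩
        ι G * ι 3
          ∎)
        where
        GS₁ : ι G * S₁ ≤ ι c * ι (s ℕ.+ 8)
        GS₁ = begin
          ι G * S₁
            ≈⟨ sum-*ˡ ρ (ι G) _ ⟨
          sumOver ρ (λ v → ι G * ((deg v + a8) * lostProb v))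
            ≈⟨ sum-cong ρ (λ v → solve 4 (λ G d a f → G :* ((d :+ a) :* f) := d :* (G :* f) :+ a :* (G :* f)) refl (ι G) (deg v) a8 (lostProb v)) ⟩
          sumOver ρ (λ v → deg v * (ι G * lostProb v) + a8 * (ι G * lostProb v))
            ≈⟨ trans (sum-+ ρ _ _) (+-congˡ (sum-*ˡ ρ a8 _)) ⟩
          sumOver ρ (λ v → deg v * (ι G * lostProb v)) + a8 * sumOver ρ (λ v → ι G * lostProb v)
            -- The degree part uses the bound on all initial segments and the order of `ρ`; the
            -- constant part needs the bound for `ρ` as a whole.
            ≤⟨ +-mono-≤ (Abel.abel ℝ deg (λ v → ι G * lostProb v) 0≤deg (ι c) ρ sorted prefix-bound)
                        (*-monoʳ-≤ 0≤a8 (prefix-bound ρ [] (≡.sym (ListP.++-identityʳ ρ)))) ⟩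
          ι c * sumOver ρ deg + a8 * (ι c * ι (length ρ))
            ≤⟨ +-mono-≤ (*-monoʳ-≤ (0≤ι c) sum-deg) (*-monoʳ-≤ 0≤a8 (*-monoʳ-≤ (0≤ι c) (ι-mono ∣ρ∣≤n))) ⟩
          ι c * ι s + ι 8 * nr ⁻¹ * (ι c * nr)
            ≈⟨ +-congˡ (solve 3 (λ m c n → con (+ 8) :* m :* (c :* n) := c :* (con (+ 8) :* (n :* m))) refl (nr ⁻¹) (ι c) nr) ⟩
          ι c * ι s + ι c * (ι 8 * (nr * nr ⁻¹))
            ≈⟨ +-congˡ (*-congˡ (trans (*-congˡ (0<⇒*⁻¹≈1 0<nr)) (*-identityʳ _))) ⟩
          ι c * ι s + ι c * ι 8
            ≈⟨ trans (*-congˡ (ι-+ s 8)) (distribˡ _ _ _) ⟨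
          ι c * ι (s ℕ.+ 8)
            ∎
          where
          0≤a8 : 0# ≤ a8
          0≤a8 = *-nonneg (0≤ι 8) (⁻¹-nonneg 0<nr)

      8S₂≤1 : ι 8 * S₂ ≤ 1#
      8S₂≤1 = begin
        ι 8 * (a32 * sumOver ρ variance)
          ≤⟨ *-monoʳ-≤ (0≤ι 8) (*-monoʳ-≤ 0≤a32 total-variance) ⟩
        ι 8 * (nr * i32 * (ι 2 * (Kp * p) * Γ P))
          ≈⟨ solve 5 (λ n i k p Γ → con (+ 8) :* (n :* i :* (con (+ 2) :* (k :* p) :* Γ)) := con (+ 16) :* i :* k :* (p :* n :* Γ)) refl nr i32 Kp p (Γ P) ⟩
        ι 16 * i32 * Kp * (p * nr * Γ P)
          ≤⟨ *-monoʳ-≤ (*-nonneg (*-nonneg (0≤ι 16) (⁻¹-nonneg (0<ι 31))) 0≤Kp) pnΓ≤64 ⟩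
        ι 16 * i32 * Kp * ι 64
          ≈⟨ solve 2 (λ i k → con (+ 16) :* i :* k :* con (+ 64) := (con (+ 32) :* i) :* (con (+ 32) :* k)) refl i32 Kp ⟩
        (ι 32 * i32) * (ι 32 * Kp)
          ≈⟨ trans (*-congʳ 32*i32≈1) (*-identityˡ _) ⟩
        ι 32 * Kp
          ≤⟨ 32Kp≤1 ⟩
        1#
          ∎

    -- The loss is at most `S₁ + S₂`, with `S₁` at most 3/8 and `S₂` at most 1/8, while `Φ` has mean
    -- 1.
    1≤2𝔼Y : 1# ≤ ι 2 * 𝔼 Y
    1≤2𝔼Y = *-cancelˡ-≤ (0<ι 3) (begin
      ι 4 * 1#
        ≈⟨ solve 0 (con (+ 4) :* con (+ 1) := con (+ 8) :* con (+ 1) :- (con (+ 3) :+ con (+ 1))) refl ⟩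
      ι 8 * 1# - (ι 3 + 1#)
        ≤⟨ +-mono-≤ (*-monoʳ-≤ (0≤ι 8) 1≤) (-‿antimono-≤ (+-mono-≤ 8S₁≤3 8S₂≤1)) ⟩
      ι 8 * (𝔼 Y + (S₁ + S₂)) - (ι 8 * S₁ + ι 8 * S₂)
        ≈⟨ solve 3 (λ y a b → con (+ 8) :* (y :+ (a :+ b)) :- (con (+ 8) :* a :+ con (+ 8) :* b) := con (+ 4) :* (con (+ 2) :* y)) refl (𝔼 Y) S₁ S₂ ⟩
      ι 4 * (ι 2 * 𝔼 Y)
        ∎)
      where
      1≤ : 1# ≤ 𝔼 Y + (S₁ + S₂)
      1≤ = begin
        1#
          ≈⟨ 𝔼Φ≈1 ⟨
        𝔼 Φ
          ≤⟨ Ex-mono coin-fair t wf Φ≤Y+lost ⟩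
        𝔼 (λ σ → Y σ + sumOver ρ (λ v → isPending (σ v) * link v σ))
          ≈⟨ trans (Ex-+ coin t σ₀ Y _) (+-congˡ (Ex-sum coin t σ₀ ρ _)) ⟩
        𝔼 Y + sumOver ρ (λ v → 𝔼 (λ σ → isPending (σ v) * link v σ))
          ≤⟨ +-monoʳ-≤ _ (sum-mono ρ (λ v → Ex-mono coin-fair t wf (lost-term v))) ⟩
        𝔼 Y + sumOver ρ (λ v → 𝔼 (λ σ → (deg v + a8) * isPending (σ v) + a32 * ((link v σ - deg v) * (link v σ - deg v))))
          ≈⟨ +-congˡ (trans (sum-cong ρ (λ v → trans (Ex-+ coin t σ₀ _ _) (+-cong (Ex-*ˡ coin t σ₀ _ _) (Ex-*ˡ coin t σ₀ a32 _))))
               (trans (sum-+ ρ _ _) (+-congˡ (sum-*ˡ ρ a32 variance)))) ⟩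
        𝔼 Y + (S₁ + S₂)
          ∎

    -- Transfer of the measure to the random set.

    𝔼[_] : Subset N → (State → Carrier) → Carrier
    𝔼[ L ] = Ex (coinOf L) t σ₀

    νOf : Subset N → Subset N → Carrier
    νOf L E = ν E * 𝔼[ L ] (Ψ E)

    0≤νOf : ∀ L E → 0# ≤ νOf L E
    0≤νOf L E = *-nonneg (0≤ν E) (Ex-nonneg (coinOf-fair L) t wf (0≤Ψ E))

    -- Under the coins of `L` a vertex outside `L` is never included. A nonnegative supermartingale
    -- that dominates `Ψ E` and has pending factor 0 at such a vertex starts at 0, which forces the
    -- mean to be 0.
    νOf-vanishes : ∀ L E → ¬ T (E ⊆ᵇ L) → νOf L E ≈ 0#
    νOf-vanishes L E E⊈L with FinP.any? (λ v → (lookup E v BoolP.≟ true) ×-dec (lookup L v BoolP.≟ false))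
    ... | no none = ⊥-elim (E⊈L (lookup-⊆ᵇ E L (λ v Ev → BoolP.¬-not (λ Lv → none (v , Ev , Lv)))))
    ... | yes (v , Ev , Lv) = trans (*-congˡ (antisym 𝔼Ψ≤0 (Ex-nonneg (coinOf-fair L) t wf (0≤Ψ E)))) (zeroʳ _)
      where
      cap : Bool → Bool → Status → Carrier
      cap false l     a        = 1#
      cap true  true  pending  = ι K
      cap true  false pending  = 0#
      cap true  l     included = ι K
      cap true  l     skipped  = 0#

      0≤cap : ∀ e l a → 0# ≤ cap e l a
      0≤cap false l     a        = 0≤1
      0≤cap true  true  pending  = 0≤ι K
      0≤cap true  false pending  = ≤-refl
      0≤cap true  true  included = 0≤ι K
      0≤cap true  false included = 0≤ι K
      0≤cap true  true  skipped  = ≤-refl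
      0≤cap true  false skipped  = ≤-refl

      cap-dominates : ∀ e l a → (if e then ψ a else 1#) ≤ cap e l a
      cap-dominates false l     a        = ≤-refl
      cap-dominates true  true  pending  = 0≤ι K
      cap-dominates true  false pending  = ≤-refl
      cap-dominates true  true  included = ≤-refl
      cap-dominates true  false included = ≤-refl
      cap-dominates true  true  skipped  = ≤-refl
      cap-dominates true  false skipped  = ≤-refl

      cap-super : ∀ e l r → r ≤ 1# → r * ind l * cap e l included + (1# - r * ind l) * cap e l skipped ≤ cap e l pending
      cap-super false l r r≤1 = ≤-reflexive (solve 1 (λ x → x :* con (+ 1) :+ (con (+ 1) :- x) :* con (+ 1) := con (+ 1)) refl (r * ind l))
      cap-super true false r r≤1 = ≤-reflexive (solve 2 (λ r k → r :* con (+ 0) :* k :+ (con (+ 1) :- r :* con (+ 0)) :* con (+ 0) := con (+ 0)) refl r (ι K))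
      cap-super true true r r≤1 = begin
        r * 1# * ι K + (1# - r * 1#) * 0#  ≈⟨ solve 2 (λ r k → r :* con (+ 1) :* k :+ (con (+ 1) :- r :* con (+ 1)) :* con (+ 0) := r :* k) refl r (ι K) ⟩
        r * ι K  ≤⟨ *-monoˡ-≤ (0≤ι K) r≤1 ⟩
        1# * ι K  ≈⟨ *-identityˡ _ ⟩
        ι K  ∎

      h : Fin N → Status → Carrier
      h w a = cap (lookup E w) (lookup L w) a

      𝔼Ψ≤0 : 𝔼[ L ] (Ψ E) ≤ 0#
      𝔼Ψ≤0 = begin
        𝔼[ L ] (Ψ E)  ≤⟨ Ex-mono (coinOf-fair L) t wf (λ σ → ∏-mono (λ w → 0≤on E w (0≤ψ (σ w))) (λ w → cap-dominates (lookup E w) (lookup L w) (σ w))) ⟩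
        𝔼[ L ] (Prod h)  ≤⟨ Ex-supermartingale h (coinOf-fair L) (λ w → 0≤cap (lookup E w) (lookup L w))
                                   (λ w r _ r≤r̄ → cap-super (lookup E w) (lookup L w) r (≤-trans r≤r̄ r̄≤1)) t wf ⟩
        ∏ (λ w → h w pending) ≈⟨ ∏-0 v (reflexive (≡.cong₂ (λ e l → cap e l pending) Ev Lv)) ⟩
        0#  ∎

    degOf : Subset N → Subset N → Carrier
    degOf L S = ∑ (λ E → ind (S ⊆ᵇ E) * νOf L E)

    private
      D : Subset N → State → Carrier
      D S σ = ∑ (λ E → ind (S ⊆ᵇ E) * (ν E * Ψ E σ))

      𝟙 : Subset N → State → Carrier
      𝟙 = prodOn χ

      sum-νOf : ∀ L → ∑ (νOf L) ≈ 𝔼[ L ] Y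
      sum-νOf L = sym (trans (Ex-sum (coinOf L) t σ₀ Ss (λ E σ → ν E * Ψ E σ)) (sum-cong Ss (λ E → Ex-*ˡ (coinOf L) t σ₀ (ν E) (Ψ E))))

      degOf≈ : ∀ L S → degOf L S ≈ 𝔼[ L ] (D S)
      degOf≈ L S = sym (trans (Ex-sum (coinOf L) t σ₀ Ss (λ E σ → ind (S ⊆ᵇ E) * (ν E * Ψ E σ)))
        (sum-cong Ss (λ E → trans (Ex-*ˡ (coinOf L) t σ₀ (ind (S ⊆ᵇ E)) (λ σ → ν E * Ψ E σ)) (*-congˡ (Ex-*ˡ (coinOf L) t σ₀ (ν E) (Ψ E))))))

      𝟙Ψ≈Ψ : ∀ S E σ → T (S ⊆ᵇ E) → 𝟙 S σ * Ψ E σ ≈ Ψ E σ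
      𝟙Ψ≈Ψ S E σ S⊆E = trans (sym (∏-* (λ w → on S w (χ (σ w))) (λ w → on E w (ψ (σ w))))) (∏-cong (λ w → pointwise w (lookup S w) (lookup E w) (⊆ᵇ-lookup S E S⊆E w)))
        where
        χψ : ∀ a → χ a * ψ a ≈ ψ a
        χψ pending  = zeroˡ _
        χψ included = *-identityˡ _
        χψ skipped  = zeroˡ _
        pointwise : ∀ w x e → (x ≡ true → e ≡ true) → (if x then χ (σ w) else 1#) * (if e then ψ (σ w) else 1#) ≈ (if e then ψ (σ w) else 1#)
        pointwise w false e     _ = *-identityˡ _
        pointwise w true  true  _ = χψ (σ w)
        pointwise w true  false f with f ≡.refl
        ... | ()

      -- Every edge counted by `D S` contains `S`, so it survives only if all of `S` is included.
      -- Writing out this indicator lets Cauchy-Schwarz extract the small probability of that event.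
      D≈𝟙D : ∀ S σ → D S σ ≈ 𝟙 S σ * D S σ
      D≈𝟙D S σ = trans (sum-cong Ss term) (sum-*ˡ Ss (𝟙 S σ) _)
        where
        term : ∀ E → ind (S ⊆ᵇ E) * (ν E * Ψ E σ) ≈ 𝟙 S σ * (ind (S ⊆ᵇ E) * (ν E * Ψ E σ))
        term E with S ⊆ᵇ E in eq
        ... | false = trans (zeroˡ _) (sym (trans (*-congˡ (zeroˡ _)) (zeroʳ _)))
        ... | true  = trans (*-congˡ (*-congˡ (sym (𝟙Ψ≈Ψ S E σ (≡.subst T (≡.sym eq) tt)))))
          (solve 3 (λ x n y → con (+ 1) :* (n :* (x :* y)) := x :* (con (+ 1) :* (n :* y))) refl (𝟙 S σ) (ν E) (Ψ E σ))

      -- Whatever the past, a queried vertex is accepted with probability at most `r̄` given `L`;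
      -- hence the pending factor `r̄` in the supermartingale.
      𝔼𝟙≤ : ∀ L S → 𝔼[ L ] (λ σ → 𝟙 S σ * 𝟙 S σ) ≤ r̄ ^ ∣ S ∣
      𝔼𝟙≤ L S = begin
        𝔼[ L ] (λ σ → 𝟙 S σ * 𝟙 S σ)  ≤⟨ Ex-mono (coinOf-fair L) t wf (λ σ → ≤-trans (≤-reflexive (sym (∏-* (λ w → on S w (χ (σ w))) (λ w → on S w (χ (σ w))))))
                                            (∏-mono (λ w → 0≤x*x _) (λ w → dominates (lookup S w) (σ w)))) ⟩
        𝔼[ L ] (Prod h)  ≤⟨ Ex-supermartingale h (coinOf-fair L) (λ w a → 0≤on S w (0≤θ a)) (λ w r 0≤r r≤r̄ → super (lookup S w) (proj₂ (thin-bounds L w r 0≤r r≤r̄))) t wf ⟩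
        ∏ (λ w → on S w r̄)  ≈⟨ ∏-on S r̄ ⟩
        r̄ ^ ∣ S ∣  ∎
        where
        θ : Status → Carrier
        θ pending  = r̄
        θ included = 1#
        θ skipped  = 0#
        0≤θ : ∀ a → 0# ≤ θ a
        0≤θ pending  = <⇒≤ 0<r̄
        0≤θ included = 0≤1
        0≤θ skipped  = ≤-refl
        h : Fin N → Status → Carrier
        h w a = on S w (θ a)
        dominates : ∀ c a → (if c then χ a else 1#) * (if c then χ a else 1#) ≤ (if c then θ a else 1#)
        dominates false a        = ≤-reflexive (*-identityˡ 1#)
        dominates true  pending  = ≤-trans (≤-reflexive (zeroˡ _)) (<⇒≤ 0<r̄)
        dominates true  included = ≤-reflexive (*-identityˡ 1#)
        dominates true  skipped  = ≤-reflexive (zeroˡ _)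
        super : ∀ c {x} → x ≤ r̄ → x * (if c then 1# else 1#) + (1# - x) * (if c then 0# else 1#) ≤ (if c then r̄ else 1#)
        super false {x} x≤r̄ = ≤-reflexive (solve 1 (λ x → x :* con (+ 1) :+ (con (+ 1) :- x) :* con (+ 1) := con (+ 1)) refl x)
        super true  {x} x≤r̄ = ≤-trans (≤-reflexive (solve 1 (λ x → x :* con (+ 1) :+ (con (+ 1) :- x) :* con (+ 0) := x) refl x)) x≤r̄

      degOf² : ∀ L S → degOf L S * degOf L S ≤ r̄ ^ ∣ S ∣ * 𝔼[ L ] (λ σ → D S σ * D S σ)
      degOf² L S = ≤-trans (≤-reflexive (*-cong eq eq))
        (Ex-cauchy (coinOf-fair L) t wf (𝟙 S) (D S) (r̄ ^ ∣ S ∣) (^-pos ∣ S ∣ 0<r̄) (𝔼𝟙≤ L S))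
        where
        eq : degOf L S ≈ 𝔼[ L ] (λ σ → 𝟙 S σ * D S σ)
        eq = trans (degOf≈ L S) (Ex-cong (coinOf L) t σ₀ (D≈𝟙D S))

      𝔼D² : ∀ S → 𝔼 (λ σ → D S σ * D S σ) ≤ ∑∑ (λ E E′ → νν E E′ * (ind (S ⊆ᵇ (E ∩ E′)) * ι K ^ ∣ E ∩ E′ ∣))
      𝔼D² S = begin
        𝔼 (λ σ → D S σ * D S σ)
          ≈⟨ Ex-cong coin t σ₀ (λ σ → trans (square _) (∑∑-cong (λ E E′ → trans
               (solve 6 (λ a b c d x y → (c :* (a :* x)) :* (d :* (b :* y)) := (a :* b :* (c :* d)) :* (x :* y)) refl
                 (ν E) (ν E′) (ind (S ⊆ᵇ E)) (ind (S ⊆ᵇ E′)) (Ψ E σ) (Ψ E′ σ))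
               (*-congʳ (*-congˡ (trans (sym (ind-∧ (S ⊆ᵇ E) (S ⊆ᵇ E′))) (reflexive (≡.cong ind (≡.sym (⊆ᵇ-∩ S E E′)))))))))) ⟩
        𝔼 (λ σ → ∑∑ (λ E E′ → (νν E E′ * ind (S ⊆ᵇ (E ∩ E′))) * (Ψ E σ * Ψ E′ σ)))
          ≈⟨ trans (∑∑-𝔼 _) (∑∑-cong (λ E E′ → Ex-*ˡ coin t σ₀ (νν E E′ * ind (S ⊆ᵇ (E ∩ E′))) _)) ⟩
        ∑∑ (λ E E′ → (νν E E′ * ind (S ⊆ᵇ (E ∩ E′))) * 𝔼 (λ σ → Ψ E σ * Ψ E′ σ))
          ≤⟨ ∑∑-mono (λ E E′ → *-monoʳ-≤ (*-nonneg (0≤νν E E′) (0≤ind (S ⊆ᵇ (E ∩ E′))))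
               (≤-trans (Ex-mono coin-fair t wf (λ σ → *-mono-≤ (0≤Ψ E σ) (0≤X E′ σ) (Ψ≤X E σ) (Ψ≤X E′ σ))) (Ex-XX t wf E E′))) ⟩
        ∑∑ (λ E E′ → (νν E E′ * ind (S ⊆ᵇ (E ∩ E′))) * ι K ^ ∣ E ∩ E′ ∣)
          ≈⟨ ∑∑-cong (λ E E′ → *-assoc _ _ _) ⟩
        ∑∑ (λ E E′ → νν E E′ * (ind (S ⊆ᵇ (E ∩ E′)) * ι K ^ ∣ E ∩ E′ ∣))
          ∎

    -- An upper bound for q°/p, the reciprocal of the density p/q°, where `q°` is the given q before
    -- rounding and at most `ι 2 * q`.
    C : Carrier
    C = ι 2 * q * P

    private
      Cr̄ : Carrier
      Cr̄ = C * r̄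

      0≤C : 0# ≤ C
      0≤C = *-nonneg (*-nonneg (0≤ι 2) (<⇒≤ 0<q)) 0≤P

      0≤Cr̄ : 0# ≤ Cr̄
      0≤Cr̄ = *-nonneg 0≤C (<⇒≤ 0<r̄)

      -- Since K q r̄ = 1, the product C r̄ K is exactly 2P; and K ≤ P because 32p ≤ q₀. The 4 is
      -- the origin of the factor 4^s in η.
      [1+Cr̄]K≤4P : (1# + Cr̄) * ι K ≤ ι 4 * P
      [1+Cr̄]K≤4P = begin
        (1# + ι 2 * q * P * r̄) * ι K  ≈⟨ solve 4 (λ q P r K → (con (+ 1) :+ con (+ 2) :* q :* P :* r) :* K := K :+ con (+ 2) :* P :* (K :* (r :* q))) refl q P r̄ (ι K) ⟩
        ι K + ι 2 * P * (ι K * (r̄ * q))  ≈⟨ +-congˡ (trans (*-congˡ (trans (*-congˡ r̄q≈q₀) K*q₀≈1)) (*-identityʳ _)) ⟩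
        ι K + ι 2 * P  ≤⟨ +-monoˡ-≤ _ K≤P ⟩
        P + ι 2 * P  ≤⟨ x≤x+y 0≤P ⟩
        P + ι 2 * P + P  ≈⟨ solve 1 (λ P → P :+ con (+ 2) :* P :+ P := con (+ 4) :* P) refl P ⟩
        ι 4 * P  ∎
        where
        K≤P : ι K ≤ P
        K≤P = *-cancelˡ-≤ 0<p (begin
          p * ι K  ≈⟨ *-comm _ _ ⟩
          Kp  ≈⟨ *-identityˡ _ ⟨
          1# * Kp  ≤⟨ *-monoˡ-≤ 0≤Kp (ι-mono {1} {32} (ℕ.s≤s ℕ.z≤n)) ⟩
          ι 32 * Kp  ≤⟨ 32Kp≤1 ⟩
          1#  ≈⟨ 0<⇒*⁻¹≈1 0<p ⟨
          p * P  ∎)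

      -- Each element of I = E ∩ E′ lies in `S` or not, so the sum over S ⊆ I is a power of 1 + Cr̄.
      -- The condition on the size of `S` is relaxed to the same condition on `I`, and |I| ≤ s turns
      -- 4^|I| into 4^s.
      sum-over-S : ∀ E E′ → ∑ (λ S → ind (2 ℕ.≤ᵇ ∣ S ∣) * Cr̄ ^ ∣ S ∣ * (νν E E′ * (ind (S ⊆ᵇ (E ∩ E′)) * ι K ^ ∣ E ∩ E′ ∣)))
                   ≤ ι 4 ^ s * (νν E E′ * (two E E′ * P ^ ∣ E ∩ E′ ∣))
      sum-over-S E E′ = begin
        ∑ (λ S → ind (2 ℕ.≤ᵇ ∣ S ∣) * Cr̄ ^ ∣ S ∣ * (νν E E′ * (ind (S ⊆ᵇ I) * ι K ^ j)))
          ≈⟨ sum-cong Ss (λ S → solve 5 (λ a c n b k → a :* c :* (n :* (b :* k)) := (n :* k) :* ((a :* b) :* c)) refl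
               (ind (2 ℕ.≤ᵇ ∣ S ∣)) (Cr̄ ^ ∣ S ∣) (νν E E′) (ind (S ⊆ᵇ I)) (ι K ^ j)) ⟩
        ∑ (λ S → (νν E E′ * ι K ^ j) * ((ind (2 ℕ.≤ᵇ ∣ S ∣) * ind (S ⊆ᵇ I)) * Cr̄ ^ ∣ S ∣))
          ≤⟨ sum-mono Ss (λ S → *-monoʳ-≤ (*-nonneg (0≤νν E E′) (^-nonneg j (0≤ι K))) (*-monoˡ-≤ (^-nonneg ∣ S ∣ 0≤Cr̄) (grow S))) ⟩
        ∑ (λ S → (νν E E′ * ι K ^ j) * ((two E E′ * ind (S ⊆ᵇ I)) * Cr̄ ^ ∣ S ∣))
          ≈⟨ sum-cong Ss (λ S → solve 4 (λ n a b c → n :* ((a :* b) :* c) := (n :* a) :* (b :* c)) refl (νν E E′ * ι K ^ j) (two E E′) (ind (S ⊆ᵇ I)) (Cr̄ ^ ∣ S ∣)) ⟩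
        ∑ (λ S → ((νν E E′ * ι K ^ j) * two E E′) * (ind (S ⊆ᵇ I) * Cr̄ ^ ∣ S ∣))
          ≈⟨ trans (sum-*ˡ Ss _ _) (*-congˡ (sum-subsets-⊆ I Cr̄)) ⟩
        ((νν E E′ * ι K ^ j) * two E E′) * (1# + Cr̄) ^ j
          ≈⟨ trans (solve 4 (λ n k a b → ((n :* k) :* a) :* b := n :* (a :* (b :* k))) refl (νν E E′) (ι K ^ j) (two E E′) ((1# + Cr̄) ^ j))
               (*-congˡ (*-congˡ (sym (^-distrib-* (1# + Cr̄) (ι K) j)))) ⟩
        νν E E′ * (two E E′ * ((1# + Cr̄) * ι K) ^ j)
          ≤⟨ *-monoʳ-≤ (0≤νν E E′) (*-monoʳ-≤ (0≤ind (2 ℕ.≤ᵇ j)) (^-mono-≤ j (*-nonneg (0≤-+ 0≤1 0≤Cr̄) (0≤ι K)) [1+Cr̄]K≤4P)) ⟩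
        νν E E′ * (two E E′ * (ι 4 * P) ^ j)
          ≈⟨ *-congˡ (*-congˡ (^-distrib-* (ι 4) P j)) ⟩
        νν E E′ * (two E E′ * (ι 4 ^ j * P ^ j))
          ≤⟨ enlarge (supp E) ⟩
        νν E E′ * (two E E′ * (ι 4 ^ s * P ^ j))
          ≈⟨ solve 4 (λ n a f b → n :* (a :* (f :* b)) := f :* (n :* (a :* b))) refl (νν E E′) (two E E′) (ι 4 ^ s) (P ^ j) ⟩
        ι 4 ^ s * (νν E E′ * (two E E′ * P ^ j))
          ∎
        where
        I = E ∩ E′
        j = ∣ I ∣

        grow : ∀ S → ind (2 ℕ.≤ᵇ ∣ S ∣) * ind (S ⊆ᵇ I) ≤ two E E′ * ind (S ⊆ᵇ I)
        grow S with S ⊆ᵇ I in eq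
        ... | false = ≤-reflexive (trans (zeroʳ _) (sym (zeroʳ _)))
        ... | true  = *-monoˡ-≤ 0≤1 (ind-mono (2 ℕ.≤ᵇ ∣ S ∣) (2 ℕ.≤ᵇ j)
          (λ le → ℕP.≤⇒≤ᵇ (ℕP.≤-trans (ℕP.≤ᵇ⇒≤ 2 ∣ S ∣ le) (⊆ᵇ⇒∣∣≤ S I (≡.subst T (≡.sym eq) tt)))))

        I⊆E : T (I ⊆ᵇ E)
        I⊆E = lookup-⊆ᵇ I E (λ v Iv → BoolP.∧-conicalˡ (lookup E v) (lookup E′ v) (≡.trans (≡.sym (VecP.lookup-zipWith _∧_ v E E′)) Iv))

        enlarge : ν E ≈ 0# ⊎ (∣ E ∣ ≡ s × (∀ v → lookup E v ≡ true → v ∈ ρ)) →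
                  νν E E′ * (two E E′ * (ι 4 ^ j * P ^ j)) ≤ νν E E′ * (two E E′ * (ι 4 ^ s * P ^ j))
        enlarge (inj₁ νE≈0) = ≤-reflexive (trans (vanish _) (sym (vanish _)))
          where
          vanish : ∀ x → νν E E′ * x ≈ 0#
          vanish x = trans (*-congʳ (trans (*-congʳ νE≈0) (zeroˡ _))) (zeroˡ x)
        enlarge (inj₂ (∣E∣≡s , _)) = *-monoʳ-≤ (0≤νν E E′) (*-monoʳ-≤ (0≤ind (2 ℕ.≤ᵇ j)) (*-monoˡ-≤ (^-nonneg j 0≤P)
          (^-monoʳ-≤ (ι-mono {1} {4} (ℕ.s≤s ℕ.z≤n)) (≡.subst (j ℕ.≤_) ∣E∣≡s (⊆ᵇ⇒∣∣≤ I E I⊆E)))))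

    -- Λ of `νOf L` with `C` in place of the reciprocal density, and with the sum extended to vertex
    -- sets outside `L`; so it is at least the value of Λ at p/q°.
    ΛOf : Subset N → Carrier
    ΛOf L = ∑ (λ S → ind (2 ℕ.≤ᵇ ∣ S ∣) * (C ^ ∣ S ∣ * (degOf L S * degOf L S)))

    -- The assumed inequalities concern single sets `L`, so Cauchy-Schwarz over `𝓜` is used before
    -- averaging. Averaging replaces the coins of `L` by `q₀`-coins, for which the second moments of
    -- `D S` are bounded, and `sum-over-S` collects the terms of `Γ`.
    transfer : ∀ D → 0# ≤ D → All (λ L → ∑ (νOf L) * ∑ (νOf L) ≤ D * ΛOf L) 𝓜 → 𝔼 Y * 𝔼 Y ≤ D * (ι 4 ^ s * Γ P)
    transfer D′ 0≤D′ nonJanson = *-cancelˡ-≤ (0<-* 0<m 0<m) (begin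
      m * m * (𝔼 Y * 𝔼 Y)
        ≈⟨ solve 2 (λ m y → m :* m :* (y :* y) := (m :* y) :* (m :* y)) refl m (𝔼 Y) ⟩
      (m * 𝔼 Y) * (m * 𝔼 Y)
        ≈⟨ *-cong sumL sumL ⟩
      sumOver 𝓜 (λ L → ∑ (νOf L)) * sumOver 𝓜 (λ L → ∑ (νOf L))
        ≤⟨ sum-square 𝓜 _ ⟩
      m * sumOver 𝓜 (λ L → ∑ (νOf L) * ∑ (νOf L))
        ≤⟨ *-monoʳ-≤ (0≤ι (length 𝓜)) (sum-mono-All nonJanson) ⟩
      m * sumOver 𝓜 (λ L → D′ * ΛOf L)
        ≈⟨ *-congˡ (sum-*ˡ 𝓜 D′ ΛOf) ⟩
      m * (D′ * sumOver 𝓜 ΛOf)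
        ≤⟨ *-monoʳ-≤ (0≤ι (length 𝓜)) (*-monoʳ-≤ 0≤D′ sumΛ) ⟩
      m * (D′ * (m * (ι 4 ^ s * Γ P)))
        ≈⟨ solve 3 (λ m d x → m :* (d :* (m :* x)) := m :* m :* (d :* x)) refl m D′ (ι 4 ^ s * Γ P) ⟩
      m * m * (D′ * (ι 4 ^ s * Γ P))
        ∎)
      where
      m : Carrier
      m = ι (length 𝓜)

      0<m : 0# < m
      0<m = 0<ι′ 1≤∣𝓜∣

      average : ∀ f → sumOver 𝓜 (λ L → 𝔼[ L ] f) ≈ m * 𝔼 f
      average f = trans (sum-cong 𝓜 (λ L → sym (*-identityˡ _))) (trans (Ex-average good f) (*-congʳ mass-one))

      sumL : m * 𝔼 Y ≈ sumOver 𝓜 (λ L → ∑ (νOf L))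
      sumL = sym (trans (sum-cong 𝓜 sum-νOf) (average Y))

      weight : Subset N → Carrier
      weight S = ind (2 ℕ.≤ᵇ ∣ S ∣) * Cr̄ ^ ∣ S ∣

      0≤weight : ∀ S → 0# ≤ weight S
      0≤weight S = *-nonneg (0≤ind (2 ℕ.≤ᵇ ∣ S ∣)) (^-nonneg ∣ S ∣ 0≤Cr̄)

      Λ-term : ∀ L S → ind (2 ℕ.≤ᵇ ∣ S ∣) * (C ^ ∣ S ∣ * (degOf L S * degOf L S)) ≤ weight S * 𝔼[ L ] (λ σ → D S σ * D S σ)
      Λ-term L S = begin
        ind (2 ℕ.≤ᵇ ∣ S ∣) * (C ^ ∣ S ∣ * (degOf L S * degOf L S))
          ≤⟨ *-monoʳ-≤ (0≤ind (2 ℕ.≤ᵇ ∣ S ∣)) (*-monoʳ-≤ (^-nonneg ∣ S ∣ 0≤C) (degOf² L S)) ⟩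
        ind (2 ℕ.≤ᵇ ∣ S ∣) * (C ^ ∣ S ∣ * (r̄ ^ ∣ S ∣ * F))
          ≈⟨ solve 4 (λ a c r f → a :* (c :* (r :* f)) := a :* (c :* r) :* f) refl (ind (2 ℕ.≤ᵇ ∣ S ∣)) (C ^ ∣ S ∣) (r̄ ^ ∣ S ∣) F ⟩
        ind (2 ℕ.≤ᵇ ∣ S ∣) * (C ^ ∣ S ∣ * r̄ ^ ∣ S ∣) * F
          ≈⟨ *-congʳ (*-congˡ (^-distrib-* C r̄ ∣ S ∣)) ⟨
        weight S * F
          ∎
        where
        F : Carrier
        F = 𝔼[ L ] (λ σ → D S σ * D S σ)

      sumΛ : sumOver 𝓜 ΛOf ≤ m * (ι 4 ^ s * Γ P)
      sumΛ = begin
        sumOver 𝓜 ΛOf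
          ≤⟨ sum-mono 𝓜 (λ L → sum-mono Ss (Λ-term L)) ⟩
        sumOver 𝓜 (λ L → ∑ (λ S → weight S * 𝔼[ L ] (λ σ → D S σ * D S σ)))
          ≈⟨ trans (sum-swap 𝓜 Ss _) (sum-cong Ss (λ S → trans (sum-*ˡ 𝓜 (weight S) _) (*-congˡ (average (λ σ → D S σ * D S σ))))) ⟩
        ∑ (λ S → weight S * (m * 𝔼 (λ σ → D S σ * D S σ)))
          ≈⟨ trans (sum-cong Ss (λ S → solve 3 (λ w m x → w :* (m :* x) := m :* (w :* x)) refl (weight S) m _)) (sum-*ˡ Ss m _) ⟩
        m * ∑ (λ S → weight S * 𝔼 (λ σ → D S σ * D S σ))
          ≤⟨ *-monoʳ-≤ (0≤ι (length 𝓜)) (sum-mono Ss (λ S → *-monoʳ-≤ (0≤weight S) (𝔼D² S))) ⟩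
        m * ∑ (λ S → weight S * ∑∑ (λ E E′ → νν E E′ * (ind (S ⊆ᵇ (E ∩ E′)) * ι K ^ ∣ E ∩ E′ ∣)))
          ≈⟨ *-congˡ (trans (sum-cong Ss (λ S → sym (trans (sum-cong Ss (λ E → sum-*ˡ Ss (weight S) _)) (sum-*ˡ Ss (weight S) _))))
               (trans (sum-swap Ss Ss _) (sum-cong Ss (λ E → sum-swap Ss Ss _)))) ⟩
        m * ∑∑ (λ E E′ → ∑ (λ S → weight S * (νν E E′ * (ind (S ⊆ᵇ (E ∩ E′)) * ι K ^ ∣ E ∩ E′ ∣))))
          ≤⟨ *-monoʳ-≤ (0≤ι (length 𝓜)) (∑∑-mono sum-over-S) ⟩
        m * ∑∑ (λ E E′ → ι 4 ^ s * (νν E E′ * (two E E′ * P ^ ∣ E ∩ E′ ∣)))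
          ≈⟨ *-congˡ (trans (sum-cong Ss (λ E → sum-*ˡ Ss (ι 4 ^ s) _)) (sum-*ˡ Ss (ι 4 ^ s) _)) ⟩
        m * (ι 4 ^ s * Γ P)
          ∎

-- Vertices sorted by degree.

module Sorting (ℝ : Reals) {A : Set} (d : A → Reals.Carrier ℝ) where
  open Reals ℝ using (_≤_)
  open OrderedField ℝ

  Decreasing : List A → Set
  Decreasing = AllPairs (λ x y → d y ≤ d x)

  private
    insert : ∀ x xs → Decreasing xs → ∃ λ ys → ys ↭ x ∷ xs × Decreasing ys
    insert x [] _ = x ∷ [] , Perm.refl , [] ∷ []
    insert x (y ∷ xs) (y≥ ∷ xs↓) with total (d y) (d x)
    ... | inj₁ dy≤dx = x ∷ y ∷ xs , Perm.refl , (dy≤dx ∷ All.map (λ dz≤dy → ≤-trans dz≤dy dy≤dx) y≥) ∷ y≥ ∷ xs↓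
    ... | inj₂ dx≤dy with insert x xs xs↓
    ...   | ys , ys↭ , ys↓ = y ∷ ys , Perm.trans (Perm.prep y ys↭) (Perm.swap y x Perm.refl) ,
                             All-resp-↭ (Perm.↭-sym ys↭) (dx≤dy ∷ y≥) ∷ ys↓

  sort : ∀ xs → ∃ λ ys → ys ↭ xs × Decreasing ys
  sort [] = [] , Perm.refl , []
  sort (x ∷ xs) with sort xs
  ... | ys , ys↭xs , ys↓ with insert x ys ys↓
  ...   | zs , zs↭ , zs↓ = zs , Perm.trans zs↭ (Perm.prep x ys↭xs) , zs↓

Unique-resp-↭ : ∀ {A : Set} {xs ys : List A} → xs ↭ ys → Unique xs → Unique ys
Unique-resp-↭ Perm.refl         xs!                         = xs!
Unique-resp-↭ (Perm.prep x p)   (x∉ ∷ xs!)                  = All-resp-↭ p x∉ ∷ Unique-resp-↭ p xs!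
Unique-resp-↭ (Perm.swap x y p) ((x≢y ∷ x∉) ∷ (y∉ ∷ xs!)) =
  ((x≢y ∘ ≡.sym) ∷ All-resp-↭ p y∉) ∷ (All-resp-↭ p x∉ ∷ Unique-resp-↭ p xs!)
Unique-resp-↭ (Perm.trans p q)  xs!                         = Unique-resp-↭ q (Unique-resp-↭ p xs!)

elements : ∀ {N} → Subset N → List (Fin N)
elements {N} A = filter (λ v → lookup A v BoolP.≟ true) (allFin N)

elements! : ∀ {N} (A : Subset N) → Unique (elements A)
elements! {N} A = UniqueP.filter⁺ (λ v → lookup A v BoolP.≟ true) (UniqueP.allFin⁺ N)

∈-elements : ∀ {N} (A : Subset N) {v} → lookup A v ≡ true → v ∈ elements A
∈-elements A {v} Av = ∈-filter⁺ (λ v → lookup A v BoolP.≟ true) (∈-allFin v) Av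

elements-∈ : ∀ {N} (A : Subset N) {v} → v ∈ elements A → lookup A v ≡ true
elements-∈ {N} A v∈ = proj₂ (∈-filter⁻ (λ v → lookup A v BoolP.≟ true) {xs = allFin N} v∈)

-- Janson witnesses as probability measures.

module Unfolding (ℝ : Reals) where
  open Reals ℝ hiding (zero)
  open OrderedField ℝ
  open Sums ℝ
  open ≤R

  length-unique : ∀ {N} (A : Subset N) {vs} → Unique vs → All (λ v → lookup A v ≡ true) vs → length vs ℕ.≤ ∣ A ∣
  length-unique A {vs} vs! vs⊆A = ι-cancel-≤ (begin
    ι (length vs)  ≈⟨ trans (sum-const vs 1#) (*-identityʳ _) ⟨
    sumOver vs (λ _ → 1#)  ≤⟨ sum-mono-All (All.map (λ eq → ≤-reflexive (reflexive (≡.cong ind (≡.sym eq)))) vs⊆A) ⟩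
    sumOver vs (λ v → ind (lookup A v))  ≤⟨ sum-unique A vs! ⟩
    ι ∣ A ∣  ∎)

  ^ℤ-neg : ∀ {x} → 0# < x → ∀ k → x ^ℤ (ℤ.- (+ k)) ≈ (x ⁻¹) ^ k
  ^ℤ-neg 0<x zero    = refl
  ^ℤ-neg {x} 0<x (suc k) = go (suc k)
    where
    go : ∀ k → (x ^ k) ⁻¹ ≈ (x ⁻¹) ^ k
    go k = sym (⁻¹-unique (^-pos k 0<x) (begin-equality
      x ^ k * (x ⁻¹) ^ k  ≈⟨ ^-distrib-* x (x ⁻¹) k ⟨
      (x * x ⁻¹) ^ k  ≈⟨ ^-congˡ k (0<⇒*⁻¹≈1 0<x) ⟩
      1# ^ k  ≈⟨ 1^n≈1 k ⟩
      1#  ∎))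

  module _ {N : ℕ} (G : Hypergraph N) (ν : Subset N → Carrier) where
    open Weights ℝ G

    onEdges : Subset N → Carrier
    onEdges A = ind (E G A) * ν A

    e≈ : e ν ≈ sumOver (subsets N) onEdges
    e≈ = sum-filter (λ A → BoolP.T? (E G A)) (subsets N) ν

    codegree : Subset N → Carrier
    codegree S = sumOver (subsets N) (λ A → ind (S ⊆ᵇ A) * onEdges A)

    d≈ : ∀ S → d ν S ≈ codegree S
    d≈ S = begin-equality
      d ν S
        ≈⟨ sum-filter (S ⊆?_) (members (E G)) ν ⟩
      sumOver (members (E G)) (λ A → ind (does (S ⊆? A)) * ν A)
        ≈⟨ sum-filter (λ A → BoolP.T? (E G A)) (subsets N) _ ⟩
      sumOver (subsets N) (λ A → ind (E G A) * (ind (does (S ⊆? A)) * ν A))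
        ≈⟨ sum-cong (subsets N) (λ A → trans (*-congˡ (*-congʳ (reflexive (≡.cong ind (does-⊆? S A)))))
             (solve 3 (λ a b c → a :* (b :* c) := b :* (a :* c)) refl (ind (E G A)) (ind (S ⊆ᵇ A)) (ν A))) ⟩
      codegree S
        ∎

    Λ≈ : ∀ {p} → 0# < p → Λ p ν ≈ sumOver (subsets N) (λ S →
           ind (S ⊆ᵇ V G) * (ind (2 ℕ.≤ᵇ ∣ S ∣) * ((p ⁻¹) ^ ∣ S ∣ * (codegree S * codegree S))))
    Λ≈ {p} 0<p = trans (sum-filter _ (subsets N) _) (sum-cong (subsets N) (λ S → begin-equality
      ind (does (S ⊆? V G) ∧ (2 ℕ.≤ᵇ ∣ S ∣)) * (d ν S ^ 2 * p ^ℤ (ℤ.- (+ ∣ S ∣)))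
        ≈⟨ *-cong (trans (ind-∧ (does (S ⊆? V G)) (2 ℕ.≤ᵇ ∣ S ∣)) (*-congʳ (reflexive (≡.cong ind (does-⊆? S (V G))))))
                  (*-cong (^-congˡ 2 (d≈ S)) (^ℤ-neg 0<p ∣ S ∣)) ⟩
      ind (S ⊆ᵇ V G) * ind (2 ℕ.≤ᵇ ∣ S ∣) * (codegree S ^ 2 * (p ⁻¹) ^ ∣ S ∣)
        ≈⟨ solve 4 (λ a b c x → a :* b :* (c :^ 2 :* x) := a :* (b :* (x :* (c :* c)))) refl
             (ind (S ⊆ᵇ V G)) (ind (2 ℕ.≤ᵇ ∣ S ∣)) (codegree S) ((p ⁻¹) ^ ∣ S ∣) ⟩
      ind (S ⊆ᵇ V G) * (ind (2 ℕ.≤ᵇ ∣ S ∣) * ((p ⁻¹) ^ ∣ S ∣ * (codegree S * codegree S)))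
        ∎))

  -- A Janson witness scaled to total mass 1 and set to 0 off the edges, so that sums may run over
  -- all subsets and the condition becomes RΛ < 1.
  record Measure {N : ℕ} (G : Hypergraph N) (p R : Carrier) : Set where
    field
      ν        : Subset N → Carrier
      ν-nonneg : ∀ A → 0# ≤ ν A
      ν-edges  : ∀ A → E G A ≡ false → ν A ≈ 0#
      ν-total  : sumOver (subsets N) ν ≈ 1#
      RΛ<1     : R * sumOver (subsets N) (λ S → ind (S ⊆ᵇ V G) * (ind (2 ℕ.≤ᵇ ∣ S ∣) * ((p ⁻¹) ^ ∣ S ∣ *
                   (sumOver (subsets N) (λ A → ind (S ⊆ᵇ A) * ν A) * sumOver (subsets N) (λ A → ind (S ⊆ᵇ A) * ν A))))) < 1#

  module _ {N : ℕ} (G : Hypergraph N) {p R : Carrier} (0<p : 0# < p) (0<R : 0# < R) where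

    normalise : Janson ℝ G p R → Measure G p R
    normalise (ν₀ , 0≤ν₀ , Λ<) = record
      { ν        = ν
      ; ν-nonneg = 0≤ν
      ; ν-edges  = λ A EA → trans (*-congˡ (trans (*-congʳ (reflexive (≡.cong ind EA))) (zeroˡ _))) (zeroʳ _)
      ; ν-total  = trans (sum-*ˡ Ss i (onEdges G ν₀)) (trans (*-congˡ (sym (e≈ G ν₀))) (⁻¹-inverseˡ 0<e))
      ; RΛ<1     = ≤-<-trans (≤-reflexive scale) (<-≤-trans (*-monoʳ-< (0<-* 0<i 0<i) RΛ<e²) (≤-reflexive ii))
      }
      where
      open Weights ℝ G
      Ss = subsets N

      0≤onEdges : ∀ A → 0# ≤ onEdges G ν₀ A
      0≤onEdges A with E G A in EA
      ... | true  = ≤-trans (0≤ν₀ A (≡.subst T (≡.sym EA) tt)) (≤-reflexive (sym (*-identityˡ _)))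
      ... | false = ≤-reflexive (sym (zeroˡ _))

      RΛ<e² : R * Λ p ν₀ < e ν₀ * e ν₀
      RΛ<e² = <-≤-trans (*-monoʳ-< 0<R Λ<) (≤-reflexive (trans
        (solve 3 (λ R e r → R :* (e :^ 2 :* r) := (R :* r) :* (e :* e)) refl R (e ν₀) (R ⁻¹))
        (trans (*-congʳ (0<⇒*⁻¹≈1 0<R)) (*-identityˡ _))))

      0≤P^ : ∀ k → 0# ≤ (p ⁻¹) ^ k
      0≤P^ k = ^-nonneg k (⁻¹-nonneg 0<p)

      0≤Λ : 0# ≤ Λ p ν₀
      0≤Λ = ≤-trans (sum-nonneg Ss (λ S → *-nonneg (0≤ind (S ⊆ᵇ V G)) (*-nonneg (0≤ind (2 ℕ.≤ᵇ ∣ S ∣)) (*-nonneg (0≤P^ ∣ S ∣) (0≤x*x (codegree G ν₀ S))))))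
        (≤-reflexive (sym (Λ≈ G ν₀ 0<p)))

      0<e : 0# < e ν₀
      -- If the mass were 0, then RΛ would lie strictly below 0, although Λ is nonnegative.
      0<e = ≤-trans (sum-nonneg Ss 0≤onEdges) (≤-reflexive (sym (e≈ G ν₀))) , λ 0≈e →
        <⇒≱ RΛ<e² (≤-trans (≤-reflexive (trans (*-congʳ (sym 0≈e)) (zeroˡ _))) (*-nonneg (<⇒≤ 0<R) 0≤Λ))

      i : Carrier
      i = e ν₀ ⁻¹

      0<i : 0# < i
      0<i = 0<⁻¹ 0<e

      ν : Subset N → Carrier
      ν A = i * onEdges G ν₀ A

      0≤ν : ∀ A → 0# ≤ ν A
      0≤ν A = *-nonneg (<⇒≤ 0<i) (0≤onEdges A)

      cod : Subset N → Carrier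
      cod S = sumOver Ss (λ A → ind (S ⊆ᵇ A) * ν A)

      cod≈ : ∀ S → cod S ≈ i * codegree G ν₀ S
      cod≈ S = trans (sum-cong Ss (λ A → solve 3 (λ a i x → a :* (i :* x) := i :* (a :* x)) refl (ind (S ⊆ᵇ A)) i (onEdges G ν₀ A))) (sum-*ˡ Ss i _)

      scale : R * sumOver Ss (λ S → ind (S ⊆ᵇ V G) * (ind (2 ℕ.≤ᵇ ∣ S ∣) * ((p ⁻¹) ^ ∣ S ∣ * (cod S * cod S)))) ≈ i * i * (R * Λ p ν₀)
      scale = begin-equality
        R * sumOver Ss (λ S → ind (S ⊆ᵇ V G) * (ind (2 ℕ.≤ᵇ ∣ S ∣) * ((p ⁻¹) ^ ∣ S ∣ * (cod S * cod S))))
          ≈⟨ *-congˡ (sum-cong Ss (λ S → trans (*-congˡ (*-congˡ (*-congˡ (*-cong (cod≈ S) (cod≈ S)))))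
               (solve 5 (λ a b c i x → a :* (b :* (c :* (i :* x :* (i :* x)))) := i :* i :* (a :* (b :* (c :* (x :* x))))) refl
                 (ind (S ⊆ᵇ V G)) (ind (2 ℕ.≤ᵇ ∣ S ∣)) ((p ⁻¹) ^ ∣ S ∣) i (codegree G ν₀ S)))) ⟩
        R * sumOver Ss (λ S → i * i * (ind (S ⊆ᵇ V G) * (ind (2 ℕ.≤ᵇ ∣ S ∣) * ((p ⁻¹) ^ ∣ S ∣ * (codegree G ν₀ S * codegree G ν₀ S)))))
          ≈⟨ *-congˡ (trans (sum-*ˡ Ss (i * i) _) (*-congˡ (sym (Λ≈ G ν₀ 0<p)))) ⟩
        R * (i * i * Λ p ν₀)
          ≈⟨ solve 3 (λ R x l → R :* (x :* l) := x :* (R :* l)) refl R (i * i) (Λ p ν₀) ⟩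
        i * i * (R * Λ p ν₀)
          ∎

      ii : i * i * (e ν₀ * e ν₀) ≈ 1#
      ii = trans (solve 2 (λ i e → i :* i :* (e :* e) := (i :* e) :* (i :* e)) refl i (e ν₀))
        (trans (*-cong (⁻¹-inverseˡ 0<e) (⁻¹-inverseˡ 0<e)) (*-identityˡ 1#))

  -- Strict order is order without equality, and excluded middle is what decides the equality.
  ¬<⇒≥ : ExcludedMiddle 0ℓ → ∀ {x y} → ¬ (x < y) → y ≤ x
  ¬<⇒≥ em {x} {y} ¬x<y with total x y
  ... | inj₂ y≤x = y≤x
  ... | inj₁ x≤y with em {x ≈ y}
  ...   | yes x≈y = ≤-reflexive (sym x≈y)
  ...   | no  x≉y = ⊥-elim (¬x<y (x≤y , x≉y))

  ∈-[] : ∀ {N} (H : Hypergraph N) L A → E (H [ L ]) A ≡ E H A ∧ (A ⊆ᵇ L)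
  ∈-[] H L A = ≡.cong (E H A ∧_) (≡.trans (isYes≗does (A ⊆? L)) (does-⊆? A L))

-- A container that the random set hits is not Janson.

module _ (em : ExcludedMiddle 0ℓ) (ℝ : Reals) where
  open Reals ℝ hiding (zero)
  open OrderedField ℝ

  module Container (s ℓ : ℕ) (2≤s : 2 ℕ.≤ s) (4≤ℓ : 4 ℕ.≤ ℓ) {N : ℕ}
    (H : Hypergraph N) (uniform : Uniform s H)
    (p q° R η : Carrier) (0<p : 0# < p) (0<q° : 0# < q°) (0<R : 0# < R) (0<η : 0# < η)
    (q°≤2q : q° ≤ ι 2 * Parameters.q ℝ s ℓ 2≤s 4≤ℓ) (32p≤q₀ : ι 32 * p ≤ Parameters.q₀ ℝ s ℓ 2≤s 4≤ℓ)
    (n : ℕ) (1≤n : 1 ℕ.≤ n) (pn≤64R : p * ι n ≤ ι 64 * R) (η-eq : ι 4 ^ s * η * ι 4 ≈ 1#) where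
    open Sums ℝ
    open Unfolding ℝ
    open Parameters ℝ s ℓ 2≤s 4≤ℓ
    open Hitting ℝ
    open ≤R

    -- Since `𝔼 Y` is at least 1/2, `transfer` with D = ηR gives 1/4 ≤ ηR 4^s Γ. By the choice of η
    -- this reads 1 ≤ RΓ, whereas RΓ ≤ RΛ < 1.
    ¬janson : ∀ X → ∣ X ∣ ℕ.≤ n → ∀ 𝓜 → 1 ℕ.≤ length 𝓜 → All (λ L → ¬ Janson ℝ (H [ L ]) (p / q°) (η * R)) 𝓜 →
              Hits 𝓜 (elements X) b → ¬ Janson ℝ (H [ X ]) p R
    ¬janson X ∣X∣≤n 𝓜 1≤∣𝓜∣ non hits janson = <⇒≱ RΓ<1 1≤RΓ
      where
      open Measure (normalise (H [ X ]) 0<p 0<R janson)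

      Ss = subsets N

      open Degrees ℝ ν
      open Sorting ℝ deg

      P : Carrier
      P = p ⁻¹

      sorted : ∃ λ ρ → ρ ↭ elements X × Decreasing ρ
      sorted = sort (elements X)

      ρ : List (Fin N)
      ρ = proj₁ sorted

      ρ↭ : ρ ↭ elements X
      ρ↭ = proj₁ (proj₂ sorted)

      ρ! : Unique ρ
      ρ! = Unique-resp-↭ (Perm.↭-sym ρ↭) (elements! X)

      ∣ρ∣≤n : length ρ ℕ.≤ n
      ∣ρ∣≤n = ℕP.≤-trans (length-unique X ρ! (All.tabulate (λ v∈ρ → elements-∈ X (∈-resp-↭ ρ↭ v∈ρ)))) ∣X∣≤n

      edge : ∀ A → ν A ≈ 0# ⊎ (T (E H A) × T (A ⊆ᵇ X))
      edge A with E H A ∧ (A ⊆ᵇ X) in eq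
      ... | false = inj₁ (ν-edges A (≡.trans (∈-[] H X A) eq))
      ... | true  = inj₂ (Equivalence.to BoolP.T-∧ (≡.subst T (≡.sym eq) tt))

      supp : ∀ A → ν A ≈ 0# ⊎ (∣ A ∣ ≡ s × (∀ v → lookup A v ≡ true → v ∈ ρ))
      supp A with edge A
      ... | inj₁ ν≈0         = inj₁ ν≈0
      ... | inj₂ (A∈E , A⊆X) = inj₂ (uniform A A∈E ,
        λ v Av → ∈-resp-↭ (Perm.↭-sym ρ↭) (∈-elements X (⊆ᵇ-lookup A X A⊆X v Av)))

      hits′ : Hits 𝓜 ρ b
      hits′ U U! U⊆ρ = hits U U! (All.map (∈-resp-↭ ρ↭) U⊆ρ)

      cod : Subset N → Carrier
      cod S = ∑ (λ A → ind (S ⊆ᵇ A) * ν A)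

      Λ̄ : Carrier
      Λ̄ = ∑ (λ S → ind (S ⊆ᵇ X) * (ind (2 ℕ.≤ᵇ ∣ S ∣) * (P ^ ∣ S ∣ * (cod S * cod S))))

      0≤P : 0# ≤ P
      0≤P = ⁻¹-nonneg 0<p

      pair≤ : ∀ A B → ν A * ν B * (ind (2 ℕ.≤ᵇ ∣ A ∩ B ∣) * P ^ ∣ A ∩ B ∣) ≤
              ∑ (λ S → ind (S ⊆ᵇ X) * (ind (2 ℕ.≤ᵇ ∣ S ∣) * (P ^ ∣ S ∣ * ((ind (S ⊆ᵇ A) * ν A) * (ind (S ⊆ᵇ B) * ν B)))))
      pair≤ A B with edge A
      ... | inj₁ ν≈0 = begin
        ν A * ν B * _  ≈⟨ trans (*-congʳ (trans (*-congʳ ν≈0) (zeroˡ _))) (zeroˡ _) ⟩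
        0#  ≤⟨ sum-nonneg Ss (λ S → *-nonneg (0≤ind (S ⊆ᵇ X)) (*-nonneg (0≤ind (2 ℕ.≤ᵇ ∣ S ∣)) (*-nonneg (^-nonneg ∣ S ∣ 0≤P)
                             (*-nonneg (*-nonneg (0≤ind (S ⊆ᵇ A)) (ν-nonneg A)) (*-nonneg (0≤ind (S ⊆ᵇ B)) (ν-nonneg B)))))) ⟩
        _  ∎
      ... | inj₂ (_ , A⊆X) = begin
        ν A * ν B * (ind (2 ℕ.≤ᵇ ∣ A ∩ B ∣) * P ^ ∣ A ∩ B ∣)
          ≈⟨ solve 4 (λ a b c x → a :* b :* (c :* x) := con (+ 1) :* (c :* (x :* ((con (+ 1) :* a) :* (con (+ 1) :* b))))) refl
               (ν A) (ν B) (ind (2 ℕ.≤ᵇ ∣ A ∩ B ∣)) (P ^ ∣ A ∩ B ∣) ⟩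
        1# * (ind (2 ℕ.≤ᵇ ∣ A ∩ B ∣) * (P ^ ∣ A ∩ B ∣ * ((1# * ν A) * (1# * ν B))))
          ≈⟨ *-cong (one I⊆X) (*-congˡ (*-congˡ (*-cong (*-congʳ (one I⊆A)) (*-congʳ (one I⊆B))))) ⟩
        ind ((A ∩ B) ⊆ᵇ X) * (ind (2 ℕ.≤ᵇ ∣ A ∩ B ∣) * (P ^ ∣ A ∩ B ∣ * ((ind ((A ∩ B) ⊆ᵇ A) * ν A) * (ind ((A ∩ B) ⊆ᵇ B) * ν B))))
          ≤⟨ sum-term (∈-subsets (A ∩ B)) (λ S → *-nonneg (0≤ind (S ⊆ᵇ X)) (*-nonneg (0≤ind (2 ℕ.≤ᵇ ∣ S ∣)) (*-nonneg (^-nonneg ∣ S ∣ 0≤P)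
                             (*-nonneg (*-nonneg (0≤ind (S ⊆ᵇ A)) (ν-nonneg A)) (*-nonneg (0≤ind (S ⊆ᵇ B)) (ν-nonneg B)))))) ⟩
        _ ∎
        where
        one : ∀ {c} → T c → 1# ≈ ind c
        one {true} _ = refl
        lookup-∩ : ∀ v → lookup (A ∩ B) v ≡ true → lookup A v ∧ lookup B v ≡ true
        lookup-∩ v eq = ≡.trans (≡.sym (VecP.lookup-zipWith _∧_ v A B)) eq
        I⊆A : T ((A ∩ B) ⊆ᵇ A)
        I⊆A = lookup-⊆ᵇ (A ∩ B) A (λ v eq → BoolP.∧-conicalˡ (lookup A v) (lookup B v) (lookup-∩ v eq))
        I⊆B : T ((A ∩ B) ⊆ᵇ B)
        I⊆B = lookup-⊆ᵇ (A ∩ B) B (λ v eq → BoolP.∧-conicalʳ (lookup A v) (lookup B v) (lookup-∩ v eq))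
        I⊆X : T ((A ∩ B) ⊆ᵇ X)
        I⊆X = lookup-⊆ᵇ (A ∩ B) X (λ v eq → ⊆ᵇ-lookup A X A⊆X v (⊆ᵇ-lookup (A ∩ B) A I⊆A v eq))

      Γ≤Λ̄ : Γ P ≤ Λ̄
      Γ≤Λ̄ = begin
        Γ P
          ≤⟨ sum-mono Ss (λ A → sum-mono Ss (pair≤ A)) ⟩
        ∑ (λ A → ∑ (λ B → ∑ (λ S → term A B S)))
          ≈⟨ trans (sum-cong Ss (λ A → sum-swap Ss Ss (term A))) (sum-swap Ss Ss (λ A S → ∑ (λ B → term A B S))) ⟩
        ∑ (λ S → ∑ (λ A → ∑ (λ B → term A B S)))
          ≈⟨ sum-cong Ss (λ S → trans (trans (sum-cong Ss (λ A → pull S _)) (pull S _))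
               (*-congˡ (*-congˡ (*-congˡ (sym (sum-*-sum Ss Ss _ _)))))) ⟩
        Λ̄
          ∎
        where
        term : Subset N → Subset N → Subset N → Carrier
        term A B S = ind (S ⊆ᵇ X) * (ind (2 ℕ.≤ᵇ ∣ S ∣) * (P ^ ∣ S ∣ * ((ind (S ⊆ᵇ A) * ν A) * (ind (S ⊆ᵇ B) * ν B))))
        pull : ∀ S (f : Subset N → Carrier) →
               ∑ (λ A → ind (S ⊆ᵇ X) * (ind (2 ℕ.≤ᵇ ∣ S ∣) * (P ^ ∣ S ∣ * f A))) ≈ ind (S ⊆ᵇ X) * (ind (2 ℕ.≤ᵇ ∣ S ∣) * (P ^ ∣ S ∣ * ∑ f))
        pull S f = trans (sum-*ˡ Ss _ _) (*-congˡ (trans (sum-*ˡ Ss _ _) (*-congˡ (sum-*ˡ Ss _ _))))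

      RΓ<1 : R * Γ P < 1#
      RΓ<1 = ≤-<-trans (*-monoʳ-≤ (<⇒≤ 0<R) Γ≤Λ̄) RΛ<1

      0≤Γ : 0# ≤ Γ P
      0≤Γ = sum-nonneg Ss (λ A → sum-nonneg Ss (λ B → *-nonneg (*-nonneg (ν-nonneg A) (ν-nonneg B))
        (*-nonneg (0≤ind (2 ℕ.≤ᵇ ∣ A ∩ B ∣)) (^-nonneg ∣ A ∩ B ∣ 0≤P))))

      pnΓ≤64 : p * ι n * Γ P ≤ ι 64
      pnΓ≤64 = begin
        p * ι n * Γ P  ≤⟨ *-monoˡ-≤ 0≤Γ pn≤64R ⟩
        ι 64 * R * Γ P  ≈⟨ *-assoc _ _ _ ⟩
        ι 64 * (R * Γ P)  ≤⟨ *-monoʳ-≤ (0≤ι 64) (<⇒≤ RΓ<1) ⟩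
        ι 64 * 1#  ≈⟨ *-identityʳ _ ⟩
        ι 64  ∎

      open Core ℝ s ℓ 2≤s 4≤ℓ 𝓜 1≤∣𝓜∣ ρ ρ! hits′ ν ν-nonneg supp ν-total (proj₂ (proj₂ sorted)) p 0<p 32p≤q₀ n 1≤n ∣ρ∣≤n pnΓ≤64
        using (𝔼; Y; νOf; 0≤νOf; νOf-vanishes; degOf; ΛOf; C; transfer; 1≤2𝔼Y)

      0<ηR : 0# < η * R
      0<ηR = 0<-* 0<η 0<R

      0<p/q° : 0# < p / q°
      0<p/q° = 0<-* 0<p (0<⁻¹ 0<q°)

      inverse≤C : (p / q°) ⁻¹ ≤ C
      inverse≤C = begin
        (p / q°) ⁻¹  ≈⟨ ⁻¹-unique 0<p/q° (begin-equality
            p * q° ⁻¹ * (q° * P)  ≈⟨ solve 4 (λ p r q P → p :* r :* (q :* P) := (p :* P) :* (q :* r)) refl p (q° ⁻¹) q° P ⟩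
            (p * P) * (q° * q° ⁻¹)  ≈⟨ *-cong (0<⇒*⁻¹≈1 0<p) (0<⇒*⁻¹≈1 0<q°) ⟩
            1# * 1#  ≈⟨ *-identityˡ 1# ⟩
            1#  ∎) ⟨
        q° * P  ≤⟨ *-monoˡ-≤ 0≤P q°≤2q ⟩
        ι 2 * q * P  ∎

      onEdges≈ : ∀ L A → onEdges (H [ L ]) (νOf L) A ≈ νOf L A
      onEdges≈ L A = trans (*-congʳ (reflexive (≡.cong ind (∈-[] H L A)))) (vanish (E H A) (A ⊆ᵇ L) ≡.refl ≡.refl)
        where
        vanish : ∀ a c → E H A ≡ a → A ⊆ᵇ L ≡ c → ind (a ∧ c) * νOf L A ≈ νOf L A
        vanish true  true  _  _  = *-identityˡ _
        vanish true  false _  eq = trans (zeroˡ _) (sym (νOf-vanishes L A (≡.subst T eq)))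
        vanish false c     eq _  = trans (zeroˡ _) (sym (trans (*-congʳ (ν-edges A (≡.trans (∈-[] H X A) (≡.cong (_∧ (A ⊆ᵇ X)) eq)))) (zeroˡ _)))

      bound : ∀ {L} → ¬ Janson ℝ (H [ L ]) (p / q°) (η * R) → ∑ (νOf L) * ∑ (νOf L) ≤ η * R * ΛOf L
      bound {L} ¬J = begin
        ∑ (νOf L) * ∑ (νOf L)
          ≈⟨ *-cong e≈∑ e≈∑ ⟨
        e (νOf L) * e (νOf L)
          ≈⟨ *-congˡ (*-identityʳ _) ⟨
        e (νOf L) ^ 2
          ≤⟨ x≤z (¬<⇒≥ em (λ Λ< → ¬J (νOf L , (λ A _ → 0≤νOf L A) , Λ<))) ⟩
        η * R * Λ (p / q°) (νOf L)
          ≈⟨ *-congˡ (Λ≈ (H [ L ]) (νOf L) 0<p/q°) ⟩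
        η * R * ∑ (λ S → ind (S ⊆ᵇ L) * (ind (2 ℕ.≤ᵇ ∣ S ∣) * (((p / q°) ⁻¹) ^ ∣ S ∣ * (cd S * cd S))))
          ≤⟨ *-monoʳ-≤ (<⇒≤ 0<ηR) (sum-mono Ss compare) ⟩
        η * R * ΛOf L
          ∎
        where
        open Weights ℝ (H [ L ])
        cd : Subset N → Carrier
        cd = codegree (H [ L ]) (νOf L)
        cd≈ : ∀ S → cd S ≈ degOf L S
        cd≈ S = sum-cong Ss (λ A → *-congˡ (onEdges≈ L A))
        e≈∑ : e (νOf L) ≈ ∑ (νOf L)
        e≈∑ = trans (e≈ (H [ L ]) (νOf L)) (sum-cong Ss (onEdges≈ L))
        x≤z : ∀ {x} → e (νOf L) ^ 2 / (η * R) ≤ x → e (νOf L) ^ 2 ≤ η * R * x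
        x≤z {x} le = begin
          z  ≈⟨ *-identityʳ _ ⟨
          z * 1#  ≈⟨ *-congˡ (0<⇒*⁻¹≈1 0<ηR) ⟨
          z * (η * R * (η * R) ⁻¹) ≈⟨ solve 3 (λ z a i → z :* (a :* i) := a :* (z :* i)) refl z (η * R) ((η * R) ⁻¹) ⟩
          η * R * (z / (η * R))  ≤⟨ *-monoʳ-≤ (<⇒≤ 0<ηR) le ⟩
          η * R * x  ∎
          where
          z : Carrier
          z = e (νOf L) ^ 2
        compare : ∀ S → ind (S ⊆ᵇ L) * (ind (2 ℕ.≤ᵇ ∣ S ∣) * (((p / q°) ⁻¹) ^ ∣ S ∣ * (cd S * cd S))) ≤
                        ind (2 ℕ.≤ᵇ ∣ S ∣) * (C ^ ∣ S ∣ * (degOf L S * degOf L S))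
        compare S = begin
          ind (S ⊆ᵇ L) * (ind (2 ℕ.≤ᵇ ∣ S ∣) * (i ^ ∣ S ∣ * (cd S * cd S)))
            ≤⟨ *-monoˡ-≤ (*-nonneg (0≤ind (2 ℕ.≤ᵇ ∣ S ∣)) (*-nonneg (^-nonneg ∣ S ∣ 0≤i) (0≤x*x (cd S)))) (ind≤1 (S ⊆ᵇ L)) ⟩
          1# * (ind (2 ℕ.≤ᵇ ∣ S ∣) * (i ^ ∣ S ∣ * (cd S * cd S)))
            ≈⟨ *-identityˡ _ ⟩
          ind (2 ℕ.≤ᵇ ∣ S ∣) * (i ^ ∣ S ∣ * (cd S * cd S))
            ≤⟨ *-monoʳ-≤ (0≤ind (2 ℕ.≤ᵇ ∣ S ∣)) (*-monoˡ-≤ (0≤x*x (cd S)) (^-mono-≤ ∣ S ∣ 0≤i inverse≤C)) ⟩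
          ind (2 ℕ.≤ᵇ ∣ S ∣) * (C ^ ∣ S ∣ * (cd S * cd S))
            ≈⟨ *-congˡ (*-congˡ (*-cong (cd≈ S) (cd≈ S))) ⟩
          ind (2 ℕ.≤ᵇ ∣ S ∣) * (C ^ ∣ S ∣ * (degOf L S * degOf L S))
            ∎
          where
          i : Carrier
          i = (p / q°) ⁻¹
          0≤i : 0# ≤ i
          0≤i = ⁻¹-nonneg 0<p/q°

      1≤RΓ : 1# ≤ R * Γ P
      1≤RΓ = begin
        1#  ≈⟨ *-identityˡ 1# ⟨
        1# * 1#  ≤⟨ *-mono-≤ 0≤1 (≤-trans 0≤1 1≤2𝔼Y) 1≤2𝔼Y 1≤2𝔼Y ⟩
        ι 2 * 𝔼 Y * (ι 2 * 𝔼 Y)  ≈⟨ solve 1 (λ y → con (+ 2) :* y :* (con (+ 2) :* y) := con (+ 4) :* (y :* y)) refl (𝔼 Y) ⟩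
        ι 4 * (𝔼 Y * 𝔼 Y)  ≤⟨ *-monoʳ-≤ (0≤ι 4) (transfer (η * R) (<⇒≤ 0<ηR) (All.map bound non)) ⟩
        ι 4 * (η * R * (ι 4 ^ s * Γ P))  ≈⟨ solve 4 (λ e R f g → con (+ 4) :* (e :* R :* (f :* g)) := (f :* e :* con (+ 4)) :* (R :* g)) refl η R (ι 4 ^ s) (Γ P) ⟩
        (ι 4 ^ s * η * ι 4) * (R * Γ P)  ≈⟨ trans (*-congʳ η-eq) (*-identityˡ _) ⟩
        R * Γ P  ∎

-- Greedy covering.

module _ (em : ExcludedMiddle 0ℓ) (ℝ : Reals) where
  open Reals ℝ hiding (zero)
  open OrderedField ℝ

  module Covering {N : ℕ} (B : Subset N)
    (b : Carrier) (0<b : 0# < b) (b≤1 : b ≤ 1#) where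
    open Sums ℝ
    open Hitting ℝ {N}
    open Unfolding ℝ using (length-unique)
    open DecMembership (FinP._≟_ {N}) using (_∈?_)
    open ≤R

    private
      n : ℕ
      n = ∣ B ∣

      Inside : List (Fin N) → Set
      Inside = All (λ v → lookup B v ≡ true)

      misses : List (Fin N) → Subset N → Bool
      misses []      L = true
      misses (w ∷ W) L = not (lookup L w) ∧ misses W L

      avoids≈ : ∀ W L → avoids W L ≈ ind (misses W L)
      avoids≈ []      L = refl
      avoids≈ (w ∷ W) L = trans (*-congˡ (avoids≈ W L)) (sym (ind-∧ (not (lookup L w)) (misses W L)))

      avoids-++ : ∀ U W L → avoids (U ++ W) L ≈ avoids U L * avoids W L
      avoids-++ []      W L = sym (*-identityˡ _)
      avoids-++ (w ∷ U) W L = trans (*-congˡ (avoids-++ U W L)) (sym (*-assoc _ _ _))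

      misses-∈ : ∀ W L {w} → T (misses W L) → w ∈ W → lookup L w ≡ false
      misses-∈ (w ∷ W) L m (here ≡.refl) with lookup L w
      ... | false = ≡.refl
      misses-∈ (w ∷ W) L m (there w∈W) = misses-∈ W L (proj₂ (Equivalence.to (BoolP.T-∧ {not (lookup L w)}) m)) w∈W

      without : List (Fin N) → Subset N
      without W = tabulate (λ v → lookup B v ∧ not (does (v ∈? W)))

      lookup-without : ∀ W v → lookup (without W) v ≡ lookup B v ∧ not (does (v ∈? W))
      lookup-without W v = VecP.lookup∘tabulate _ v

      without-⊆ : ∀ W → T (without W ⊆ᵇ B)
      without-⊆ W = lookup-⊆ᵇ (without W) B (λ v eq → BoolP.∧-conicalˡ (lookup B v) _ (≡.trans (≡.sym (lookup-without W v)) eq))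

      without-∉ : ∀ W {v} → lookup (without W) v ≡ true → ¬ (v ∈ W)
      without-∉ W {v} eq v∈W with v ∈? W | BoolP.∧-conicalʳ (lookup B v) _ (≡.trans (≡.sym (lookup-without W v)) eq)
      ... | yes _  | ()
      ... | no v∉W | _ = v∉W v∈W

      ⊆-without : ∀ W L → T (L ⊆ᵇ B) → T (misses W L) → T (L ⊆ᵇ without W)
      ⊆-without W L L⊆B miss = lookup-⊆ᵇ L (without W) (λ v Lv → ≡.trans (lookup-without W v)
        (≡.cong₂ (λ x y → x ∧ not y) (⊆ᵇ-lookup L B L⊆B v Lv)
          (dec-false (v ∈? W) (λ v∈W → BoolP.not-¬ (misses-∈ W L miss v∈W) Lv))))

      module _ (𝓛 : List (Subset N)) where

        m : Carrier
        m = ι (length 𝓛)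

        Likely : List (Fin N) → Set
        Likely W = Unique W × Inside W × b ^ length W * m ≤ sumOver 𝓛 (avoids W)

        -- Extensions by several vertices at once: being likely need not pass to the sets between
        -- `W` and `U ++ W`, so excluding single vertices would not give the hitting property.
        Extension : List (Fin N) → Set
        Extension W = ∃ λ U → 1 ℕ.≤ length U × Likely (U ++ W)

        maximal : ∀ fuel W → Likely W → n ℕ.< fuel ℕ.+ length W → ∃ λ W → Likely W × ¬ Extension W
        maximal zero W (W! , W⊆B , _) n<W = ⊥-elim (ℕP.<⇒≱ n<W (length-unique B W! W⊆B))
        maximal (suc fuel) W likely n<W with em {Extension W}
        ... | no none                  = W , likely , none
        ... | yes (U , 1≤∣U∣ , likely′) = maximal fuel (U ++ W) likely′
          (ℕP.<-≤-trans n<W (ℕP.≤-trans (ℕP.≤-reflexive (≡.sym (ℕP.+-suc fuel (length W))))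
            (ℕP.+-monoʳ-≤ fuel (≡.subst (suc (length W) ℕ.≤_) (≡.sym (ListP.length-++ U)) (ℕP.+-monoˡ-≤ (length W) 1≤∣U∣)))))

    record Step (𝓛 : List (Subset N)) : Set where
      field
        X       : Subset N
        X⊆B     : T (X ⊆ᵇ B)
        𝓜       : List (Subset N)
        𝓜≥1     : 1 ℕ.≤ length 𝓜
        𝓜⊆𝓛     : ∀ {L} → L ∈ 𝓜 → L ∈ 𝓛
        hits    : Hits 𝓜 (elements X) b
        shrinks : ι (length (filter (λ L → BoolP.T? (not (L ⊆ᵇ X))) 𝓛)) ≤ (1# - b ^ n) * ι (length 𝓛)

    private
      fromMaximal : ∀ 𝓛 → 1 ℕ.≤ length 𝓛 → All (λ L → T (L ⊆ᵇ B)) 𝓛 → ∀ W → Likely 𝓛 W → ¬ Extension 𝓛 W → Step 𝓛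
      fromMaximal 𝓛 𝓛≥1 𝓛⊆B W (W! , W⊆B , likely) maxi = record
        { X = without W ; X⊆B = without-⊆ W ; 𝓜 = 𝓜 ; 𝓜≥1 = 𝓜≥1
        ; 𝓜⊆𝓛 = λ L∈ → proj₁ (∈-filter⁻ (λ L → BoolP.T? (misses W L)) L∈)
        ; hits = hits ; shrinks = shrinks }
        where
        𝓜 : List (Subset N)
        𝓜 = filter (λ L → BoolP.T? (misses W L)) 𝓛

        ∣𝓜∣ : ι (length 𝓜) ≈ sumOver 𝓛 (avoids W)
        ∣𝓜∣ = trans (length-filter (λ L → BoolP.T? (misses W L)) 𝓛) (sum-cong 𝓛 (λ L → sym (avoids≈ W L)))

        𝓜≥1 : 1 ℕ.≤ length 𝓜
        𝓜≥1 = positive (length 𝓜) (<-≤-trans (0<-* (^-pos (length W) 0<b) (0<ι′ 𝓛≥1)) (≤-trans likely (≤-reflexive (sym ∣𝓜∣))))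
          where
          positive : ∀ k → 0# < ι k → 1 ℕ.≤ k
          positive zero    0<0 = ⊥-elim (<-irrefl 0<0)
          positive (suc k) _   = ℕ.s≤s ℕ.z≤n

        -- A conditional probability: `U ++ W` is missed with probability at most b^(|U| + |W|) by
        -- maximality, and `W` with probability at least b^|W|. The vertices of `U` are not in `W`,
        -- so `U ++ W` is a genuine extension.
        hits : Hits 𝓜 (elements (without W)) b
        -- The empty set is excluded from extensions; for it the bound is an equality.
        hits [] _ _ = ≤-reflexive (trans (sum-const 𝓜 1#) (trans (*-identityʳ _) (sym (*-identityˡ _))))
        hits U@(_ ∷ _) U! U⊆X = begin
          sumOver 𝓜 (avoids U)
            ≈⟨ sum-filter (λ L → BoolP.T? (misses W L)) 𝓛 (avoids U) ⟩
          sumOver 𝓛 (λ L → ind (misses W L) * avoids U L)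
            ≈⟨ sum-cong 𝓛 (λ L → trans (*-congʳ (sym (avoids≈ W L))) (trans (*-comm _ _) (sym (avoids-++ U W L)))) ⟩
          sumOver 𝓛 (avoids (U ++ W))
            ≤⟨ unlikely (total _ _) ⟩
          b ^ length (U ++ W) * ι (length 𝓛)
            ≈⟨ trans (*-congʳ (trans (reflexive (≡.cong (b ^_) (ListP.length-++ U))) (^-homo-* b (length U) (length W)))) (*-assoc _ _ _) ⟩
          b ^ length U * (b ^ length W * ι (length 𝓛))
            ≤⟨ *-monoʳ-≤ (^-nonneg (length U) (<⇒≤ 0<b)) (≤-trans likely (≤-reflexive (sym ∣𝓜∣))) ⟩
          b ^ length U * ι (length 𝓜)
            ∎
          where
          in-without : ∀ {v} → v ∈ U → lookup (without W) v ≡ true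
          in-without v∈U = elements-∈ (without W) (All.lookup U⊆X v∈U)
          unlikely : sumOver 𝓛 (avoids (U ++ W)) ≤ b ^ length (U ++ W) * ι (length 𝓛) ⊎ b ^ length (U ++ W) * ι (length 𝓛) ≤ sumOver 𝓛 (avoids (U ++ W)) →
                     sumOver 𝓛 (avoids (U ++ W)) ≤ b ^ length (U ++ W) * ι (length 𝓛)
          unlikely (inj₁ le) = le
          unlikely (inj₂ ge) = ⊥-elim (maxi (U , ℕ.s≤s ℕ.z≤n ,
            UniqueP.++⁺ U! W! (λ (v∈U , v∈W) → without-∉ W (in-without v∈U) v∈W) ,
            AllP.++⁺ (All.tabulate (λ {v} v∈U → ⊆ᵇ-lookup (without W) B (without-⊆ W) v (in-without v∈U))) W⊆B , ge))

        b^n≤ : b ^ n ≤ b ^ length W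
        b^n≤ = ^-antitone (<⇒≤ 0<b) b≤1 (length-unique B W! W⊆B)

        -- The sets that miss `W` lie in its complement, and their proportion is at least b^|W|,
        -- hence at least b^n.
        shrinks : ι (length (filter (λ L → BoolP.T? (not (L ⊆ᵇ without W))) 𝓛)) ≤ (1# - b ^ n) * ι (length 𝓛)
        shrinks = begin
          ι (length (filter (λ L → BoolP.T? (not (L ⊆ᵇ without W))) 𝓛))
            ≈⟨ length-filter (λ L → BoolP.T? (not (L ⊆ᵇ without W))) 𝓛 ⟩
          sumOver 𝓛 (λ L → ind (not (L ⊆ᵇ without W)))
            ≤⟨ x+y≤z⇒x≤z-y (begin
                 sumOver 𝓛 (λ L → ind (not (L ⊆ᵇ without W))) + b ^ n * ι (length 𝓛)
                   ≤⟨ +-monoʳ-≤ _ (≤-trans (*-monoˡ-≤ (0≤ι (length 𝓛)) b^n≤) likely) ⟩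
                 sumOver 𝓛 (λ L → ind (not (L ⊆ᵇ without W))) + sumOver 𝓛 (avoids W)
                   ≈⟨ sum-+ 𝓛 _ _ ⟨
                 sumOver 𝓛 (λ L → ind (not (L ⊆ᵇ without W)) + avoids W L)
                   ≤⟨ sum-mono-All (All.map (λ {L} L⊆B → disjoint L L⊆B) 𝓛⊆B) ⟩
                 sumOver 𝓛 (λ _ → 1#)
                   ≈⟨ sum-const 𝓛 1# ⟩
                 ι (length 𝓛) * 1#
                   ∎) ⟩
          ι (length 𝓛) * 1# - b ^ n * ι (length 𝓛)
            ≈⟨ solve 2 (λ l b → l :* con (+ 1) :- b :* l := (con (+ 1) :- b) :* l) refl (ι (length 𝓛)) (b ^ n) ⟩
          (1# - b ^ n) * ι (length 𝓛)
            ∎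
          where
          disjoint : ∀ L → T (L ⊆ᵇ B) → ind (not (L ⊆ᵇ without W)) + avoids W L ≤ 1#
          disjoint L L⊆B = ≤-trans (+-monoʳ-≤ _ (≤-reflexive (avoids≈ W L))) (exclusive (L ⊆ᵇ without W) (misses W L) (⊆-without W L L⊆B))
            where
            exclusive : ∀ x y → (T y → T x) → ind (not x) + ind y ≤ 1#
            exclusive true  y     _ = ≤-trans (≤-reflexive (+-identityˡ _)) (ind≤1 y)
            exclusive false false _ = ≤-reflexive (+-identityʳ _)
            exclusive false true  f = ⊥-elim (f tt)

    abstract
      step : ∀ 𝓛 → 1 ℕ.≤ length 𝓛 → All (λ L → T (L ⊆ᵇ B)) 𝓛 → Step 𝓛
      step 𝓛 𝓛≥1 𝓛⊆B = go (maximal 𝓛 (suc n) []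
        ([] , [] , ≤-reflexive (trans (*-identityˡ _) (sym (trans (sum-const 𝓛 1#) (*-identityʳ _))))) (ℕP.m≤m+n (suc n) 0))
        where
        go : (∃ λ W → Likely 𝓛 W × ¬ Extension 𝓛 W) → Step 𝓛
        go (W , likely , maxi) = fromMaximal 𝓛 𝓛≥1 𝓛⊆B W likely maxi

    module _ (Accept : Subset N → Set) (Rejected : Subset N → Set)
      (accept : ∀ X → T (X ⊆ᵇ B) → ∀ 𝓜 → 1 ℕ.≤ length 𝓜 → All Rejected 𝓜 → Hits 𝓜 (elements X) b → Accept X) where

      private
        β : Carrier
        β = b ^ n

        0≤1-β : 0# ≤ 1# - β
        0≤1-β = x≤y⇒0≤y-x (^-≤1 n (<⇒≤ 0<b) b≤1)

      record Rounds (i : ℕ) (𝓛 : List (Subset N)) : Set where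
        field
          Xs        : List (Subset N)
          Xs-length : length Xs ℕ.≤ i
          Xs-accept : All (λ X → T (X ⊆ᵇ B) × Accept X) Xs
          rest      : List (Subset N)
          rest-size : ι (length rest) ≤ (1# - β) ^ i * ι (length 𝓛)
          covers    : ∀ {L} → L ∈ 𝓛 → Any (λ X → T (L ⊆ᵇ X)) Xs ⊎ L ∈ rest

      private
        remaining : Subset N → List (Subset N) → List (Subset N)
        remaining X = filter (λ L → BoolP.T? (not (L ⊆ᵇ X)))

        prepend : ∀ {i 𝓛} (st : Step 𝓛) → All Rejected 𝓛 → Rounds i (remaining (Step.X st) 𝓛) → Rounds (suc i) 𝓛
        prepend {i} {𝓛} st rej rs = record
          { Xs        = X ∷ Xs
          ; Xs-length = ℕ.s≤s Xs-length
          ; Xs-accept = (X⊆B , accept X X⊆B 𝓜 𝓜≥1 (All.tabulate (λ L∈ → All.lookup rej (𝓜⊆𝓛 L∈))) hits) ∷ Xs-accept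
          ; rest      = rest
          ; rest-size = begin
              ι (length rest)  ≤⟨ rest-size ⟩
              (1# - β) ^ i * ι (length (remaining X 𝓛))  ≤⟨ *-monoʳ-≤ (^-nonneg i 0≤1-β) shrinks ⟩
              (1# - β) ^ i * ((1# - β) * ι (length 𝓛))  ≈⟨ solve 3 (λ x y z → x :* (y :* z) := y :* x :* z) refl ((1# - β) ^ i) (1# - β) (ι (length 𝓛)) ⟩
              (1# - β) ^ suc i * ι (length 𝓛)  ∎
          ; covers    = cov
          }
          where
          open Step st
          open Rounds rs

          cov : ∀ {L} → L ∈ 𝓛 → Any (λ X → T (L ⊆ᵇ X)) (X ∷ Xs) ⊎ L ∈ rest
          cov {L} L∈𝓛 with L ⊆ᵇ X in eq
          ... | true  = inj₁ (here (≡.subst T (≡.sym eq) tt))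
          ... | false with covers (∈-filter⁺ (λ L → BoolP.T? (not (L ⊆ᵇ X))) L∈𝓛 (≡.subst (λ c → T (not c)) (≡.sym eq) tt))
          ...   | inj₁ any = inj₁ (there any)
          ...   | inj₂ L∈r = inj₂ L∈r

      rounds : ∀ i 𝓛 → All (λ L → T (L ⊆ᵇ B)) 𝓛 → All Rejected 𝓛 → Rounds i 𝓛
      rounds zero 𝓛 𝓛⊆B rej = record
        { Xs = [] ; Xs-length = ℕ.z≤n ; Xs-accept = [] ; rest = 𝓛 ; rest-size = ≤-reflexive (sym (*-identityˡ _)) ; covers = inj₂ }
      rounds (suc i) [] 𝓛⊆B rej = record
        { Xs = [] ; Xs-length = ℕ.z≤n ; Xs-accept = [] ; rest = [] ; rest-size = ≤-reflexive (sym (zeroʳ _)) ; covers = inj₂ }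
      rounds (suc i) 𝓛@(_ ∷ _) 𝓛⊆B rej = prepend st rej
        (rounds i (remaining (Step.X st) 𝓛) (AllP.filter⁺ (λ L → BoolP.T? (not (L ⊆ᵇ Step.X st))) 𝓛⊆B) (AllP.filter⁺ (λ L → BoolP.T? (not (L ⊆ᵇ Step.X st))) rej))
        where
        st : Step 𝓛
        st = step 𝓛 (ℕ.s≤s ℕ.z≤n) 𝓛⊆B

-- Families and their size from lists of sets.

infix 7 _≡ᵇ_

_≡ᵇ_ : ∀ {N} → Subset N → Subset N → Bool
[]  ≡ᵇ []            = true
(inside ∷ A)  ≡ᵇ (inside ∷ B)  = A ≡ᵇ B
(outside ∷ A) ≡ᵇ (outside ∷ B) = A ≡ᵇ B
(inside ∷ A)  ≡ᵇ (outside ∷ B) = false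
(outside ∷ A) ≡ᵇ (inside ∷ B)  = false

≡ᵇ⇒≡ : ∀ {N} (A B : Subset N) → T (A ≡ᵇ B) → A ≡ B
≡ᵇ⇒≡ []            []            _ = ≡.refl
≡ᵇ⇒≡ (inside ∷ A)  (inside ∷ B)  p = ≡.cong (inside ∷_) (≡ᵇ⇒≡ A B p)
≡ᵇ⇒≡ (outside ∷ A) (outside ∷ B) p = ≡.cong (outside ∷_) (≡ᵇ⇒≡ A B p)

≡ᵇ-refl : ∀ {N} (A : Subset N) → T (A ≡ᵇ A)
≡ᵇ-refl []            = tt
≡ᵇ-refl (inside ∷ A)  = ≡ᵇ-refl A
≡ᵇ-refl (outside ∷ A) = ≡ᵇ-refl A

family : ∀ {N} → List (Subset N) → Family N
family []       A = false
family (X ∷ Xs) A = A ≡ᵇ X ∨ family Xs A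

∈-family⁻ : ∀ {N} {P : Subset N → Set} Xs → (∀ {X} → Any (X ≡_) Xs → P X) → ∀ {A} → A ∈ᶠ family Xs → P A
∈-family⁻ (X ∷ Xs) f {A} A∈ with Equivalence.to (BoolP.T-∨ {A ≡ᵇ X}) A∈
... | inj₁ A≡X = f (here (≡ᵇ⇒≡ A X A≡X))
... | inj₂ A∈′ = ∈-family⁻ Xs (f ∘ there) A∈′

∈-family⁺ : ∀ {N} {P : Subset N → Set} {Xs} → Any P Xs → ∃ λ X → X ∈ᶠ family Xs × P X
∈-family⁺ {Xs = X ∷ Xs} (here pX) = X , Equivalence.from (BoolP.T-∨ {X ≡ᵇ X}) (inj₁ (≡ᵇ-refl X)) , pX
∈-family⁺ {Xs = X ∷ Xs} (there any) with ∈-family⁺ any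
... | Y , Y∈ , pY = Y , Equivalence.from (BoolP.T-∨ {Y ≡ᵇ X}) (inj₂ Y∈) , pY

subset-of-size : ∀ {N} k (A : Subset N) → k ℕ.≤ ∣ A ∣ → ∃ λ S → T (S ⊆ᵇ A) × ∣ S ∣ ≡ k
subset-of-size zero    []            _         = [] , tt , ≡.refl
subset-of-size k       (outside ∷ A) k≤        with subset-of-size k A k≤
... | S , S⊆A , ∣S∣ = outside ∷ S , S⊆A , ∣S∣
subset-of-size zero    (inside ∷ A)  _         with subset-of-size zero A ℕ.z≤n
... | S , S⊆A , ∣S∣ = outside ∷ S , S⊆A , ∣S∣
subset-of-size (suc k) (inside ∷ A)  (ℕ.s≤s k≤) with subset-of-size k A k≤
... | S , S⊆A , ∣S∣ = inside ∷ S , S⊆A , ≡.cong suc ∣S∣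

module FamilySize (ℝ : Reals) where
  open Reals ℝ hiding (zero)
  open OrderedField ℝ
  open Sums ℝ
  open ≤R

  private
    sum-≡ᵇ : ∀ {N} (X : Subset N) → sumOver (subsets N) (λ A → ind (A ≡ᵇ X)) ≈ 1#
    sum-≡ᵇ [] = +-identityʳ 1#
    sum-≡ᵇ {suc N} (x ∷ X) = trans (sum-++ (map (outside ∷_) Ss) (map (inside ∷_) Ss) f)
      (trans (+-cong (sum-map (outside ∷_) Ss f) (sum-map (inside ∷_) Ss f)) (last x))
      where
      Ss = subsets N
      f : Subset (suc N) → Carrier
      f A = ind (A ≡ᵇ (x ∷ X))
      last : ∀ x → sumOver Ss (λ A → ind ((outside ∷ A) ≡ᵇ (x ∷ X))) + sumOver Ss (λ A → ind ((inside ∷ A) ≡ᵇ (x ∷ X))) ≈ 1#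
      last outside = trans (+-cong (sum-≡ᵇ X) (sum-0 Ss)) (+-identityʳ 1#)
      last inside  = trans (+-cong (sum-0 Ss) (sum-≡ᵇ X)) (+-identityˡ 1#)

  -- Repetitions in the list are counted once in the family, so a union bound over the entries is
  -- enough.
  card-family : ∀ {N} (Xs : List (Subset N)) → ι (card (family Xs)) ≤ ι (length Xs)
  card-family {N} Xs = ≤-trans (≤-reflexive (length-filter (λ A → BoolP.T? (family Xs A)) (subsets N))) (go Xs)
    where
    ind-∨ : ∀ a c → ind (a ∨ c) ≤ ind a + ind c
    ind-∨ true  c = x≤x+y (0≤ind c)
    ind-∨ false c = ≤-reflexive (sym (+-identityˡ _))
    go : ∀ Xs → sumOver (subsets N) (λ A → ind (family Xs A)) ≤ ι (length Xs)
    go []       = ≤-reflexive (sum-0 (subsets N))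
    go (X ∷ Xs) = begin
      sumOver (subsets N) (λ A → ind (A ≡ᵇ X ∨ family Xs A))  ≤⟨ sum-mono (subsets N) (λ A → ind-∨ (A ≡ᵇ X) (family Xs A)) ⟩
      sumOver (subsets N) (λ A → ind (A ≡ᵇ X) + ind (family Xs A)) ≈⟨ sum-+ (subsets N) _ _ ⟩
      sumOver (subsets N) (λ A → ind (A ≡ᵇ X)) + sumOver (subsets N) (λ A → ind (family Xs A)) ≤⟨ +-mono-≤ (≤-reflexive (sum-≡ᵇ X)) (go Xs) ⟩
      1# + ι (length Xs)  ≈⟨ ι-suc (length Xs) ⟨
      ι (suc (length Xs))  ∎

-- Natural powers below real powers.

module RealPower (ℝ : Reals) where
  open Reals ℝ hiding (zero)
  open OrderedField ℝ
  open ≤R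

  -- `a ^ k` is one of the rational powers in the supremum. The bound `ι m` on the exponent makes
  -- this set bounded, so that its supremum is meaningful.
  ^≤^ℝ : ∀ {a x} k m → 1# ≤ a → ι k ≤ x → x ≤ ι m → a ^ k ≤ a ^ℝ x
  ^≤^ℝ {a} {x} k m 1≤a k≤x x≤m = sup-upper Power (a ^ k , power) (a ^ m , bounded) (a ^ k) power
    where
    Power : Carrier → Set
    Power z = ∃ λ r → fromℚᵘ r ≤ x × IsRationalPower a r z

    0<a : 0# < a
    0<a = <-≤-trans 0<1 1≤a

    power : Power (a ^ k)
    power = mkℚᵘ (+ k) 0 , ≤-trans (x/y≤z 0<f1 (≤-reflexive (trans (fromℕ≈ι k) (sym (trans (*-congˡ (fromℕ≈ι 1)) (*-identityʳ _)))))) k≤x ,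
      ^-nonneg k (<⇒≤ 0<a) , *-identityʳ _
      where
      0<f1 : 0# < fromℕ 1
      0<f1 = <-≤-trans 0<1 (≤-reflexive (sym (fromℕ≈ι 1)))

    -- Raising to the power `suc d` clears the denominator and leaves integral exponents; a negative
    -- exponent gives at most 1.
    bounded : ∀ z → Power z → z ≤ a ^ m
    bounded z (mkℚᵘ num d , r≤x , _ , z^≈) = ^-cancel-≤ d (^-pos m 0<a) (begin
      z ^ suc d  ≈⟨ z^≈ ⟩
      a ^ℤ num  ≤⟨ go num num≤ ⟩
      a ^ (m ℕ.* suc d)  ≈⟨ ^-assocʳ a m (suc d) ⟨
      (a ^ m) ^ suc d  ∎)
      where
      num≤ : fromℤ num ≤ ι (m ℕ.* suc d)
      num≤ = begin
        fromℤ num  ≤⟨ x/y≤z⇒ ⟩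
        ι m * fromℕ (suc d)  ≈⟨ *-congˡ (fromℕ≈ι (suc d)) ⟩
        ι m * ι (suc d)  ≈⟨ ι-* m (suc d) ⟨
        ι (m ℕ.* suc d)  ∎
        where
        0<D : 0# < fromℕ (suc d)
        0<D = <-≤-trans (0<ι d) (≤-reflexive (sym (fromℕ≈ι (suc d))))
        x/y≤z⇒ : fromℤ num ≤ ι m * fromℕ (suc d)
        x/y≤z⇒ = begin
          fromℤ num  ≈⟨ *-identityʳ _ ⟨
          fromℤ num * 1#  ≈⟨ *-congˡ (⁻¹-inverseˡ 0<D) ⟨
          fromℤ num * (fromℕ (suc d) ⁻¹ * fromℕ (suc d))  ≈⟨ *-assoc _ _ _ ⟨
          fromℤ num / fromℕ (suc d) * fromℕ (suc d)  ≤⟨ *-monoˡ-≤ (<⇒≤ 0<D) (≤-trans r≤x x≤m) ⟩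
          ι m * fromℕ (suc d)  ∎
      go : ∀ num → fromℤ num ≤ ι (m ℕ.* suc d) → a ^ℤ num ≤ a ^ (m ℕ.* suc d)
      go (+ j)    le = ^-monoʳ-≤ {m = j} {m ℕ.* suc d} 1≤a (ι-cancel-≤ {j} {m ℕ.* suc d} (≤-trans (≤-reflexive (sym (fromℕ≈ι j))) le))
      go -[1+ j ] le = begin
        (a ^ suc j) ⁻¹  ≈⟨ *-identityˡ _ ⟨
        1# / a ^ suc j  ≤⟨ x/y≤z (^-pos (suc j) 0<a) (≤-trans (1≤^ (suc j) 1≤a) (≤-reflexive (sym (*-identityˡ _)))) ⟩
        1#  ≤⟨ 1≤^ (m ℕ.* suc d) 1≤a ⟩
        a ^ (m ℕ.* suc d)  ∎

-- A lower bound for pn from a Janson witness.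

module _ (ℝ : Reals) where
  open Reals ℝ hiding (zero)
  open OrderedField ℝ

  module VertexCount {N : ℕ} (G : Hypergraph N) (s : ℕ) (2≤s : 2 ℕ.≤ s) (uniform : Uniform s G)
    (p R : Carrier) (0<p : 0# < p) (0<R : 0# < R) (n : ℕ) (1≤n : 1 ℕ.≤ n) (∣V∣≡n : ∣ V G ∣ ≡ n) (pn≤64R : p * ι n ≤ ι 64 * R) where
    open Sums ℝ
    open Unfolding ℝ
    open ≤R

    -- Cauchy–Schwarz over the at most 8n² pairs of vertices bounds Λ_p(ν) below by 1/(8p²n²).
    1≤512pn : Measure G p R → 1# ≤ ι 512 * (p * ι n)
    1≤512pn measure = begin
      1#
        ≈⟨ *-identityˡ 1# ⟨
      1# * 1#
        ≤⟨ *-mono-≤ 0≤1 (≤-trans 0≤1 1≤sum) 1≤sum 1≤sum ⟩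
      sumOver Ts cod * sumOver Ts cod
        ≤⟨ sum-square Ts cod ⟩
      ι (length Ts) * sumOver Ts (λ S → cod S * cod S)
        ≤⟨ *-mono-≤ (0≤ι (length Ts)) (*-nonneg (0≤x*x p) 0≤Λ) few squares ⟩
      ι 8 * (ι n * ι n) * (p * p * Λ)
        ≈⟨ solve 3 (λ n p l → con (+ 8) :* (n :* n) :* (p :* p :* l) := con (+ 8) :* (p :* n) :* (p :* n :* l)) refl (ι n) p Λ ⟩
      ι 8 * (p * ι n) * (p * ι n * Λ)
        ≤⟨ *-monoʳ-≤ (*-nonneg (0≤ι 8) 0≤pn) (begin
             p * ι n * Λ  ≤⟨ *-monoˡ-≤ 0≤Λ pn≤64R ⟩
             ι 64 * R * Λ  ≈⟨ *-assoc _ _ _ ⟩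
             ι 64 * (R * Λ)  ≤⟨ *-monoʳ-≤ (0≤ι 64) (<⇒≤ RΛ<1) ⟩
             ι 64 * 1#  ∎) ⟩
      ι 8 * (p * ι n) * (ι 64 * 1#)
        ≈⟨ solve 1 (λ x → con (+ 8) :* x :* (con (+ 64) :* con (+ 1)) := con (+ 512) :* x) refl (p * ι n) ⟩
      ι 512 * (p * ι n)
        ∎
      where
      open Measure measure
      Ss = subsets N

      cod : Subset N → Carrier
      cod S = sumOver Ss (λ A → ind (S ⊆ᵇ A) * ν A)

      Λ : Carrier
      Λ = sumOver Ss (λ S → ind (S ⊆ᵇ V G) * (ind (2 ℕ.≤ᵇ ∣ S ∣) * ((p ⁻¹) ^ ∣ S ∣ * (cod S * cod S))))

      0≤P : 0# ≤ p ⁻¹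
      0≤P = ⁻¹-nonneg 0<p

      0≤Λ : 0# ≤ Λ
      0≤Λ = sum-nonneg Ss (λ S → *-nonneg (0≤ind (S ⊆ᵇ V G)) (*-nonneg (0≤ind (2 ℕ.≤ᵇ ∣ S ∣)) (*-nonneg (^-nonneg ∣ S ∣ 0≤P) (0≤x*x (cod S)))))

      0≤pn : 0# ≤ p * ι n
      0≤pn = *-nonneg (<⇒≤ 0<p) (0≤ι n)

      isPair : Subset N → Bool
      isPair S = (∣ S ∣ ℕ.≡ᵇ 2) ∧ (S ⊆ᵇ V G)

      isPair⁻ : ∀ S → T (isPair S) → ∣ S ∣ ≡ 2 × T (S ⊆ᵇ V G)
      isPair⁻ S pr with Equivalence.to (BoolP.T-∧ {∣ S ∣ ℕ.≡ᵇ 2}) pr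
      ... | size , S⊆V = ℕP.≡ᵇ⇒≡ ∣ S ∣ 2 size , S⊆V

      Ts : List (Subset N)
      Ts = filter (λ S → BoolP.T? (isPair S)) Ss

      ind-true : ∀ {c} → T c → ind c ≈ 1#
      ind-true {true} _ = refl

      by-pair : ∀ S {x} → (T (isPair S) → 1# ≤ x) → 0# ≤ x → ind (isPair S) ≤ x
      by-pair S yes′ no′ with isPair S
      ... | true  = yes′ tt
      ... | false = no′

      -- An edge has at least two vertices and hence contains a pair, so the total mass 1 is counted
      -- at least once.
      1≤sum : 1# ≤ sumOver Ts cod
      1≤sum = begin
        1#
          ≈⟨ ν-total ⟨
        sumOver Ss ν
          ≤⟨ sum-mono Ss contains ⟩
        sumOver Ss (λ A → sumOver Ss (λ S → ind (isPair S) * (ind (S ⊆ᵇ A) * ν A)))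
          ≈⟨ sum-swap Ss Ss _ ⟩
        sumOver Ss (λ S → sumOver Ss (λ A → ind (isPair S) * (ind (S ⊆ᵇ A) * ν A)))
          ≈⟨ sum-cong Ss (λ S → sum-*ˡ Ss (ind (isPair S)) _) ⟩
        sumOver Ss (λ S → ind (isPair S) * cod S)
          ≈⟨ sum-filter (λ S → BoolP.T? (isPair S)) Ss cod ⟨
        sumOver Ts cod
          ∎
        where
        0≤term : ∀ A S → 0# ≤ ind (isPair S) * (ind (S ⊆ᵇ A) * ν A)
        0≤term A S = *-nonneg (0≤ind (isPair S)) (*-nonneg (0≤ind (S ⊆ᵇ A)) (ν-nonneg A))
        contains : ∀ A → ν A ≤ sumOver Ss (λ S → ind (isPair S) * (ind (S ⊆ᵇ A) * ν A))
        contains A with E G A in EA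
        ... | false = ≤-trans (≤-reflexive (ν-edges A EA)) (sum-nonneg Ss (0≤term A))
        ... | true with subset-of-size 2 A (≡.subst (2 ℕ.≤_) (≡.sym (uniform A (≡.subst T (≡.sym EA) tt))) 2≤s)
        ...   | S , S⊆A , ∣S∣≡2 = begin
          ν A
            ≈⟨ solve 1 (λ x → x := con (+ 1) :* (con (+ 1) :* x)) refl (ν A) ⟩
          1# * (1# * ν A)
            ≈⟨ *-cong (ind-true pr) (*-congʳ (ind-true S⊆A)) ⟨
          ind (isPair S) * (ind (S ⊆ᵇ A) * ν A)
            ≤⟨ sum-term (∈-subsets S) (0≤term A) ⟩
          sumOver Ss (λ S → ind (isPair S) * (ind (S ⊆ᵇ A) * ν A))
            ∎
          where
          A⊆V : T (A ⊆ᵇ V G)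
          A⊆V = ⊆⇒⊆ᵇ A (V G) (E⊆V G (≡.subst T (≡.sym EA) tt))
          pr : T (isPair S)
          pr = Equivalence.from (BoolP.T-∧ {∣ S ∣ ℕ.≡ᵇ 2}) (ℕP.≡⇒≡ᵇ ∣ S ∣ 2 ∣S∣≡2 ,
            lookup-⊆ᵇ S (V G) (λ v Sv → ⊆ᵇ-lookup A (V G) A⊆V v (⊆ᵇ-lookup S A S⊆A v Sv)))

      squares : sumOver Ts (λ S → cod S * cod S) ≤ p * p * Λ
      squares = begin
        sumOver Ts (λ S → cod S * cod S)
          ≈⟨ sum-filter (λ S → BoolP.T? (isPair S)) Ss _ ⟩
        sumOver Ss (λ S → ind (isPair S) * (cod S * cod S))
          ≤⟨ sum-mono Ss (λ S → ≤-trans (*-monoˡ-≤ (0≤x*x (cod S)) (by-pair S (bound S) (0≤w S)))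
               (≤-reflexive (solve 5 (λ x a b c d → x :* (a :* (b :* c)) :* d := x :* (a :* (b :* (c :* d)))) refl (p * p) (ind (S ⊆ᵇ V G)) (ind (2 ℕ.≤ᵇ ∣ S ∣)) ((p ⁻¹) ^ ∣ S ∣) (cod S * cod S)))) ⟩
        sumOver Ss (λ S → p * p * (ind (S ⊆ᵇ V G) * (ind (2 ℕ.≤ᵇ ∣ S ∣) * ((p ⁻¹) ^ ∣ S ∣ * (cod S * cod S)))))
          ≈⟨ sum-*ˡ Ss (p * p) _ ⟩
        p * p * Λ
          ∎
        where
        0≤w : ∀ S → 0# ≤ p * p * (ind (S ⊆ᵇ V G) * (ind (2 ℕ.≤ᵇ ∣ S ∣) * (p ⁻¹) ^ ∣ S ∣))
        0≤w S = *-nonneg (0≤x*x p) (*-nonneg (0≤ind (S ⊆ᵇ V G)) (*-nonneg (0≤ind (2 ℕ.≤ᵇ ∣ S ∣)) (^-nonneg ∣ S ∣ 0≤P)))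
        bound : ∀ S → T (isPair S) → 1# ≤ p * p * (ind (S ⊆ᵇ V G) * (ind (2 ℕ.≤ᵇ ∣ S ∣) * (p ⁻¹) ^ ∣ S ∣))
        bound S pr with isPair⁻ S pr
        ... | ∣S∣≡2 , S⊆V rewrite ∣S∣≡2 = ≤-reflexive (sym (begin-equality
          p * p * (ind (S ⊆ᵇ V G) * (1# * (p ⁻¹ * (p ⁻¹ * 1#))))
            ≈⟨ *-congˡ (*-congʳ (ind-true S⊆V)) ⟩
          p * p * (1# * (1# * (p ⁻¹ * (p ⁻¹ * 1#))))
            ≈⟨ solve 2 (λ p i → p :* p :* (con (+ 1) :* (con (+ 1) :* (i :* (i :* con (+ 1))))) := (p :* i) :* (p :* i)) refl p (p ⁻¹) ⟩
          (p * p ⁻¹) * (p * p ⁻¹)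
            ≈⟨ *-cong (0<⇒*⁻¹≈1 0<p) (0<⇒*⁻¹≈1 0<p) ⟩
          1# * 1#
            ≈⟨ *-identityˡ 1# ⟩
          1# ∎))

      -- Counts pairs without binomial coefficients: if each vertex has weight c = 1/(2n), all
      -- vertex sets together weigh (1 + c)^n ≤ 2, and a pair weighs 1/(4n²).
      few : ι (length Ts) ≤ ι 8 * (ι n * ι n)
      few = begin
        ι (length Ts)
          ≈⟨ length-filter (λ S → BoolP.T? (isPair S)) Ss ⟩
        sumOver Ss (λ S → ind (isPair S))
          ≤⟨ sum-mono Ss (λ S → by-pair S (bound S) (0≤w S)) ⟩
        sumOver Ss (λ S → M * M * (ind (S ⊆ᵇ V G) * c ^ ∣ S ∣))
          ≈⟨ trans (sum-*ˡ Ss (M * M) _) (*-congˡ (trans (sum-subsets-⊆ (V G) c) (reflexive (≡.cong ((1# + c) ^_) ∣V∣≡n)))) ⟩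
        M * M * (1# + c) ^ n
          ≤⟨ *-monoʳ-≤ (0≤x*x M) power≤2 ⟩
        M * M * ι 2
          ≈⟨ solve 1 (λ n → con (+ 2) :* n :* (con (+ 2) :* n) :* con (+ 2) := con (+ 8) :* (n :* n)) refl (ι n) ⟩
        ι 8 * (ι n * ι n)
          ∎
        where
        M c : Carrier
        M = ι 2 * ι n
        c = M ⁻¹
        0<M : 0# < M
        0<M = 0<-* (0<ι 1) (0<ι′ 1≤n)
        0≤c : 0# ≤ c
        0≤c = ⁻¹-nonneg 0<M
        0≤w : ∀ S → 0# ≤ M * M * (ind (S ⊆ᵇ V G) * c ^ ∣ S ∣)
        0≤w S = *-nonneg (0≤x*x M) (*-nonneg (0≤ind (S ⊆ᵇ V G)) (^-nonneg ∣ S ∣ 0≤c))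
        bound : ∀ S → T (isPair S) → 1# ≤ M * M * (ind (S ⊆ᵇ V G) * c ^ ∣ S ∣)
        bound S pr with isPair⁻ S pr
        ... | ∣S∣≡2 , S⊆V rewrite ∣S∣≡2 = ≤-reflexive (sym (begin-equality
          M * M * (ind (S ⊆ᵇ V G) * (c * (c * 1#)))
            ≈⟨ *-congˡ (*-congʳ (ind-true S⊆V)) ⟩
          M * M * (1# * (c * (c * 1#)))
            ≈⟨ solve 2 (λ p i → p :* p :* (con (+ 1) :* (i :* (i :* con (+ 1)))) := (p :* i) :* (p :* i)) refl M c ⟩
          (M * c) * (M * c)
            ≈⟨ *-cong (0<⇒*⁻¹≈1 0<M) (0<⇒*⁻¹≈1 0<M) ⟩
          1# * 1#
            ≈⟨ *-identityˡ 1# ⟩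
          1# ∎))
        2nc≈1 : ι 2 * (ι n * c) ≈ 1#
        2nc≈1 = trans (sym (*-assoc _ _ _)) (0<⇒*⁻¹≈1 0<M)
        c≤1 : c ≤ 1#
        c≤1 = *-cancelˡ-≤ 0<M (begin
          M * c  ≈⟨ 0<⇒*⁻¹≈1 0<M ⟩
          1#  ≤⟨ ι-mono {1} (ℕP.*-mono-≤ {1} {2} (ℕ.s≤s ℕ.z≤n) 1≤n) ⟩
          ι (2 ℕ.* n)  ≈⟨ ι-* 2 n ⟩
          M  ≈⟨ *-identityʳ M ⟨
          M * 1#  ∎)
        -- Bernoulli gives (1 - c)^n ≥ 1/2, and (1 + c)^n (1 - c)^n is at most 1.
        power≤2 : (1# + c) ^ n ≤ ι 2
        power≤2 = begin
          (1# + c) ^ n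
            ≈⟨ solve 2 (λ x y → x := x :* (con (+ 2) :- con (+ 1))) refl ((1# + c) ^ n) c ⟩
          (1# + c) ^ n * (ι 2 - 1#)
            ≈⟨ *-congˡ (trans (+-congˡ (-‿cong (sym 2nc≈1))) (solve 1 (λ x → con (+ 2) :- con (+ 2) :* x := con (+ 2) :* (con (+ 1) :- x)) refl (ι n * c))) ⟩
          (1# + c) ^ n * (ι 2 * (1# - ι n * c))
            ≤⟨ *-monoʳ-≤ (^-nonneg n (0≤-+ 0≤1 0≤c)) (*-monoʳ-≤ (0≤ι 2) (bernoulli⁻ n 0≤c c≤1)) ⟩
          (1# + c) ^ n * (ι 2 * (1# - c) ^ n)
            ≈⟨ trans (solve 3 (λ x y z → x :* (y :* z) := y :* (x :* z)) refl ((1# + c) ^ n) (ι 2) ((1# - c) ^ n)) (*-congˡ (sym (^-distrib-* (1# + c) (1# - c) n))) ⟩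
          ι 2 * ((1# + c) * (1# - c)) ^ n
            ≤⟨ *-monoʳ-≤ (0≤ι 2) (^-≤1 n (*-nonneg (0≤-+ 0≤1 0≤c) (x≤y⇒0≤y-x c≤1)) (begin
                 (1# + c) * (1# - c)  ≈⟨ solve 1 (λ c → (con (+ 1) :+ c) :* (con (+ 1) :- c) := con (+ 1) :- c :* c) refl c ⟩
                 1# - c * c  ≤⟨ x-y≤x (0≤x*x c) ⟩
                 1#  ∎)) ⟩
          ι 2 * 1#
            ≈⟨ *-identityʳ _ ⟩
          ι 2
            ∎

-- The number of containers.

n<2^n : ∀ n → n ℕ.< 2 ℕ.^ n
n<2^n zero    = ℕ.s≤s ℕ.z≤n
n<2^n (suc n) = ℕP.≤-trans (ℕP.+-mono-≤ (ℕP.m^n>0 2 n) (n<2^n n)) (ℕP.+-monoʳ-≤ (2 ℕ.^ n) (ℕP.m≤m+n (2 ℕ.^ n) 0))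

-- The factor n + 1 is at most (t + 1)2^ℓ, and t + 1 ≤ 2^(ℓ(2t - 7)); the exponents 6ℓ(t + 1), ℓ(2t
-- - 7) and ℓ add up to exactly 8tℓ. The hypotheses on `t` and `ℓ` make 2t - 7 positive and ℓ(2t -
-- 7) at least t.
count-bound : ∀ {ℓ t n} → 4 ℕ.≤ ℓ → 4 ℕ.≤ t → n ℕ.< suc t ℕ.* 2 ℕ.^ ℓ →
              2 ℕ.^ (6 ℕ.* ℓ ℕ.* suc t) ℕ.* suc n ℕ.≤ 2 ℕ.^ (8 ℕ.* t ℕ.* ℓ)
count-bound {ℓ} {t} {n} 4≤ℓ 4≤t n< = begin
  2 ℕ.^ e ℕ.* suc n
    ≤⟨ ℕP.*-monoʳ-≤ (2 ℕ.^ e) (ℕP.≤-trans n< (ℕP.*-monoˡ-≤ (2 ℕ.^ ℓ) t<)) ⟩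
  2 ℕ.^ e ℕ.* (2 ℕ.^ (ℓ ℕ.* k) ℕ.* 2 ℕ.^ ℓ)
    ≡⟨ ≡.cong (2 ℕ.^ e ℕ.*_) (≡.sym (ℕP.^-distribˡ-+-* 2 (ℓ ℕ.* k) ℓ)) ⟩
  2 ℕ.^ e ℕ.* 2 ℕ.^ (ℓ ℕ.* k ℕ.+ ℓ)
    ≡⟨ ℕP.^-distribˡ-+-* 2 e (ℓ ℕ.* k ℕ.+ ℓ) ⟨
  2 ℕ.^ (e ℕ.+ (ℓ ℕ.* k ℕ.+ ℓ))
    ≡⟨ ≡.cong (2 ℕ.^_) exponents ⟩
  2 ℕ.^ (8 ℕ.* t ℕ.* ℓ)
    ∎
  where
  open ℕP.≤-Reasoning
  open +-*-Solver
  a e k : ℕ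
  a = t ℕ.∸ 4
  e = 6 ℕ.* ℓ ℕ.* suc t
  k = 1 ℕ.+ 2 ℕ.* a
  t≡ : 4 ℕ.+ a ≡ t
  t≡ = ℕP.m+[n∸m]≡n 4≤t
  t< : suc t ℕ.≤ 2 ℕ.^ (ℓ ℕ.* k)
  t< = ℕP.≤-trans (n<2^n t) (ℕP.^-monoʳ-≤ 2 (begin
    t  ≡⟨ t≡ ⟨
    4 ℕ.+ a  ≤⟨ ℕP.m≤m+n (4 ℕ.+ a) (7 ℕ.* a) ⟩
    4 ℕ.+ a ℕ.+ 7 ℕ.* a  ≡⟨ solve 1 (λ a → con 4 :+ a :+ con 7 :* a := con 4 :* (con 1 :+ con 2 :* a)) ≡.refl a ⟩
    4 ℕ.* k  ≤⟨ ℕP.*-monoˡ-≤ k 4≤ℓ ⟩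
    ℓ ℕ.* k  ∎))
  exponents : e ℕ.+ (ℓ ℕ.* k ℕ.+ ℓ) ≡ 8 ℕ.* t ℕ.* ℓ
  exponents = ≡.subst (λ t → 6 ℕ.* ℓ ℕ.* suc t ℕ.+ (ℓ ℕ.* k ℕ.+ ℓ) ≡ 8 ℕ.* t ℕ.* ℓ) t≡
    (solve 2 (λ l a → con 6 :* l :* (con 5 :+ a) :+ (l :* (con 1 :+ con 2 :* a) :+ l) := con 8 :* (con 4 :+ a) :* l) ≡.refl ℓ a)

nonempty : ∀ {N} (A : Subset N) → 1 ℕ.≤ ∣ A ∣ → ∃ λ v → lookup A v ≡ true
nonempty (inside ∷ A)  _  = zero , ≡.refl
nonempty (outside ∷ A) 1≤ with nonempty A 1≤
... | v , Av = suc v , Av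

-- Containers for edges of size 1, and for larger edges.

module _ (em : ExcludedMiddle 0ℓ) (ℝ : Reals) where
  open Reals ℝ hiding (zero)
  open OrderedField ℝ

  module Containers {N : ℕ} (H : Hypergraph N)
    (p q° R η : Carrier) (0<p : 0# < p) (0<q° : 0# < q°) (0<R : 0# < R) (0<η : 0# < η) where
    open Sums ℝ
    open Unfolding ℝ
    open ≤R

    Rejected : Subset N → Set
    Rejected L = ¬ Janson ℝ (H [ L ]) (p / q°) (η * R)

    Accept : Subset N → Set
    Accept X = ¬ Janson ℝ (H [ X ]) p R

    record Solution (c : ℕ) : Set where
      field
        Xs        : List (Subset N)
        Xs-length : length Xs ℕ.≤ c
        Xs-accept : All (λ X → T (X ⊆ᵇ V H) × Accept X) Xs
        Xs-cover  : ∀ L → T (L ⊆ᵇ V H) → Rejected L → Any (λ X → T (L ⊆ᵇ X)) Xs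

    module Singletons (uniform : Uniform 1 H) where

      private
        covered : Fin N → Set
        covered v = ∃ λ A → T (E H A) × lookup A v ≡ true

        -- A rejected set contains no edge, so the vertices covered by no edge form one container
        -- for all rejected sets.
        X : Subset N
        X = tabulate (λ v → lookup (V H) v ∧ not (does (em {covered v})))

        lookup-X : ∀ v → lookup X v ≡ lookup (V H) v ∧ not (does (em {covered v}))
        lookup-X v = VecP.lookup∘tabulate _ v

        X⊆V : T (X ⊆ᵇ V H)
        X⊆V = lookup-⊆ᵇ X (V H) (λ v eq → BoolP.∧-conicalˡ (lookup (V H) v) _ (≡.trans (≡.sym (lookup-X v)) eq))

        X-uncovered : ∀ v → lookup X v ≡ true → ¬ covered v
        X-uncovered v eq cov with em {covered v} | BoolP.∧-conicalʳ (lookup (V H) v) _ (≡.trans (≡.sym (lookup-X v)) eq)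
        ... | yes _   | ()
        ... | no ¬cov | _ = ¬cov cov

        same-vertex : ∀ (A : Subset N) → ∣ A ∣ ≡ 1 → ∀ {v w} → lookup A v ≡ true → lookup A w ≡ true → v ≡ w
        same-vertex A ∣A∣≡1 {v} {w} Av Aw with v FinP.≟ w
        ... | yes v≡w = v≡w
        ... | no  v≢w = ⊥-elim (ℕP.<⇒≱ (ℕ.s≤s (ℕ.s≤s ℕ.z≤n)) (≡.subst (2 ℕ.≤_) ∣A∣≡1
          (length-unique A {v ∷ w ∷ []} ((v≢w ∷ []) ∷ ([] ∷ [])) (Av ∷ Aw ∷ []))))

        no-edges : ∀ A → E (H [ X ]) A ≡ false
        no-edges A with E (H [ X ]) A in eq
        ... | false = ≡.refl
        ... | true with Equivalence.to (BoolP.T-∧ {E H A}) (≡.subst T (≡.trans (≡.sym eq) (∈-[] H X A)) tt)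
        ...   | A∈E , A⊆X with nonempty A (ℕP.≤-reflexive (≡.sym (uniform A A∈E)))
        ...     | v , Av = ⊥-elim (X-uncovered v (⊆ᵇ-lookup A X A⊆X v Av) (A , A∈E , Av))

        X-accept : Accept X
        X-accept janson = 0≉1 (trans (sym (trans (sum-cong (subsets N) (λ A → ν-edges A (no-edges A))) (sum-0 (subsets N)))) ν-total)
          where open Measure (normalise (H [ X ]) 0<p 0<R janson)

        -- No edge of size 1 contains two vertices, so Λ vanishes, and a single edge makes the right
        -- side of the Janson inequality positive.
        edge⇒janson : ∀ L A → T (E H A) → T (A ⊆ᵇ L) → Janson ℝ (H [ L ]) (p / q°) (η * R)
        edge⇒janson L A A∈E A⊆L = ν , (λ _ _ → 0≤1) ,
          ≤-<-trans (≤-reflexive (trans (Λ≈ (H [ L ]) ν 0<p/q°) (trans (sum-cong (subsets N) term≈0) (sum-0 (subsets N)))))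
            (0<-* (^-pos 2 0<e) (0<⁻¹ (0<-* 0<η 0<R)))
          where
          open Weights ℝ (H [ L ])
          ν : Subset N → Carrier
          ν _ = 1#

          0<p/q° : 0# < p / q°
          0<p/q° = 0<-* 0<p (0<⁻¹ 0<q°)

          0<e : 0# < e ν
          0<e = <-≤-trans 0<1 (begin
            1#  ≈⟨ *-identityˡ 1# ⟨
            1# * 1#  ≈⟨ *-congʳ (one (≡.subst T (≡.sym (∈-[] H L A)) (Equivalence.from (BoolP.T-∧ {E H A}) (A∈E , A⊆L)))) ⟩
            onEdges (H [ L ]) ν A  ≤⟨ sum-term (∈-subsets A) (λ B → *-nonneg (0≤ind (E (H [ L ]) B)) 0≤1) ⟩
            sumOver (subsets N) (onEdges (H [ L ]) ν)  ≈⟨ e≈ (H [ L ]) ν ⟨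
            e ν  ∎)
            where
            one : ∀ {c} → T c → 1# ≈ ind c
            one {true} _ = refl

          cod≈0 : ∀ S → 2 ℕ.≤ ∣ S ∣ → codegree (H [ L ]) ν S ≈ 0#
          cod≈0 S 2≤∣S∣ = trans (sum-cong (subsets N) zero-term) (sum-0 (subsets N))
            where
            zero-term : ∀ B → ind (S ⊆ᵇ B) * onEdges (H [ L ]) ν B ≈ 0#
            zero-term B with S ⊆ᵇ B in S⊆B | E H B in EB
            ... | false | _     = zeroˡ _
            ... | true  | false = trans (*-identityˡ _) (zeroˡ _)
            ... | true  | true  = ⊥-elim (ℕP.<⇒≱ 2≤∣S∣ (≡.subst (∣ S ∣ ℕ.≤_) (uniform B (≡.subst T (≡.sym EB) tt)) (⊆ᵇ⇒∣∣≤ S B (≡.subst T (≡.sym S⊆B) tt))))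

          term≈0 : ∀ S → ind (S ⊆ᵇ L) * (ind (2 ℕ.≤ᵇ ∣ S ∣) * (((p / q°) ⁻¹) ^ ∣ S ∣ * (codegree (H [ L ]) ν S * codegree (H [ L ]) ν S))) ≈ 0#
          term≈0 S with 2 ℕ.≤ᵇ ∣ S ∣ in eq
          ... | false = trans (*-congˡ (zeroˡ _)) (zeroʳ _)
          ... | true  = trans (*-congˡ (trans (*-congˡ (trans (*-congˡ (trans (*-congʳ cod) (zeroˡ _))) (zeroʳ _))) (zeroʳ _))) (zeroʳ _)
            where
            cod : codegree (H [ L ]) ν S ≈ 0#
            cod = cod≈0 S (ℕP.≤ᵇ⇒≤ 2 ∣ S ∣ (≡.subst T (≡.sym eq) tt))

        X-covers : ∀ L → T (L ⊆ᵇ V H) → Rejected L → T (L ⊆ᵇ X)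
        X-covers L L⊆V rejected = lookup-⊆ᵇ L X (λ v Lv → ≡.trans (lookup-X v) (≡.cong₂ (λ x y → x ∧ not y)
          (⊆ᵇ-lookup L (V H) L⊆V v Lv) (uncovered v Lv)))
          where
          uncovered : ∀ v → lookup L v ≡ true → does (em {covered v}) ≡ false
          uncovered v Lv with em {covered v}
          ... | no _ = ≡.refl
          ... | yes (A , A∈E , Av) = ⊥-elim (rejected (edge⇒janson L A A∈E
            (lookup-⊆ᵇ A L (λ w Aw → ≡.subst (λ w → lookup L w ≡ true) (same-vertex A (uniform A A∈E) Av Aw) Lv))))

      singletons : Solution 1
      singletons = record
        { Xs = X ∷ [] ; Xs-length = ℕP.≤-refl ; Xs-accept = (X⊆V , X-accept) ∷ []
        ; Xs-cover = λ L L⊆V rejected → here (X-covers L L⊆V rejected) }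

    whole : Accept (V H) → Solution 1
    whole accept = record
      { Xs = V H ∷ [] ; Xs-length = ℕP.≤-refl ; Xs-accept = (lookup-⊆ᵇ (V H) (V H) (λ _ eq → eq) , accept) ∷ []
      ; Xs-cover = λ L L⊆V _ → here L⊆V }

    module General (s : ℕ) (2≤s : 2 ℕ.≤ s) (uniform : Uniform s H) (1≤n : 1 ℕ.≤ ∣ V H ∣)
      (pn≤64R : p * ι ∣ V H ∣ ≤ ι 64 * R) (η-eq : ι 4 ^ s * η * ι 4 ≈ 1#)
      (1024s²p≤q° : ι 1024 * (ι s * ι s) * p ≤ q°) (16q°≤1 : ι 16 * q° ≤ 1#) where

      private
        n : ℕ
        n = ∣ V H ∣

        half : Carrier
        half = ι 2 ⁻¹

        2*half≈1 : ι 2 * half ≈ 1#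
        2*half≈1 = 0<⇒*⁻¹≈1 (0<ι 1)

        0≤half : 0# ≤ half
        0≤half = ⁻¹-nonneg (0<ι 1)

        2^k*half^k≈1 : ∀ k → ι 2 ^ k * half ^ k ≈ 1#
        2^k*half^k≈1 k = trans (sym (^-distrib-* (ι 2) half k)) (trans (^-congˡ k 2*half≈1) (1^n≈1 k))

        ι-2^ : ∀ k → ι (2 ℕ.^ k) ≈ ι 2 ^ k
        ι-2^ zero    = refl
        ι-2^ (suc k) = trans (ι-* 2 (2 ℕ.^ k)) (*-congˡ (ι-2^ k))

        Scale : Set
        Scale = ∃ λ ℓ → 4 ℕ.≤ ℓ × half ^ ℓ ≤ q° × q° ≤ ι 2 * half ^ ℓ

        -- Dyadic rounding: `j` grows until 2^(-j) ≤ q°. If that fails at `j`, then q° ≤ 2^(-j),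
        -- which is twice 2^(-(j + 1)) and hence the invariant for `j + 1`.
        search : ∀ k j → 4 ℕ.≤ j → q° ≤ ι 2 * half ^ j → half ^ (j ℕ.+ k) ≤ q° → Scale
        search zero    j 4≤j q°≤ ≤q° = j , 4≤j , ≤-trans (≤-reflexive (reflexive (≡.cong (half ^_) (≡.sym (ℕP.+-identityʳ j))))) ≤q° , q°≤
        search (suc k) j 4≤j q°≤ ≤q° with total (half ^ j) q°
        ... | inj₁ half^j≤q° = j , 4≤j , half^j≤q° , q°≤
        ... | inj₂ q°≤half^j = search k (suc j) (ℕP.m≤n⇒m≤1+n 4≤j)
          (≤-trans q°≤half^j (≤-reflexive (sym (trans (sym (*-assoc _ _ _)) (trans (*-congʳ 2*half≈1) (*-identityˡ _))))))
          (≤-trans (≤-reflexive (reflexive (≡.cong (half ^_) (≡.sym (ℕP.+-suc j k))))) ≤q°)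

        scale : ι 8 ≤ q° * ι n → Scale
        scale 8≤q°n = search n 4 ℕP.≤-refl q°≤ ≤q°
          where
          q°≤ : q° ≤ ι 2 * half ^ 4
          q°≤ = *-cancelˡ-≤ (0<ι 15) (begin
            ι 16 * q°  ≤⟨ 16q°≤1 ⟩
            1#  ≤⟨ ι-mono {1} {2} (ℕ.s≤s ℕ.z≤n) ⟩
            ι 2  ≈⟨ *-identityʳ _ ⟨
            ι 2 * 1#  ≈⟨ *-congˡ (2^k*half^k≈1 4) ⟨
            ι 2 * (ι 2 ^ 4 * half ^ 4)  ≈⟨ solve 1 (λ h → con (+ 2) :* (con (+ 2) :^ 4 :* h) := con (+ 16) :* (con (+ 2) :* h)) refl (half ^ 4) ⟩
            ι 16 * (ι 2 * half ^ 4)  ∎)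
          -- The search is finite because q°n ≥ 1 and n ≤ 2^n force q° ≥ 2^(-n).
          ≤q° : half ^ (4 ℕ.+ n) ≤ q°
          ≤q° = begin
            half ^ (4 ℕ.+ n)  ≤⟨ ^-antitone 0≤half half≤1 (ℕP.m≤n+m n 4) ⟩
            half ^ n  ≈⟨ *-identityʳ _ ⟨
            half ^ n * 1#  ≤⟨ *-monoʳ-≤ (^-nonneg n 0≤half) (≤-trans (ι-mono {1} {8} (ℕ.s≤s ℕ.z≤n)) 8≤q°n) ⟩
            half ^ n * (q° * ι n)  ≈⟨ solve 3 (λ h q n → h :* (q :* n) := q :* (n :* h)) refl (half ^ n) q° (ι n) ⟩
            q° * (ι n * half ^ n)  ≤⟨ *-monoʳ-≤ (<⇒≤ 0<q°) (*-monoˡ-≤ (^-nonneg n 0≤half) (≤-trans (ι-mono (ℕP.<⇒≤ (n<2^n n))) (≤-reflexive (ι-2^ n)))) ⟩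
            q° * (ι 2 ^ n * half ^ n)  ≈⟨ trans (*-congˡ (2^k*half^k≈1 n)) (*-identityʳ _) ⟩
            q°  ∎
            where
            half≤1 : half ≤ 1#
            half≤1 = *-cancelˡ-≤ (0<ι 1) (≤-trans (≤-reflexive 2*half≈1) (≤-trans (ι-mono {1} {2} (ℕ.s≤s ℕ.z≤n)) (≤-reflexive (sym (*-identityʳ _)))))

      module _ (8≤q°n : ι 8 ≤ q° * ι n) (ℓ : ℕ) (4≤ℓ : 4 ℕ.≤ ℓ) (q≤q° : (ι 2 ⁻¹) ^ ℓ ≤ q°) (q°≤2q : q° ≤ ι 2 * (ι 2 ⁻¹) ^ ℓ) where
        private
          open Parameters ℝ s ℓ 2≤s 4≤ℓ hiding (half; 2*half≈1)

          instance
            A≢0 : ℕ.NonZero A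
            A≢0 = ℕ.>-nonZero 1≤A

          -- The constant 2^10 splits as 16 · 32 · 2: the 16 from `q₀`, the 32 for the second
          -- moment, and the 2 lost by rounding `q°`.
          32p≤q₀ : ι 32 * p ≤ q₀
          32p≤q₀ = *-cancelˡ-≤ 0<ιK (begin
            ι K * (ι 32 * p)
              ≈⟨ *-congʳ (trans (ι-* A g) (*-congˡ (trans (ι-* 16 (s ℕ.* s)) (*-congˡ (ι-* s s))))) ⟩
            ι A * (ι 16 * (ι s * ι s)) * (ι 32 * p)
              ≈⟨ solve 3 (λ a s p → a :* (con (+ 16) :* (s :* s)) :* (con (+ 32) :* p) := a :* (con (+ 512) :* (s :* s) :* p)) refl (ι A) (ι s) p ⟩
            ι A * (ι 512 * (ι s * ι s) * p)
              ≤⟨ *-monoʳ-≤ (0≤ι A) (*-cancelˡ-≤ (0<ι 1) (begin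
                   ι 2 * (ι 512 * (ι s * ι s) * p)  ≈⟨ solve 2 (λ s p → con (+ 2) :* (con (+ 512) :* (s :* s) :* p) := con (+ 1024) :* (s :* s) :* p) refl (ι s) p ⟩
                   ι 1024 * (ι s * ι s) * p  ≤⟨ 1024s²p≤q° ⟩
                   q°  ≤⟨ q°≤2q ⟩
                   ι 2 * q  ∎)) ⟩
            ι A * q
              ≈⟨ trans A*q≈1 (sym K*q₀≈1) ⟩
            ι K * q₀
              ∎)

          4A≤n : 4 ℕ.* A ℕ.≤ n
          4A≤n = ι-cancel-≤ (begin
            ι (4 ℕ.* A)  ≈⟨ ι-* 4 A ⟩
            ι 4 * ι A  ≤⟨ *-monoˡ-≤ (0≤ι A) (*-cancelˡ-≤ (0<ι 1) (begin
                ι 2 * ι 4  ≈⟨ solve 0 (con (+ 2) :* con (+ 4) := con (+ 8)) refl ⟩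
                ι 8  ≤⟨ 8≤q°n ⟩
                q° * ι n  ≤⟨ *-monoˡ-≤ (0≤ι n) q°≤2q ⟩
                ι 2 * q * ι n  ≈⟨ *-assoc _ _ _ ⟩
                ι 2 * (q * ι n)  ∎)) ⟩
            q * ι n * ι A  ≈⟨ solve 3 (λ q n a → q :* n :* a := n :* (a :* q)) refl q (ι n) (ι A) ⟩
            ι n * (ι A * q)  ≈⟨ trans (*-congˡ A*q≈1) (*-identityʳ _) ⟩
            ι n  ∎)

          t : ℕ
          -- The integer part of qn, for the rounded q.
          t = n ℕ./ A

          tA≤n : t ℕ.* A ℕ.≤ n
          tA≤n = DivMod.m/n*n≤m n A

          n<[1+t]A : n ℕ.< suc t ℕ.* A
          n<[1+t]A = ≡.subst (ℕ._< suc t ℕ.* A) (≡.sym (DivMod.m≡m%n+[m/n]*n n A)) (ℕP.+-monoˡ-< (t ℕ.* A) (DivMod.m%n<n n A))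

          4≤t : 4 ℕ.≤ t
          4≤t = ℕP.≤-pred (ℕP.*-cancelʳ-< A 4 (suc t) (ℕP.≤-<-trans 4A≤n n<[1+t]A))

          -- Chosen so that `m′` rounds halve the uncovered list: b^n = y^(3gℓn), n ≤ (t + 1)A and
          -- y^(K/2) ≥ 1/2 together give b^n ≥ 2^(-6ℓ(t + 1)).
          e′ m′ : ℕ
          e′ = 6 ℕ.* ℓ ℕ.* suc t
          m′ = 2 ℕ.^ e′

          h J : ℕ
          h = 2 ℕ.^ (ℓ ℕ.∸ 1)
          J = g ℕ.* h

          2h≡A : 2 ℕ.* h ≡ A
          2h≡A = ≡.cong (2 ℕ.^_) (ℕP.m+[n∸m]≡n {1} {ℓ} (ℕP.≤-trans (ℕ.s≤s ℕ.z≤n) 4≤ℓ))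

          half≤y^J : half ≤ y ^ J
          half≤y^J = *-cancelˡ-≤ (0<ι 1) (begin
            ι 2 * half  ≈⟨ 2*half≈1 ⟩
            1#  ≈⟨ solve 0 (con (+ 1) := con (+ 2) :- con (+ 1)) refl ⟩
            ι 2 - 1#  ≈⟨ +-congˡ (-‿cong K*q₀≈1) ⟨
            ι 2 - ι K * q₀  ≈⟨ +-congˡ (-‿cong (*-congʳ ιK≈)) ⟩
            ι 2 - ι 2 * ι J * q₀  ≈⟨ solve 2 (λ j q → con (+ 2) :- con (+ 2) :* j :* q := con (+ 2) :* (con (+ 1) :- j :* q)) refl (ι J) q₀ ⟩
            ι 2 * (1# - ι J * q₀)  ≤⟨ *-monoʳ-≤ (0≤ι 2) (bernoulli⁻ J (<⇒≤ 0<q₀) (<⇒≤ q₀<1)) ⟩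
            ι 2 * y ^ J  ∎)
            where
            open +-*-Solver using () renaming (solve to solveℕ; _:=_ to _:≡_; _:*_ to _⊗_; con to lit)
            ιK≈ : ι K ≈ ι 2 * ι J
            ιK≈ = trans (reflexive (≡.cong ι (≡.trans (≡.cong (ℕ._* g) (≡.sym 2h≡A))
              (solveℕ 2 (λ g h → (lit 2 ⊗ h) ⊗ g :≡ lit 2 ⊗ (g ⊗ h)) ≡.refl g h)))) (ι-* 2 J)

          β : Carrier
          β = b ^ n

          exponent : ℕ
          exponent = g ℕ.* ℓ ℕ.* 3 ℕ.* n

          β≈ : β ≈ y ^ exponent
          β≈ = begin-equality
            ((u ^ ℓ) ^ 3) ^ n  ≈⟨ ^-congˡ n (^-congˡ 3 (^-assocʳ y g ℓ)) ⟩
            ((y ^ (g ℕ.* ℓ)) ^ 3) ^ n  ≈⟨ ^-congˡ n (^-assocʳ y (g ℕ.* ℓ) 3) ⟩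
            (y ^ (g ℕ.* ℓ ℕ.* 3)) ^ n  ≈⟨ ^-assocʳ y (g ℕ.* ℓ ℕ.* 3) n ⟩
            y ^ exponent  ∎

          exponent≤ : exponent ℕ.≤ J ℕ.* e′
          exponent≤ = ℕP.≤-trans (ℕP.*-monoʳ-≤ (g ℕ.* ℓ ℕ.* 3) (ℕP.<⇒≤ n<[1+t]A)) (ℕP.≤-reflexive
            (≡.trans (≡.cong (λ a → g ℕ.* ℓ ℕ.* 3 ℕ.* (suc t ℕ.* a)) (≡.sym 2h≡A))
              (solveℕ 4 (λ g l t h → g ⊗ l ⊗ lit 3 ⊗ (t ⊗ (lit 2 ⊗ h)) :≡ g ⊗ h ⊗ (lit 6 ⊗ l ⊗ t)) ≡.refl g ℓ (suc t) h)))
            where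
            open +-*-Solver using () renaming (solve to solveℕ; _:=_ to _:≡_; _:*_ to _⊗_; con to lit)

          1≤m′β : 1# ≤ ι m′ * β
          1≤m′β = begin
            1#  ≈⟨ 2^k*half^k≈1 e′ ⟨
            ι 2 ^ e′ * half ^ e′  ≤⟨ *-monoʳ-≤ (^-nonneg e′ (0≤ι 2)) (^-mono-≤ e′ 0≤half half≤y^J) ⟩
            ι 2 ^ e′ * (y ^ J) ^ e′  ≈⟨ *-cong (sym (ι-2^ e′)) (^-assocʳ y J e′) ⟩
            ι m′ * y ^ (J ℕ.* e′)  ≤⟨ *-monoʳ-≤ (0≤ι m′) (^-antitone (<⇒≤ 0<y) (<⇒≤ y<1) exponent≤) ⟩
            ι m′ * y ^ exponent  ≈⟨ *-congˡ β≈ ⟨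
            ι m′ * β  ∎

          0≤β : 0# ≤ β
          0≤β = ^-nonneg n (<⇒≤ 0<b)

          β≤1 : β ≤ 1#
          β≤1 = ^-≤1 n (<⇒≤ 0<b) b≤1

          -- The same device as for `y ^ K`: (1 + β)^m′ is at least 1 + m′β ≥ 2, and (1 - β²)^m′ is
          -- at most 1.
          [1-β]^m′≤half : (1# - β) ^ m′ ≤ half
          [1-β]^m′≤half = *-cancelˡ-≤ (0<ι 1) (begin
            ι 2 * (1# - β) ^ m′  ≤⟨ *-monoˡ-≤ (^-nonneg m′ (x≤y⇒0≤y-x β≤1)) (+-monoʳ-≤ 1# 1≤m′β) ⟩
            (1# + ι m′ * β) * (1# - β) ^ m′  ≤⟨ *-monoˡ-≤ (^-nonneg m′ (x≤y⇒0≤y-x β≤1)) (bernoulli m′ 0≤β) ⟩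
            (1# + β) ^ m′ * (1# - β) ^ m′  ≈⟨ ^-distrib-* (1# + β) (1# - β) m′ ⟨
            ((1# + β) * (1# - β)) ^ m′  ≤⟨ ^-≤1 m′ (*-nonneg (0≤-+ 0≤1 0≤β) (x≤y⇒0≤y-x β≤1)) (begin
                (1# + β) * (1# - β)  ≈⟨ solve 1 (λ c → (con (+ 1) :+ c) :* (con (+ 1) :- c) := con (+ 1) :- c :* c) refl β ⟩
                1# - β * β  ≤⟨ x-y≤x (0≤x*x β) ⟩
                1#  ∎) ⟩
            1#  ≈⟨ 2*half≈1 ⟨
            ι 2 * half  ∎)

          Target : Subset N → Set
          Target L = T (L ⊆ᵇ V H) × Rejected L

          𝓛 : List (Subset N)
          𝓛 = filter (λ L → em {Target L}) (subsets N)

          𝓛-targets : All Target 𝓛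
          𝓛-targets = AllP.all-filter (λ L → em {Target L}) (subsets N)

          𝓛-size : ι (length 𝓛) ≤ ι 2 ^ n
          𝓛-size = begin
            ι (length 𝓛)
              ≈⟨ length-filter (λ L → em {Target L}) (subsets N) ⟩
            sumOver (subsets N) (λ L → ind (does (em {Target L})))
              ≤⟨ sum-mono (subsets N) (λ L → ≤-trans (bound L) (≤-reflexive (sym (trans (*-congˡ (1^n≈1 ∣ L ∣)) (*-identityʳ _))))) ⟩
            sumOver (subsets N) (λ L → ind (L ⊆ᵇ V H) * 1# ^ ∣ L ∣)
              ≈⟨ sum-subsets-⊆ (V H) 1# ⟩
            ι 2 ^ n
              ∎
            where
            bound : ∀ L → ind (does (em {Target L})) ≤ ind (L ⊆ᵇ V H)
            bound L with em {Target L}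
            ... | no _          = 0≤ind (L ⊆ᵇ V H)
            ... | yes (L⊆V , _) = ind-mono true (L ⊆ᵇ V H) (λ _ → L⊆V)

          open Container em ℝ s ℓ 2≤s 4≤ℓ H uniform p q° R η 0<p 0<q° 0<R 0<η q°≤2q 32p≤q₀ n 1≤n pn≤64R η-eq using (¬janson)
          open Covering em ℝ (V H) b 0<b b≤1 using (Rounds; rounds)

          covering : Rounds Accept Rejected (λ X X⊆V 𝓜 → ¬janson X (⊆ᵇ⇒∣∣≤ X (V H) X⊆V) 𝓜) (m′ ℕ.* suc n) 𝓛
          covering = rounds Accept Rejected _ (m′ ℕ.* suc n) 𝓛 (All.map proj₁ 𝓛-targets) (All.map proj₂ 𝓛-targets)

          open Rounds covering

          -- There are at most 2^n targets, and the rounds amount to n + 1 halvings, so fewer than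
          -- one set is left.
          rest-empty : ∀ {L} → ¬ (L ∈ rest)
          rest-empty {L} L∈rest = <⇒≱ (x<1+x 1#) (begin
            ι 2  ≈⟨ *-identityʳ _ ⟨
            ι 2 * 1#  ≤⟨ *-monoʳ-≤ (0≤ι 2) (ι-mono {1} (∈-length L∈rest)) ⟩
            ι 2 * ι (length rest)  ≤⟨ *-monoʳ-≤ (0≤ι 2) (≤-trans rest-size (*-monoʳ-≤ (^-nonneg (m′ ℕ.* suc n) (x≤y⇒0≤y-x β≤1)) 𝓛-size)) ⟩
            ι 2 * ((1# - β) ^ (m′ ℕ.* suc n) * ι 2 ^ n)  ≈⟨ *-congˡ (*-congʳ (^-assocʳ (1# - β) m′ (suc n))) ⟨
            ι 2 * (((1# - β) ^ m′) ^ suc n * ι 2 ^ n)  ≤⟨ *-monoʳ-≤ (0≤ι 2) (*-monoˡ-≤ (^-nonneg n (0≤ι 2)) (^-mono-≤ (suc n) (^-nonneg m′ (x≤y⇒0≤y-x β≤1)) [1-β]^m′≤half)) ⟩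
            ι 2 * (half ^ suc n * ι 2 ^ n)  ≈⟨ solve 3 (λ h x y → con (+ 2) :* (h :* x :* y) := (con (+ 2) :* h) :* (y :* x)) refl half (half ^ n) (ι 2 ^ n) ⟩
            (ι 2 * half) * (ι 2 ^ n * half ^ n)  ≈⟨ *-cong 2*half≈1 (2^k*half^k≈1 n) ⟩
            1# * 1#  ≈⟨ *-identityˡ 1# ⟩
            1#  ∎)

          solution : Solution (m′ ℕ.* suc n)
          solution = record
            { Xs = Xs ; Xs-length = Xs-length ; Xs-accept = Xs-accept
            ; Xs-cover = λ L L⊆V rejected → found (covers (∈-filter⁺ (λ L → em {Target L}) (∈-subsets L) (L⊆V , rejected))) }
            where
            found : ∀ {L} → Any (λ X → T (L ⊆ᵇ X)) Xs ⊎ L ∈ rest → Any (λ X → T (L ⊆ᵇ X)) Xs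
            found (inj₁ any)    = any
            found (inj₂ L∈rest) = ⊥-elim (rest-empty L∈rest)

        -- The witness for `k` is `t`, the integer part of qn, so the exponent of the bound stays
        -- natural. The base comes from q° ≤ 2 · 2^(-ℓ), that is, 2^ℓ ≤ 2/q°.
        bounded-solution : ∃ λ k → ι k ≤ q° * ι ∣ V H ∣ × ∃ λ c → Solution c × ι c ≤ (ι 2 / q°) ^ (8 ℕ.* k)
        bounded-solution = t , t≤ , m′ ℕ.* suc n , solution , (begin
          ι (m′ ℕ.* suc n)  ≤⟨ ι-mono (count-bound 4≤ℓ 4≤t n<[1+t]A) ⟩
          ι (2 ℕ.^ (8 ℕ.* t ℕ.* ℓ))  ≈⟨ trans (ι-2^ (8 ℕ.* t ℕ.* ℓ)) (trans (reflexive (≡.cong (ι 2 ^_) (ℕP.*-comm (8 ℕ.* t) ℓ))) (sym (^-assocʳ (ι 2) ℓ (8 ℕ.* t)))) ⟩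
          (ι 2 ^ ℓ) ^ (8 ℕ.* t)  ≤⟨ ^-mono-≤ (8 ℕ.* t) (^-nonneg ℓ (0≤ι 2)) 2^ℓ≤ ⟩
          (ι 2 / q°) ^ (8 ℕ.* t)  ∎)
          where
          t≤ : ι t ≤ q° * ι n
          t≤ = begin
            ι t  ≈⟨ trans (sym (*-identityʳ _)) (*-congˡ (sym A*q≈1)) ⟩
            ι t * (ι A * q)  ≈⟨ trans (sym (*-assoc _ _ _)) (*-congʳ (sym (ι-* t A))) ⟩
            ι (t ℕ.* A) * q  ≤⟨ *-mono-≤ (0≤ι (t ℕ.* A)) (<⇒≤ 0<q°) (ι-mono tA≤n) q≤q° ⟩
            ι n * q°  ≈⟨ *-comm _ _ ⟩
            q° * ι n  ∎
          2^ℓ≤ : ι 2 ^ ℓ ≤ ι 2 / q°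
          2^ℓ≤ = z≤x/y 0<q° (begin
            ι 2 ^ ℓ * q°  ≤⟨ *-monoʳ-≤ (^-nonneg ℓ (0≤ι 2)) q°≤2q ⟩
            ι 2 ^ ℓ * (ι 2 * q)  ≈⟨ solve 3 (λ a b c → a :* (b :* c) := b :* (a :* c)) refl (ι 2 ^ ℓ) (ι 2) q ⟩
            ι 2 * (ι 2 ^ ℓ * q)  ≈⟨ trans (*-congˡ (2^k*half^k≈1 ℓ)) (*-identityʳ _) ⟩
            ι 2  ∎)

      private
        -- The witness gives pn ≥ 1/512; with q° ≥ 2^10 s²p ≥ 2^12 p this yields q°n ≥ 8, the
        -- largeness that the counting needs.
        fromJanson : Janson ℝ (H [ V H ]) p R → ∃ λ k → ι k ≤ q° * ι ∣ V H ∣ × ∃ λ c → Solution c × ι c ≤ (ι 2 / q°) ^ (8 ℕ.* k)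
        fromJanson janson = fromScale (scale 8≤q°n)
          where
          1≤512pn : 1# ≤ ι 512 * (p * ι n)
          1≤512pn = VertexCount.1≤512pn ℝ (H [ V H ]) s 2≤s uniform′ p R 0<p 0<R n 1≤n ≡.refl pn≤64R (normalise (H [ V H ]) 0<p 0<R janson)
            where
            uniform′ : Uniform s (H [ V H ])
            uniform′ A A∈ = uniform A (proj₁ (Equivalence.to (BoolP.T-∧ {E H A}) A∈))

          8≤q°n : ι 8 ≤ q° * ι n
          8≤q°n = begin
            ι 8  ≈⟨ *-identityʳ _ ⟨
            ι 8 * 1#  ≤⟨ *-monoʳ-≤ (0≤ι 8) 1≤512pn ⟩
            ι 8 * (ι 512 * (p * ι n))  ≈⟨ solve 2 (λ p n → con (+ 8) :* (con (+ 512) :* (p :* n)) := con (+ 1024) :* con (+ 4) :* p :* n) refl p (ι n) ⟩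
            ι 1024 * ι 4 * p * ι n  ≤⟨ *-monoˡ-≤ (0≤ι n) (*-monoˡ-≤ (<⇒≤ 0<p) (*-monoʳ-≤ (0≤ι 1024)
                                                      (≤-trans (ι-mono (ℕP.*-mono-≤ 2≤s 2≤s)) (≤-reflexive (ι-* s s))))) ⟩
            ι 1024 * (ι s * ι s) * p * ι n  ≤⟨ *-monoˡ-≤ (0≤ι n) 1024s²p≤q° ⟩
            q° * ι n  ∎

          fromScale : Scale → ∃ λ k → ι k ≤ q° * ι ∣ V H ∣ × ∃ λ c → Solution c × ι c ≤ (ι 2 / q°) ^ (8 ℕ.* k)
          fromScale (ℓ , 4≤ℓ , q≤q° , q°≤2q) = bounded-solution 8≤q°n ℓ 4≤ℓ q≤q° q°≤2q

      general : ∃ λ k → ι k ≤ q° * ι ∣ V H ∣ × ∃ λ c → Solution c × ι c ≤ (ι 2 / q°) ^ (8 ℕ.* k)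
      general with em {Janson ℝ (H [ V H ]) p R}
      ... | no ¬janson = 0 , *-nonneg (<⇒≤ 0<q°) (0≤ι n) , 1 , whole ¬janson , ≤-refl
      ... | yes janson = fromJanson janson

-- From the real constants of the statement to numerals, and back.

theorem4p1 : ExcludedMiddle 0ℓ →
    (ℝ : Reals) → let open Reals ℝ in
    (s n : ℕ) → 1 ℕ.≤ s → s ℕ.≤ n →
    (p q R η : Carrier) → 0# < p → 0# < q → 0# < R → 0# < η →
    q ≤ 1# / fromℕ 16 →
    p ≤ q / (fromℕ 2 ^ 10 * fromℕ s ^ 2) →
    fromℕ 2 ^ℤ (ℤ.- (+ 6)) * p * fromℕ n ≤ R →
    η ≈ fromℕ 2 ^ℤ (ℤ.- (+ (2 ℕ.* s ℕ.+ 2))) →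
    {N : ℕ} (𝓗 : Hypergraph N) → Uniform s 𝓗 → ∣ V 𝓗 ∣ ≡ n →
    ∃ λ (𝓧 : Family N) →
    (∀ X → X ∈ᶠ 𝓧 → X ⊆ V 𝓗) ×
    fromℕ (card 𝓧) ≤ fromℕ 4 * (fromℕ 2 / q) ^ℝ (fromℕ 8 * q * fromℕ n) ×
    (∀ L → L ⊆ V 𝓗 → ¬ Janson ℝ (𝓗 [ L ]) (p / q) (η * R) → ∃ λ X → X ∈ᶠ 𝓧 × L ⊆ X) ×
    (∀ X → X ∈ᶠ 𝓧 → ¬ Janson ℝ (𝓗 [ X ]) p R)
theorem4p1 em ℝ s n 1≤s s≤n p q R η 0<p 0<q 0<R 0<η q≤ p≤ ≤R η≈ {N} 𝓗 uniform ≡.refl = conclude (solve′ s 1≤s uniform p≤ η≈)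
  where
  open Reals ℝ hiding (zero)
  open OrderedField ℝ
  open Unfolding ℝ using (^ℤ-neg)
  open FamilySize ℝ
  open RealPower ℝ
  open Containers em ℝ 𝓗 p q R η 0<p 0<q 0<R 0<η
  open ≤R

  0<fromℕ : ∀ k → 0# < fromℕ (suc k)
  0<fromℕ k = <-≤-trans (0<ι k) (≤-reflexive (sym (fromℕ≈ι (suc k))))

  16q≤1 : ι 16 * q ≤ 1#
  16q≤1 = begin
    ι 16 * q  ≈⟨ trans (*-comm _ _) (*-congˡ (sym (fromℕ≈ι 16))) ⟩
    q * fromℕ 16  ≤⟨ x≤z/y⇒x*y≤z (0<fromℕ 15) q≤ ⟩
    1#  ∎

  half-powers : ∀ k → fromℕ 2 ^ℤ (ℤ.- (+ k)) ≈ (ι 2 ⁻¹) ^ k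
  half-powers k = trans (^ℤ-neg (0<fromℕ 1) k) (^-congˡ k (⁻¹-cong (fromℕ≈ι 2)))

  2^k*half^k≈1 : ∀ k → ι 2 ^ k * (ι 2 ⁻¹) ^ k ≈ 1#
  2^k*half^k≈1 k = trans (sym (^-distrib-* (ι 2) (ι 2 ⁻¹) k)) (trans (^-congˡ k (0<⇒*⁻¹≈1 (0<ι 1))) (1^n≈1 k))

  pn≤64R : p * ι n ≤ ι 64 * R
  pn≤64R = begin
    p * ι n  ≈⟨ trans (sym (*-identityˡ _)) (*-congʳ (sym (2^k*half^k≈1 6))) ⟩
    ι 2 ^ 6 * (ι 2 ⁻¹) ^ 6 * (p * ι n)  ≈⟨ *-cong (*-congˡ (sym (half-powers 6))) (*-congˡ (sym (fromℕ≈ι n))) ⟩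
    ι 2 ^ 6 * fromℕ 2 ^ℤ (ℤ.- (+ 6)) * (p * fromℕ n)  ≈⟨ solve 3 (λ h p n → con (+ 2) :^ 6 :* h :* (p :* n) := con (+ 64) :* (h :* p :* n)) refl (fromℕ 2 ^ℤ (ℤ.- (+ 6))) p (fromℕ n) ⟩
    ι 64 * (fromℕ 2 ^ℤ (ℤ.- (+ 6)) * p * fromℕ n)  ≤⟨ *-monoʳ-≤ (0≤ι 64) ≤R ⟩
    ι 64 * R  ∎

  Result : Set
  Result = ∃ λ k → ι k ≤ q * ι n × ∃ λ c → Solution c × ι c ≤ (ι 2 / q) ^ (8 ℕ.* k)

  solve′ : ∀ s → 1 ℕ.≤ s → Uniform s 𝓗 → p ≤ q / (fromℕ 2 ^ 10 * fromℕ s ^ 2) → η ≈ fromℕ 2 ^ℤ (ℤ.- (+ (2 ℕ.* s ℕ.+ 2))) → Result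
  solve′ (suc zero)    _ uniform _ _ = 0 , *-nonneg (<⇒≤ 0<q) (0≤ι n) , 1 , Singletons.singletons uniform , ≤-refl
  solve′ s@(suc (suc s′)) _ uniform p≤ η≈ = General.general s (ℕ.s≤s (ℕ.s≤s ℕ.z≤n)) uniform (ℕP.≤-trans 1≤s s≤n) pn≤64R η-eq 1024s²p≤q 16q≤1
    where
    1024s²p≤q : ι 1024 * (ι s * ι s) * p ≤ q
    1024s²p≤q = begin
      ι 1024 * (ι s * ι s) * p  ≈⟨ solve 2 (λ s p → con (+ 1024) :* (s :* s) :* p := p :* (con (+ 2) :^ 10 :* s :^ 2)) refl (ι s) p ⟩
      p * (ι 2 ^ 10 * ι s ^ 2)  ≈⟨ *-congˡ (*-cong (^-congˡ 10 (fromℕ≈ι 2)) (^-congˡ 2 (fromℕ≈ι s))) ⟨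
      p * (fromℕ 2 ^ 10 * fromℕ s ^ 2)  ≤⟨ x≤z/y⇒x*y≤z (0<-* (^-pos 10 (0<fromℕ 1)) (^-pos 2 (0<fromℕ (suc s′)))) p≤ ⟩
      q  ∎

    η-eq : ι 4 ^ s * η * ι 4 ≈ 1#
    η-eq = begin-equality
      ι 4 ^ s * η * ι 4  ≈⟨ solve 2 (λ x η → x :* η :* con (+ 4) := x :* con (+ 2) :^ 2 :* η) refl (ι 4 ^ s) η ⟩
      ι 4 ^ s * ι 2 ^ 2 * η  ≈⟨ *-cong (*-congʳ (trans (^-congˡ s (solve 0 (con (+ 4) := con (+ 2) :^ 2) refl)) (^-assocʳ (ι 2) 2 s))) (trans η≈ (half-powers (2 ℕ.* s ℕ.+ 2))) ⟩
      ι 2 ^ (2 ℕ.* s) * ι 2 ^ 2 * (ι 2 ⁻¹) ^ (2 ℕ.* s ℕ.+ 2)  ≈⟨ *-congʳ (^-homo-* (ι 2) (2 ℕ.* s) 2) ⟨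
      ι 2 ^ (2 ℕ.* s ℕ.+ 2) * (ι 2 ⁻¹) ^ (2 ℕ.* s ℕ.+ 2)  ≈⟨ 2^k*half^k≈1 (2 ℕ.* s ℕ.+ 2) ⟩
      1#  ∎

  conclude : Result → ∃ λ (𝓧 : Family N) →
    (∀ X → X ∈ᶠ 𝓧 → X ⊆ V 𝓗) ×
    fromℕ (card 𝓧) ≤ fromℕ 4 * (fromℕ 2 / q) ^ℝ (fromℕ 8 * q * fromℕ n) ×
    (∀ L → L ⊆ V 𝓗 → Rejected L → ∃ λ X → X ∈ᶠ 𝓧 × L ⊆ X) ×
    (∀ X → X ∈ᶠ 𝓧 → Accept X)
  conclude (k , k≤ , c , sol , c≤) = family Xs ,
    (λ X X∈ → ⊆ᵇ⇒⊆ X (V 𝓗) (proj₁ (∈-family⁻ Xs (All.lookup Xs-accept) X∈))) ,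
    size ,
    (λ L L⊆V rejected → found L (∈-family⁺ (Xs-cover L (⊆⇒⊆ᵇ L (V 𝓗) L⊆V) rejected))) ,
    (λ X X∈ → proj₂ (∈-family⁻ Xs (All.lookup Xs-accept) X∈))
    where
    open Solution sol

    found : ∀ L → (∃ λ X → X ∈ᶠ family Xs × T (L ⊆ᵇ X)) → ∃ λ X → X ∈ᶠ family Xs × L ⊆ X
    found L (X , X∈ , L⊆X) = X , X∈ , ⊆ᵇ⇒⊆ L X L⊆X

    a x : Carrier
    a = fromℕ 2 / q
    x = fromℕ 8 * q * fromℕ n

    x≈ : x ≈ ι 8 * q * ι n
    x≈ = *-cong (*-congʳ (fromℕ≈ι 8)) (fromℕ≈ι n)

    1≤a : 1# ≤ a
    1≤a = z≤x/y 0<q (begin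
      1# * q  ≤⟨ *-monoˡ-≤ (<⇒≤ 0<q) (ι-mono {1} {16} (ℕ.s≤s ℕ.z≤n)) ⟩
      ι 16 * q  ≤⟨ 16q≤1 ⟩
      1#  ≤⟨ ι-mono {1} {2} (ℕ.s≤s ℕ.z≤n) ⟩
      ι 2  ≈⟨ fromℕ≈ι 2 ⟨
      fromℕ 2  ∎)

    8k≤x : ι (8 ℕ.* k) ≤ x
    8k≤x = begin
      ι (8 ℕ.* k)  ≈⟨ ι-* 8 k ⟩
      ι 8 * ι k  ≤⟨ *-monoʳ-≤ (0≤ι 8) k≤ ⟩
      ι 8 * (q * ι n)  ≈⟨ trans (sym (*-assoc _ _ _)) (sym x≈) ⟩
      x  ∎

    -- Since 8q ≤ 1. A natural bound on the exponent ensures that the supremum defining `a ^ℝ x` is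
    -- over a bounded set.
    x≤n : x ≤ ι n
    x≤n = begin
      x  ≈⟨ x≈ ⟩
      ι 8 * q * ι n  ≤⟨ *-monoˡ-≤ (0≤ι n) (≤-trans (*-monoˡ-≤ (<⇒≤ 0<q) (ι-mono {8} {16} (ℕP.m≤m+n 8 8))) 16q≤1) ⟩
      1# * ι n  ≈⟨ *-identityˡ _ ⟩
      ι n  ∎

    size : fromℕ (card (family Xs)) ≤ fromℕ 4 * a ^ℝ x
    size = begin
      fromℕ (card (family Xs))  ≈⟨ fromℕ≈ι (card (family Xs)) ⟩
      ι (card (family Xs))  ≤⟨ card-family Xs ⟩
      _  ≤⟨ ι-mono Xs-length ⟩
      ι c  ≤⟨ c≤ ⟩
      (ι 2 / q) ^ (8 ℕ.* k)  ≈⟨ ^-congˡ (8 ℕ.* k) (*-congʳ (fromℕ≈ι 2)) ⟨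
      a ^ (8 ℕ.* k)  ≤⟨ power ⟩
      a ^ℝ x  ≈⟨ *-identityˡ _ ⟨
      1# * a ^ℝ x  ≤⟨ *-monoˡ-≤ (≤-trans (^-nonneg (8 ℕ.* k) (≤-trans 0≤1 1≤a)) power) (≤-trans (ι-mono {1} {4} (ℕ.s≤s ℕ.z≤n)) (≤-reflexive (sym (fromℕ≈ι 4)))) ⟩
      fromℕ 4 * a ^ℝ x  ∎
      where
      power : a ^ (8 ℕ.* k) ≤ a ^ℝ x
      power = ^≤^ℝ (8 ℕ.* k) n 1≤a 8k≤x x≤n
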